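{- Let $N\ge 1$ and let $\mathbf v_1=(s_1,t_1),\dots,\mathbf v_N=(s_N,t_N)\in\mathbb Z^2$ be fixed vectors whose second components $t_1,\dots,t_N$ are pairwise distinct. Let $M:=\max_{1\le j\le N}\|\mathbf v_j\|_\infty$. For a prime $p$ let \[ \mathcal G_N(p):=\bigcap_{j=1}^N\big\{(a,b)\in\mathbb Z^2: 0\le a\le p-1,\ 1\le b\le p-1,\ 0\le a+s_j\le p-1,\ 1\le b+t_j\le p-1\big\}, \] and for $(a,b)\in\mathcal G_N(p)$ let \[ \mathbf x_{a,b}(p):=\frac1p\big(A_{a+s_1,b+t_1},\dots,A_{a+s_N,b+t_N}\big)\in[0,1]^N . \] Then for every permutation $\sigma$ of $\{1,\dots,N\}$, \[ \#\big\{(a,b)\in\mathcal G_N(p): \mathbf x_{a,b}(p)\in T(\sigma,N)\big\}=\frac{p^2}{N!}+O_{M,N}\Big(p^{(2N+1)/(N+1)}(\log p)^{N/(N+1)}\Big), \] where the implied constant depends only on $M$ and $N$.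
   Context: For a prime $p$ and an integer $n$ with $\gcd(n,p)=1$, $\mathfrak q_p(n)$ denotes the unique representative in $\{0,1,\dots,p-1\}$ of the integer $\frac{n^{p-1}-1}{p}$ modulo $p$. The Fermat quotient matrix has entries $A_{a,b}:=\mathfrak q_p(ap+b)$ for $0\le a\le p-1$, $1\le b\le p-1$. For a permutation $\sigma$ of $\{1,\dots,N\}$, $T(\sigma,N):=\{(x_1,\dots,x_N)\in[0,1]^N: x_{\sigma(1)}<x_{\sigma(2)}<\cdots<x_{\sigma(N)}\}$. -}

module Defs where

open import Data.Nat as ℕ using (ℕ; zero; suc; _∸_; _^_; _/_; _%_)
import Data.Nat.Properties as ℕP
open import Data.Integer as ℤ using (ℤ; +_; ∣_∣)
import Data.Integer.Properties as ℤP
open import Data.Fin using (Fin; inject₁) renaming (suc to fsuc)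
open import Data.Fin.Properties using (all?)
open import Data.Fin.Permutation using (Permutation′; _⟨$⟩ʳ_)
open import Data.Product using (_×_; _,_; proj₁; proj₂)
open import Data.List using (List; length; filter; cartesianProduct; upTo)
open import Relation.Nullary using (Dec)
open import Relation.Nullary.Decidable using (_×-dec_)

-- Fermat quotient q_p(n) = ((n^(p-1) - 1)/p) mod p  (meaningful for gcd(n,p)=1, n ≥ 1).
fermatQuotient : ℕ → ℕ → ℕ
fermatQuotient zero    n = 0
fermatQuotient (suc k) n = ((n ^ k ∸ 1) / suc k) % suc k

A : ℕ → ℕ → ℕ → ℕ
A p a b = fermatQuotient p (a ℕ.* p ℕ.+ b)

-- The shift vectors v_j = (s_j , t_j), j ∈ {1..N} with N = suc n.
Shifts : ℕ → Set
Shifts n = Fin (suc n) → ℤ × ℤ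

InG : (p : ℕ) {n : ℕ} → Shifts n → ℕ → ℕ → Set
InG p {n} v a b =
  (a ℕ.< p) × ((1 ℕ.≤ b) × ((b ℕ.< p) ×
  (∀ j → ((+ 0) ℤ.≤ (+ a) ℤ.+ proj₁ (v j)) × (((+ a) ℤ.+ proj₁ (v j) ℤ.< + p) ×
          (((+ 1) ℤ.≤ (+ b) ℤ.+ proj₂ (v j)) × ((+ b) ℤ.+ proj₂ (v j) ℤ.< + p))))))

-- j-th coordinate of p · x_{a,b}(p), i.e. A_{a+s_j, b+t_j}
-- (the arguments are nonnegative on 𝒢_N(p), so ∣_∣ is the identity there)
entry : (p : ℕ) {n : ℕ} → Shifts n → ℕ → ℕ → Fin (suc n) → ℕ
entry p v a b j = A p ∣ (+ a) ℤ.+ proj₁ (v j) ∣ ∣ (+ b) ℤ.+ proj₂ (v j) ∣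

-- x_{a,b}(p) ∈ T(σ,N): x_{σ(1)} < x_{σ(2)} < ... < x_{σ(N)}
-- (stated for p·x, since multiplying by 1/p > 0 preserves strict order)
InT : (p : ℕ) {n : ℕ} → Shifts n → Permutation′ (suc n) → ℕ → ℕ → Set
InT p {n} v σ a b =
  ∀ (k : Fin n) → entry p v a b (σ ⟨$⟩ʳ inject₁ k) ℕ.< entry p v a b (σ ⟨$⟩ʳ fsuc k)

good : (p : ℕ) {n : ℕ} → Shifts n → Permutation′ (suc n) → ℕ × ℕ → Set
good p v σ (a , b) = InG p v a b × InT p v σ a b

good? : (p : ℕ) {n : ℕ} (v : Shifts n) (σ : Permutation′ (suc n)) → (ab : ℕ × ℕ) → Dec (good p v σ ab)
good? p v σ (a , b) =
  ((a ℕP.<? p) ×-dec ((1 ℕP.≤? b) ×-dec ((b ℕP.<? p) ×-dec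
   all? (λ j → ((+ 0) ℤP.≤? (+ a) ℤ.+ proj₁ (v j)) ×-dec (((+ a) ℤ.+ proj₁ (v j) ℤP.<? + p) ×-dec
          (((+ 1) ℤP.≤? (+ b) ℤ.+ proj₂ (v j)) ×-dec ((+ b) ℤ.+ proj₂ (v j) ℤP.<? + p)))))))
  ×-dec all? (λ k → entry p v a b (σ ⟨$⟩ʳ inject₁ k) ℕP.<? entry p v a b (σ ⟨$⟩ʳ fsuc k))

-- #{(a,b) ∈ 𝒢_N(p) : x_{a,b}(p) ∈ T(σ,N)}   (all of 𝒢_N(p) lies in [0,p) × [0,p))
count : (p : ℕ) {n : ℕ} → Shifts n → Permutation′ (suc n) → ℕ
count p v σ = length (filter (good? p v σ) (cartesianProduct (upTo p) (upTo p)))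

-- On a fixed column b the shifted Fermat quotients trace, as a varies, a line in F_pᴺ, because
-- q_p(ap + b) ≡ q_p(b) − a/b (mod p); its direction is w_b = (−1/(b + t_j))_j.  The t_j being distinct,
-- a nonzero h is orthogonal to at most N of the w_b (a sum of N partial fractions has few zeros).
-- Expanding the indicator of a line over the hyperplanes containing its direction and applying
-- AM-GM hyperplane by hyperplane therefore shows that, summed over b, the pairs of φ × ψ differing
-- by a point of the b-th line number |φ||ψ|/pᴺ⁻¹ per column, up to N p · pᴺ in total.  Take for φ a
-- small cube of side D, and for ψ either the vectors in ascending order (about pᴺ/N! of them) or the
-- O(D pᴺ⁻¹) vectors whose order type a shift by the cube can change: the cube average of the
-- former counts the wanted points up to the latter.  This gives an error O(pD + p · pᴺ/Dᴺ), and
-- Dᴺ⁺¹ ≈ pᴺ balances the two terms (no logarithm is needed).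
module Submission where

open import Defs

import Data.Nat as ℕ
open import Data.Nat using (ℕ; zero; suc; _!)
open import Data.Nat.Combinatorics using (_C_; nCk+nC[k+1]≡[n+1]C[k+1]; nC1≡n; nCn≡1; nCk≡nC[n∸k]; k>n⇒nCk≡0)
import Data.Nat.Divisibility as ℕD
import Data.Nat.DivMod as ℕDM
import Data.Nat.Properties as ℕP
open import Data.Nat.Logarithm using (⌊log₂_⌋; ⌊log₂⌋-mono-≤; ⌊log₂[2^n]⌋≡n)
open import Data.Nat.Primality using (Prime; euclidsLemma; prime⇒nonZero; prime⇒nonTrivial; ¬prime[1])
open import Data.Nat.Tactic.RingSolver using () renaming (solve-∀ to solveℕ-∀)
import Data.Integer as ℤ
open import Data.Integer using (ℤ; +_; ∣_∣)
import Data.Integer.Properties as ℤP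
open import Data.Integer.DivMod using (_%ℕ_; _/ℕ_; n%ℕd<d; a≡a%ℕn+[a/ℕn]*n)
open import Data.Integer.Divisibility.Signed using (_∣_; _∣?_; divides; ∣⇒∣ᵤ; ∣ᵤ⇒∣; ∣m∣n⇒∣m+n; ∣m∣n⇒∣m-n; ∣n⇒∣m*n)
open import Data.Integer.Tactic.RingSolver using (solve-∀)
open import Data.Fin using (Fin; inject₁) renaming (zero to fzero; suc to fsuc)
open import Data.Fin.Properties using (all?)
open import Data.Fin.Permutation using (Permutation′; _⟨$⟩ʳ_; _⟨$⟩ˡ_; inverseʳ; inverseˡ)
open import Data.List using (List; []; _∷_; map; _++_; _∷ʳ_; length; filter; upTo; cartesianProduct; cartesianProductWith)
import Data.List.Properties as ListP
open import Data.List.Relation.Unary.All as All using (All; []; _∷_)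
open import Data.List.Relation.Unary.All.Properties using (¬Any⇒All¬; all-filter; ++⁺; map⁺)
open import Data.List.Relation.Unary.Any as Any using (Any; here; there; any?)
open import Data.Vec using (Vec; []; _∷_; head; tail; replicate; tabulate)
import Data.Vec as Vec
import Data.Vec.Relation.Unary.All as AllV
open AllV using () renaming (All to AllV)
open import Data.Vec.Relation.Unary.AllPairs as AllPairs using (AllPairs)
open import Data.Vec.Relation.Unary.AllPairs.Properties using () renaming (tabulate⁺ to allPairs-tabulate⁺)
open import Data.Vec.Relation.Unary.Linked as Linked using (Linked; linked?; [-])
open import Data.Vec.Relation.Binary.Pointwise.Inductive as Pointwise using (Pointwise)
open import Data.Empty using (⊥-elim)
open import Data.Product using (Σ; ∃; _×_; _,_; proj₁; proj₂)
open import Data.Sum using (_⊎_; inj₁; inj₂)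
import Data.Sum as Sum
open import Function using (_∘_)
open import Function.Definitions using (Injective)
open import Relation.Binary.Definitions using (tri<; tri≈; tri>)
import Relation.Binary.Definitions as B
open import Relation.Binary.PropositionalEquality hiding ([_])
open import Relation.Nullary using (Dec; yes; no; ¬_)
open import Relation.Nullary.Decidable using (_×-dec_; _⊎-dec_)
open import Relation.Unary using (Decidable)
open ≡-Reasoning

-- A single line of F_pᴺ may be badly distributed among the N! orderings; only the average over
-- columns and over small displacements is under control. Displacements are harmless because
-- shifting each coordinate by less than D can alter the order only if two neighbouring values are
-- close or a residue wraps around p. No complex exponentials occur. The function κ = p δ - 1 has
-- mean zero over the residues and reproduces itself under convolution, so sums over vectors h act
-- as a Fourier expansion inside ℤ. AM-GM stands in for Cauchy-Schwarz, since it needs no square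
-- roots; its price is an error bound that ignores the sizes of φ and ψ. Divisions by N!, pⁿ and Dᴺ
-- are avoided by carrying these factors along and cancelling at the end. The permutation σ is
-- removed by reordering the shifts, so only ascending order is ever counted. The t_j stay distinct
-- modulo p once p > 2M; smaller primes are absorbed into the constant.

module FiniteSums where

  open import Data.Integer using (ℤ; +_; -[1+_]; -_; _+_; _*_; _-_; _≤_; _^_; 0ℤ; 1ℤ; +≤+)

  private variable
    X Y W : Set
    P Q : Set

  0≤+ : ∀ n → 0ℤ ≤ + n
  0≤+ n = +≤+ ℕ.z≤n

  -- Nonlinear inequalities are proved by naming the slack explicitly: the ring solver checks the
  -- identity, and the sign of the slack follows from sums and products of nonnegative factors.
  ≤-from-gap : ∀ {x y g} → y ≡ x + g → 0ℤ ≤ g → x ≤ y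
  ≤-from-gap {x} {y} {g} e h =
    subst (x ≤_) (sym e) (subst (_≤ x + g) (ℤP.+-identityʳ x) (ℤP.+-monoʳ-≤ x h))

  0≤-* : ∀ {x y} → 0ℤ ≤ x → 0ℤ ≤ y → 0ℤ ≤ x * y
  0≤-* {+ m} {+ n} _ _ = subst (0ℤ ≤_) (ℤP.pos-* m n) (0≤+ (m ℕ.* n))

  0≤^ : ∀ k N → 0ℤ ≤ (+ k) ^ N
  0≤^ k zero    = 0≤+ 1
  0≤^ k (suc N) = 0≤-* {+ k} (0≤+ k) (0≤^ k N)

  0≤gap : ∀ {x y} → x ≤ y → 0ℤ ≤ y - x
  0≤gap = ℤP.i≤j⇒0≤j-i

  *-monoˡ-≤ : ∀ {c x y} → 0ℤ ≤ c → x ≤ y → c * x ≤ c * y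
  *-monoˡ-≤ {c} {x} {y} hc h = ≤-from-gap (lem c x y) (0≤-* hc (0≤gap h))
    where
    lem : ∀ c x y → c * y ≡ c * x + c * (y - x)
    lem = solve-∀

  *-mono-≤ : ∀ {a b x y} → 0ℤ ≤ a → 0ℤ ≤ y → a ≤ b → x ≤ y → a * x ≤ b * y
  *-mono-≤ {a} {b} {x} {y} ha hy h k =
    ≤-from-gap (lem a b x y) (ℤP.+-mono-≤ (0≤-* ha (0≤gap k)) (0≤-* (0≤gap h) hy))
    where
    lem : ∀ a b x y → b * y ≡ a * x + (a * (y - x) + (b - a) * y)
    lem = solve-∀

  0≤square : ∀ x → 0ℤ ≤ x * x
  0≤square (+ n) = 0≤-* {+ n} {+ n} (0≤+ n) (0≤+ n)
  0≤square (-[1+ n ]) = 0≤+ _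

  infix 4 _within_
  -- The bound |x| ≤ b as two inequalities, so that such bounds add, scale by nonnegative factors
  -- and cancel positive ones as ordinary inequalities in ℤ do.
  _within_ : ℤ → ℤ → Set
  x within b = x ≤ b × - x ≤ b

  within-resp : ∀ {x y b} → x ≡ y → x within b → y within b
  within-resp refl h = h

  within-+ : ∀ {x y a b} → x within a → y within b → (x + y) within (a + b)
  within-+ {x} {y} (h , h') (k , k') =
    ℤP.+-mono-≤ h k , subst (_≤ _) (sym (ℤP.neg-distrib-+ x y)) (ℤP.+-mono-≤ h' k')

  within-* : ∀ {c x a} → 0ℤ ≤ c → x within a → (c * x) within (c * a)
  within-* {c} {x} hc (h , h') =
    *-monoˡ-≤ hc h , subst (_≤ _) (sym (ℤP.neg-distribʳ-* c x)) (*-monoˡ-≤ hc h')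

  within-≤ : ∀ {x a b} → a ≤ b → x within a → x within b
  within-≤ k (h , h') = ℤP.≤-trans h k , ℤP.≤-trans h' k

  ∑ : List X → (X → ℤ) → ℤ
  ∑ []       f = 0ℤ
  ∑ (x ∷ xs) f = f x + ∑ xs f

  ∑-congᴬ : ∀ {xs : List X} {f g : X → ℤ} → All (λ x → f x ≡ g x) xs → ∑ xs f ≡ ∑ xs g
  ∑-congᴬ []       = refl
  ∑-congᴬ (e ∷ es) = cong₂ _+_ e (∑-congᴬ es)

  ∑-cong : ∀ (xs : List X) {f g : X → ℤ} → (∀ x → f x ≡ g x) → ∑ xs f ≡ ∑ xs g
  ∑-cong xs e = ∑-congᴬ (All.universal e xs)

  ∑-monoᴬ : ∀ {xs : List X} {f g : X → ℤ} → All (λ x → f x ≤ g x) xs → ∑ xs f ≤ ∑ xs g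
  ∑-monoᴬ []       = ℤP.≤-refl
  ∑-monoᴬ (e ∷ es) = ℤP.+-mono-≤ e (∑-monoᴬ es)

  ∑-mono : ∀ (xs : List X) {f g : X → ℤ} → (∀ x → f x ≤ g x) → ∑ xs f ≤ ∑ xs g
  ∑-mono xs e = ∑-monoᴬ (All.universal e xs)

  ∑-0 : ∀ (xs : List X) → ∑ xs (λ _ → 0ℤ) ≡ 0ℤ
  ∑-0 []       = refl
  ∑-0 (x ∷ xs) = trans (ℤP.+-identityˡ _) (∑-0 xs)

  ∑-const : ∀ c (xs : List X) → ∑ xs (λ _ → c) ≡ + length xs * c
  ∑-const c []       = sym (ℤP.*-zeroˡ c)
  ∑-const c (x ∷ xs) = trans (cong (λ k → c + k) (∑-const c xs)) (lem c (+ length xs))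
    where
    lem : ∀ c l → c + l * c ≡ (1ℤ + l) * c
    lem = solve-∀

  ∑-+ : ∀ (xs : List X) (f g : X → ℤ) → ∑ xs (λ x → f x + g x) ≡ ∑ xs f + ∑ xs g
  ∑-+ []       f g = refl
  ∑-+ (x ∷ xs) f g = trans (cong (λ k → f x + g x + k) (∑-+ xs f g)) (lem (f x) (g x) _ _)
    where
    lem : ∀ a b c d → a + b + (c + d) ≡ a + c + (b + d)
    lem = solve-∀

  ∑-*ˡ : ∀ (xs : List X) c (f : X → ℤ) → ∑ xs (λ x → c * f x) ≡ c * ∑ xs f
  ∑-*ˡ []       c f = sym (ℤP.*-zeroʳ c)
  ∑-*ˡ (x ∷ xs) c f = trans (cong (λ k → c * f x + k) (∑-*ˡ xs c f)) (sym (ℤP.*-distribˡ-+ c _ _))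

  ∑-*ʳ : ∀ (xs : List X) c (f : X → ℤ) → ∑ xs (λ x → f x * c) ≡ ∑ xs f * c
  ∑-*ʳ xs c f = trans (∑-cong xs (λ x → ℤP.*-comm (f x) c)) (trans (∑-*ˡ xs c f) (ℤP.*-comm c _))

  ∑-neg : ∀ (xs : List X) (f : X → ℤ) → ∑ xs (λ x → - f x) ≡ - ∑ xs f
  ∑-neg []       f = refl
  ∑-neg (x ∷ xs) f = trans (cong (λ k → - f x + k) (∑-neg xs f)) (sym (ℤP.neg-distrib-+ (f x) _))

  ∑-- : ∀ (xs : List X) (f g : X → ℤ) → ∑ xs (λ x → f x - g x) ≡ ∑ xs f - ∑ xs g
  ∑-- xs f g = trans (∑-+ xs f (λ x → - g x)) (cong (λ k → ∑ xs f + k) (∑-neg xs g))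

  ∑-swap : ∀ (xs : List X) (ys : List Y) (f : X → Y → ℤ) →
    ∑ xs (λ x → ∑ ys (f x)) ≡ ∑ ys (λ y → ∑ xs (λ x → f x y))
  ∑-swap []       ys f = sym (∑-0 ys)
  ∑-swap (x ∷ xs) ys f =
    trans (cong (λ k → ∑ ys (f x) + k) (∑-swap xs ys f)) (sym (∑-+ ys (f x) _))

  ∑-++ : ∀ (xs ys : List X) (f : X → ℤ) → ∑ (xs ++ ys) f ≡ ∑ xs f + ∑ ys f
  ∑-++ []       ys f = sym (ℤP.+-identityˡ _)
  ∑-++ (x ∷ xs) ys f = trans (cong (λ k → f x + k) (∑-++ xs ys f)) (sym (ℤP.+-assoc (f x) _ _))

  ∑-map : ∀ (h : X → Y) (xs : List X) (f : Y → ℤ) → ∑ (map h xs) f ≡ ∑ xs (f ∘ h)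
  ∑-map h []       f = refl
  ∑-map h (x ∷ xs) f = cong (λ k → f (h x) + k) (∑-map h xs f)

  ∑-product : ∀ (h : X → Y → W) (xs : List X) (ys : List Y) (f : W → ℤ) →
    ∑ (cartesianProductWith h xs ys) f ≡ ∑ xs (λ x → ∑ ys (λ y → f (h x y)))
  ∑-product h []       ys f = refl
  ∑-product h (x ∷ xs) ys f =
    trans (∑-++ (map (h x) ys) _ f) (cong₂ _+_ (∑-map (h x) ys f) (∑-product h xs ys f))

  ∑-within : ∀ (xs : List X) {f g : X → ℤ} → All (λ x → f x within g x) xs → ∑ xs f within ∑ xs g
  ∑-within xs {f} {g} hs =
    ∑-monoᴬ (All.map proj₁ hs) ,
    subst (_≤ ∑ xs g) (∑-neg xs f) (∑-monoᴬ (All.map proj₂ hs))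

  ∑-nonneg : ∀ (xs : List X) {f : X → ℤ} → (∀ x → 0ℤ ≤ f x) → 0ℤ ≤ ∑ xs f
  ∑-nonneg xs {f} h = subst (_≤ ∑ xs f) (∑-0 xs) (∑-mono xs h)

  ∑-∑-* : ∀ (xs : List X) (ys : List Y) (f : X → ℤ) (g : Y → ℤ) →
    ∑ xs (λ x → ∑ ys (λ y → f x * g y)) ≡ ∑ xs f * ∑ ys g
  ∑-∑-* xs ys f g = trans (∑-cong xs (λ x → ∑-*ˡ ys (f x) g)) (∑-*ʳ xs (∑ ys g) f)

  𝟙 : Dec P → ℤ
  𝟙 (yes _) = 1ℤ
  𝟙 (no  _) = 0ℤ

  𝟙-yes : (d : Dec P) → P → 𝟙 d ≡ 1ℤ
  𝟙-yes (yes _) _ = refl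
  𝟙-yes (no ¬x) x = ⊥-elim (¬x x)

  𝟙-no : (d : Dec P) → ¬ P → 𝟙 d ≡ 0ℤ
  𝟙-no (yes x) ¬x = ⊥-elim (¬x x)
  𝟙-no (no _)  _  = refl

  𝟙-cong : (d : Dec P) (e : Dec Q) → (P → Q) → (Q → P) → 𝟙 d ≡ 𝟙 e
  𝟙-cong (yes x) e f g = sym (𝟙-yes e (f x))
  𝟙-cong (no ¬x) e f g = sym (𝟙-no e (¬x ∘ g))

  𝟙-mono : (d : Dec P) (e : Dec Q) → (P → Q) → 𝟙 d ≤ 𝟙 e
  𝟙-mono (yes x) e f = ℤP.≤-reflexive (sym (𝟙-yes e (f x)))
  𝟙-mono (no _) (yes _) f = 0≤+ 1
  𝟙-mono (no _) (no _)  f = 0≤+ 0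

  0≤𝟙 : (d : Dec P) → 0ℤ ≤ 𝟙 d
  0≤𝟙 (yes _) = 0≤+ 1
  0≤𝟙 (no _)  = 0≤+ 0

  𝟙≤1 : (d : Dec P) → 𝟙 d ≤ 1ℤ
  𝟙≤1 (yes _) = ℤP.≤-refl
  𝟙≤1 (no _)  = 0≤+ 1

  𝟙-× : (d : Dec P) (e : Dec Q) → 𝟙 (d ×-dec e) ≡ 𝟙 d * 𝟙 e
  𝟙-× (yes _) (yes _) = refl
  𝟙-× (yes _) (no _)  = refl
  𝟙-× (no _)  e       = sym (ℤP.*-zeroˡ (𝟙 e))

  ∑-filter : ∀ {R : X → Set} (R? : Decidable R) (xs : List X) (f : X → ℤ) →
    ∑ (filter R? xs) f ≡ ∑ xs (λ x → 𝟙 (R? x) * f x)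
  ∑-filter R? []       f = refl
  ∑-filter R? (x ∷ xs) f with R? x
  ... | yes _ = cong₂ _+_ (sym (ℤP.*-identityˡ (f x))) (∑-filter R? xs f)
  ... | no  _ = trans (∑-filter R? xs f) (trans (sym (ℤP.+-identityˡ _))
      (cong (_+ ∑ xs (λ y → 𝟙 (R? y) * f y)) (sym (ℤP.*-zeroˡ (f x)))))

  length-∑ : ∀ (xs : List X) → + length xs ≡ ∑ xs (λ _ → 1ℤ)
  length-∑ xs = sym (trans (∑-const 1ℤ xs) (ℤP.*-identityʳ _))

open FiniteSums

-- Boxes of residue vectors and the integer dot product.

module Cubes where

  open import Data.Integer using (ℤ; +_; -_; _+_; _*_; _-_; _≤_; _<_; _^_; 0ℤ; 1ℤ; ∣_∣)

  range : ℕ → List ℤ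
  range zero    = []
  range (suc k) = + k ∷ range k

  length-range : ∀ k → length (range k) ≡ k
  length-range zero    = refl
  length-range (suc k) = cong suc (length-range k)

  cube : ℕ → (N : ℕ) → List (Vec ℤ N)
  cube k zero    = [] ∷ []
  cube k (suc N) = cartesianProductWith _∷_ (range k) (cube k N)

  InRange : ℕ → ℤ → Set
  InRange k c = ∃ λ r → (r ℕ.< k) × (c ≡ + r)

  range-InRange : ∀ k → All (InRange k) (range k)
  range-InRange zero    = []
  range-InRange (suc k) =
    (k , ℕP.≤-refl , refl) ∷ All.map (λ (r , r<k , e) → r , ℕP.m<n⇒m<1+n r<k , e) (range-InRange k)

  ∑-cube : ∀ k N (f : Vec ℤ (suc N) → ℤ) →
    ∑ (cube k (suc N)) f ≡ ∑ (range k) (λ c → ∑ (cube k N) (λ v → f (c ∷ v)))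
  ∑-cube k N f = ∑-product _∷_ (range k) (cube k N) f

  ∑-cube-zero : ∀ k (f : Vec ℤ 0 → ℤ) → ∑ (cube k 0) f ≡ f []
  ∑-cube-zero k f = ℤP.+-identityʳ _

  ∑-range-const : ∀ k c → ∑ (range k) (λ _ → c) ≡ + k * c
  ∑-range-const k c = trans (∑-const c (range k)) (cong (λ l → + l * c) (length-range k))

  ∑-cube-const : ∀ k N c → ∑ (cube k N) (λ _ → c) ≡ (+ k) ^ N * c
  ∑-cube-const k zero    c = trans (ℤP.+-identityʳ c) (sym (ℤP.*-identityˡ c))
  ∑-cube-const k (suc N) c = begin
    ∑ (cube k (suc N)) (λ _ → c)                ≡⟨ ∑-cube k N _ ⟩
    ∑ (range k) (λ _ → ∑ (cube k N) (λ _ → c))  ≡⟨ ∑-range-const k _ ⟩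
    + k * ∑ (cube k N) (λ _ → c)                ≡⟨ cong (+ k *_) (∑-cube-const k N c) ⟩
    + k * ((+ k) ^ N * c)                       ≡⟨ ℤP.*-assoc (+ k) _ c ⟨
    (+ k) ^ suc N * c                           ∎

  cube-All : ∀ k N → All (AllV (InRange k)) (cube k N)
  cube-All k zero    = AllV.[] ∷ []
  cube-All k (suc N) = go (range k) (range-InRange k)
    where
    go : ∀ xs → All (InRange k) xs → All (AllV (InRange k)) (cartesianProductWith _∷_ xs (cube k N))
    go []       []       = []
    go (x ∷ xs) (h ∷ hs) = ++⁺ (map⁺ (All.map (h AllV.∷_) (cube-All k N))) (go xs hs)

  infixl 6 _⊖_
  _⊖_ : ∀ {N} → Vec ℤ N → Vec ℤ N → Vec ℤ N
  _⊖_ = Vec.zipWith _-_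

  infixr 9 _⊙_
  _⊙_ : ∀ {N} → ℤ → Vec ℤ N → Vec ℤ N
  c ⊙ xs = Vec.map (c *_) xs

  infixl 6 _⊕_
  _⊕_ : ∀ {N} → Vec ℤ N → Vec ℤ N → Vec ℤ N
  _⊕_ = Vec.zipWith _+_

  ⊖-⊕ : ∀ {N} (y x u z : Vec ℤ N) → y ⊖ x ⊖ u ⊖ z ≡ y ⊖ (x ⊕ (u ⊕ z))
  ⊖-⊕ []      []      []      []      = refl
  ⊖-⊕ (y ∷ ys) (x ∷ xs) (u ∷ us) (z ∷ zs) = cong₂ _∷_ (lem y x u z) (⊖-⊕ ys xs us zs)
    where
    lem : ∀ y x u z → y - x - u - z ≡ y - (x + (u + z))
    lem = solve-∀

  infixl 8 _·_

  -- Opaque, since conversion checking blows up once integer products are unfolded.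
  opaque
    _·_ : ∀ {N} → Vec ℤ N → Vec ℤ N → ℤ
    []       · []       = 0ℤ
    (x ∷ xs) · (y ∷ ys) = x * y + xs · ys

    ·-[] : (xs : Vec ℤ 0) → xs · [] ≡ 0ℤ
    ·-[] [] = refl

    ·-∷ : ∀ {N} x y (xs ys : Vec ℤ N) → (x ∷ xs) · (y ∷ ys) ≡ x * y + xs · ys
    ·-∷ x y xs ys = refl

    ·-⊖ : ∀ {N} (h x y : Vec ℤ N) → h · (x ⊖ y) ≡ h · x - h · y
    ·-⊖ []      []      []      = refl
    ·-⊖ (a ∷ h) (b ∷ x) (c ∷ y) = trans (cong (λ k → a * (b - c) + k) (·-⊖ h x y)) (lem a b c _ _)
      where
      lem : ∀ a b c s t → a * (b - c) + (s - t) ≡ a * b + s - (a * c + t)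
      lem = solve-∀

    ·-⊙ : ∀ {N} (h : Vec ℤ N) c (x : Vec ℤ N) → h · (c ⊙ x) ≡ c * h · x
    ·-⊙ []      c []      = sym (ℤP.*-zeroʳ c)
    ·-⊙ (a ∷ h) c (b ∷ x) = trans (cong (λ k → a * (c * b) + k) (·-⊙ h c x)) (lem a b c _)
      where
      lem : ∀ a b c s → a * (c * b) + c * s ≡ c * (a * b + s)
      lem = solve-∀

  -- Congruences modulo p and their indicators.

  module Modular (p : ℕ) .{{_ : ℕ.NonZero p}} where

    Null : ℤ → Set
    Null z = + p ∣ z

    null-lin : ∀ {x a b} c d → x ≡ c * a + d * b → Null a → Null b → Null x
    null-lin c d refl ha hb = ∣m∣n⇒∣m+n (∣n⇒∣m*n c ha) (∣n⇒∣m*n d hb)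

    null-+ : ∀ {x a b} → x ≡ a + b → Null a → Null b → Null x
    null-+ refl = ∣m∣n⇒∣m+n

    null-- : ∀ a b → Null a → Null b → Null (a - b)
    null-- a b = ∣m∣n⇒∣m-n {+ p} {a} {b}

    null-* : ∀ {x a} c → x ≡ c * a → Null a → Null x
    null-* c refl ha = ∣n⇒∣m*n c ha

    null-0 : Null 0ℤ
    null-0 = divides 0ℤ refl

    small-≡ : ∀ {r s} → r ℕ.< p → s ℕ.< p → Null (+ r - + s) → r ≡ s
    small-≡ {r} {s} r<p s<p h with ∣ + r - + s ∣ in eq | ∣⇒∣ᵤ h
    ... | zero  | _  = ℤP.+-injective (ℤP.i-j≡0⇒i≡j (+ r) (+ s) (ℤP.∣i∣≡0⇒i≡0 eq))
    ... | suc m | d  = ⊥-elim (ℕP.<⇒≱ (ℕP.≤-<-trans bound (ℕP.⊔-lub r<p s<p)) (ℕD.∣⇒≤ d))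
      where
      bound : suc m ℕ.≤ r ℕ.⊔ s
      bound = subst (ℕ._≤ r ℕ.⊔ s) (trans (cong ∣_∣ (sym (ℤP.m-n≡m⊖n r s))) eq) (ℤP.∣m⊝n∣≤m⊔n r s)

    δ : ℤ → ℤ
    δ z = 𝟙 (+ p ∣? z)

    δ-null : ∀ {z} → Null z → δ z ≡ 1ℤ
    δ-null {z} = 𝟙-yes (+ p ∣? z)

    δ-cong : ∀ {x y} → (Null x → Null y) → (Null y → Null x) → δ x ≡ δ y
    δ-cong {x} {y} = 𝟙-cong (+ p ∣? x) (+ p ∣? y)

    δ-shift : ∀ {x y} → Null (x - y) → δ x ≡ δ y
    δ-shift {x} {y} h = δ-cong (λ k → null-lin 1ℤ (- 1ℤ) (lem₁ x y) k h) (λ k → null-lin 1ℤ 1ℤ (lem₂ x y) k h)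
      where
      lem₁ : ∀ x y → y ≡ 1ℤ * x + - 1ℤ * (x - y)
      lem₁ = solve-∀
      lem₂ : ∀ x y → x ≡ 1ℤ * y + 1ℤ * (x - y)
      lem₂ = solve-∀

    red : ℤ → ℤ
    red d = + (d %ℕ p)

    red-null : ∀ d → Null (red d - d)
    red-null d = divides (- (d /ℕ p)) (begin
      red d - d                             ≡⟨ cong (λ k → red d - k) (a≡a%ℕn+[a/ℕn]*n d p) ⟩
      red d - (red d + (d /ℕ p) * + p)      ≡⟨ lem (red d) (d /ℕ p) (+ p) ⟩
      - (d /ℕ p) * + p                      ∎)
      where
      lem : ∀ a q p → a - (a + q * p) ≡ - q * p
      lem = solve-∀

    -- For k ≤ p the entries of `range k` are pairwise incongruent, so at most one term is hit. The
    -- partial sums are tracked because the induction cannot start at k = p.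
    ∑-δ-partial : ∀ d k → k ℕ.≤ p → ∑ (range k) (λ c → δ (c - d)) ≡ 𝟙 (d %ℕ p ℕP.<? k)
    ∑-δ-partial d zero    _   = refl
    ∑-δ-partial d (suc k) k<p = trans (cong (λ t → δ (+ k - d) + t) (∑-δ-partial d k (ℕP.<⇒≤ k<p)))
        (cases (ℕP.<-cmp r k))
      where
      r = d %ℕ p
      hit : Null (+ k - d) → k ≡ r
      hit h = small-≡ k<p (n%ℕd<d d p) (null-lin 1ℤ (- 1ℤ) (lem (+ k) (+ r) d) h (red-null d))
        where
        lem : ∀ k r d → k - r ≡ 1ℤ * (k - d) + - 1ℤ * (r - d)
        lem = solve-∀
      miss : ¬ r ≡ k → δ (+ k - d) ≡ 0ℤ
      miss ne = 𝟙-no (+ p ∣? (+ k - d)) (ne ∘ sym ∘ hit)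
      cases : _ → δ (+ k - d) + 𝟙 (r ℕP.<? k) ≡ 𝟙 (r ℕP.<? suc k)
      cases (tri< r<k ne _) = trans (cong₂ _+_ (miss ne) (𝟙-yes (r ℕP.<? k) r<k))
          (sym (𝟙-yes (r ℕP.<? suc k) (ℕP.m<n⇒m<1+n r<k)))
      cases (tri≈ ¬r<k r≡k _) = trans (cong₂ _+_ (𝟙-yes (+ p ∣? (+ k - d))
          (subst (λ j → Null (+ j - d)) r≡k (red-null d))) (𝟙-no (r ℕP.<? k) ¬r<k))
          (sym (𝟙-yes (r ℕP.<? suc k) (subst (ℕ._< suc k) (sym r≡k) ℕP.≤-refl)))
      cases (tri> ¬r<k ne r>k) = trans (cong₂ _+_ (miss ne) (𝟙-no (r ℕP.<? k) ¬r<k))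
          (sym (𝟙-no (r ℕP.<? suc k) (ℕP.<⇒≱ (ℕ.s≤s r>k))))

    ∑-δ : ∀ d → ∑ (range p) (λ c → δ (c - d)) ≡ 1ℤ
    ∑-δ d = trans (∑-δ-partial d p ℕP.≤-refl) (𝟙-yes (d %ℕ p ℕP.<? p) (n%ℕd<d d p))

    Periodic : (ℤ → ℤ) → Set
    Periodic g = ∀ c d → Null (c - d) → g c ≡ g d

    δ-* : ∀ {x a b} → (Null x → a ≡ b) → δ x * a ≡ δ x * b
    δ-* {x} h with + p ∣? x
    ... | yes n = cong (1ℤ *_) (h n)
    ... | no  _ = refl

    ∑-pick : ∀ d {g : ℤ → ℤ} → Periodic g → ∑ (range p) (λ c → δ (c - d) * g c) ≡ g d
    ∑-pick d {g} per = begin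
      ∑ (range p) (λ c → δ (c - d) * g c)  ≡⟨ ∑-cong (range p) (λ c → δ-* {c - d} (per c d)) ⟩
      ∑ (range p) (λ c → δ (c - d) * g d)  ≡⟨ ∑-*ʳ (range p) (g d) _ ⟩
      ∑ (range p) (λ c → δ (c - d)) * g d  ≡⟨ cong (_* g d) (∑-δ d) ⟩
      1ℤ * g d                             ≡⟨ ℤP.*-identityˡ _ ⟩
      g d                                  ∎

    -- For invertible u the congruence c u + e ≡ 0 has the single solution c ≡ - u′ e.
    ∑-pick-unit : ∀ u u′ e {g : ℤ → ℤ} → Null (u * u′ - 1ℤ) → Periodic g →
      ∑ (range p) (λ c → δ (c * u + e) * g c) ≡ g (- (u′ * e))
    ∑-pick-unit u u′ e {g} inv per = trans
      (∑-cong (range p) (λ c → cong (_* g c) (δ-cong {c * u + e} {c - - (u′ * e)}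
        (λ h → null-lin u′ (- c) (lem₁ u u′ e c) h inv)
        (λ h → null-lin u (- e) (lem₂ u u′ e c) h inv))))
      (∑-pick (- (u′ * e)) per)
      where
      lem₁ : ∀ u v e c → c - - (v * e) ≡ v * (c * u + e) + - c * (u * v - 1ℤ)
      lem₁ = solve-∀
      lem₂ : ∀ u v e c → c * u + e ≡ u * (c - - (v * e)) + - e * (u * v - 1ℤ)
      lem₂ = solve-∀

    ZeroV : ∀ {N} → Vec ℤ N → Set
    ZeroV = AllV Null

    zeroV? : ∀ {N} (z : Vec ℤ N) → Dec (ZeroV z)
    zeroV? = AllV.all? (+ p ∣?_)

    Z : ∀ {N} → Vec ℤ N → ℤ
    Z z = 𝟙 (zeroV? z)

    Z-∷ : ∀ {N} a (z : Vec ℤ N) → Z (a ∷ z) ≡ δ a * Z z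
    Z-∷ a z = trans (𝟙-cong (zeroV? (a ∷ z)) ((+ p ∣? a) ×-dec zeroV? z) AllV.uncons (λ (h , hs) → h AllV.∷ hs))
        (𝟙-× (+ p ∣? a) (zeroV? z))

    Z-shift : ∀ {N} {x y : Vec ℤ N} → ZeroV (x ⊖ y) → Z x ≡ Z y
    Z-shift {x = []}    {[]}    AllV.[]        = refl
    Z-shift {x = a ∷ x} {b ∷ y} (h AllV.∷ hs) =
      trans (Z-∷ a x) (trans (cong₂ _*_ (δ-shift h) (Z-shift hs)) (sym (Z-∷ b y)))

open Cubes

-- Fermat's little theorem and inverses modulo a prime.

module FermatLittle where

  open import Data.Integer using (ℤ; +_; -_; _+_; _*_; _-_; _≤_; _<_; _^_; 0ℤ; 1ℤ; ∣_∣)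

  -- The absorption identity. It shows that a prime `suc n` divides a product whose first factor is
  -- too small to be a multiple of it, hence divides the binomial coefficient.
  C-absorb : ∀ n k → suc k ℕ.* (suc n C suc k) ≡ suc n ℕ.* (n C k)
  C-absorb zero    zero    = refl
  C-absorb zero    (suc k) = trans (cong (suc (suc k) ℕ.*_) (k>n⇒nCk≡0 {1} {suc (suc k)} (ℕ.s≤s (ℕ.s≤s ℕ.z≤n))))
      (trans (ℕP.*-zeroʳ (suc (suc k))) (sym (cong (1 ℕ.*_) (k>n⇒nCk≡0 {0} {suc k} (ℕ.s≤s ℕ.z≤n)))))
  C-absorb (suc n) zero    = trans (ℕP.*-identityˡ _) (trans (nC1≡n (suc (suc n))) (sym (ℕP.*-identityʳ _)))
  C-absorb (suc n) (suc k) = begin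
    suc (suc k) ℕ.* (suc (suc n) C suc (suc k))
      ≡⟨ cong (suc (suc k) ℕ.*_) (nCk+nC[k+1]≡[n+1]C[k+1] (suc n) (suc k)) ⟨
    suc (suc k) ℕ.* (a ℕ.+ b)
      ≡⟨ lem₁ k a b ⟩
    suc k ℕ.* a ℕ.+ suc (suc k) ℕ.* b ℕ.+ a
      ≡⟨ cong₂ (λ s t → s ℕ.+ t ℕ.+ a) (C-absorb n k) (C-absorb n (suc k)) ⟩
    suc n ℕ.* (n C k) ℕ.+ suc n ℕ.* (n C suc k) ℕ.+ a
      ≡⟨ cong (ℕ._+ a) (ℕP.*-distribˡ-+ (suc n) (n C k) (n C suc k)) ⟨
    suc n ℕ.* (n C k ℕ.+ n C suc k) ℕ.+ a
      ≡⟨ cong (λ t → suc n ℕ.* t ℕ.+ a) (nCk+nC[k+1]≡[n+1]C[k+1] n k) ⟩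
    suc n ℕ.* a ℕ.+ a
      ≡⟨ ℕP.+-comm _ a ⟩
    suc (suc n) ℕ.* a ∎
    where
    a b : ℕ
    a = suc n C suc k
    b = suc n C suc (suc k)
    lem₁ : ∀ k a b → suc (suc k) ℕ.* (a ℕ.+ b) ≡ suc k ℕ.* a ℕ.+ suc (suc k) ℕ.* b ℕ.+ a
    lem₁ = solveℕ-∀

  nC0≡1 : ∀ n → n C 0 ≡ 1
  nC0≡1 n = trans (nCk≡nC[n∸k] {0} {n} ℕ.z≤n) (nCn≡1 n)

  -- The expansion of (1 + x)ⁿ cut off after j terms. The cut-off separates the first and the last
  -- term, which survive modulo p, from the middle ones, which vanish.
  binomialSum : ℕ → ℤ → ℕ → ℤ
  binomialSum n x zero    = 0ℤ
  binomialSum n x (suc j) = binomialSum n x j + + (n C j) * x ^ j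

  binomialSum-pascal : ∀ n x j → binomialSum (suc n) x (suc j) ≡ binomialSum n x (suc j) + x * binomialSum n x j
  binomialSum-pascal n x zero = begin
    0ℤ + + (suc n C 0) * 1ℤ          ≡⟨ cong (λ t → 0ℤ + + t * 1ℤ) (trans (nC0≡1 (suc n)) (sym (nC0≡1 n))) ⟩
    0ℤ + + (n C 0) * 1ℤ              ≡⟨ lem (+ (n C 0)) x ⟩
    0ℤ + + (n C 0) * 1ℤ + x * 0ℤ     ∎
    where
    lem : ∀ c x → 0ℤ + c * 1ℤ ≡ 0ℤ + c * 1ℤ + x * 0ℤ
    lem = solve-∀
  binomialSum-pascal n x (suc j) = begin
    binomialSum (suc n) x (suc j) + + (suc n C suc j) * (x * x ^ j)
      ≡⟨ cong₂ (λ s t → s + + t * (x * x ^ j)) (binomialSum-pascal n x j) (sym (nCk+nC[k+1]≡[n+1]C[k+1] n j)) ⟩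
    binomialSum n x (suc j) + x * B + (+ (n C j) + + (n C suc j)) * (x * x ^ j)
      ≡⟨ lem (binomialSum n x (suc j)) x B (+ (n C j)) (+ (n C suc j)) (x ^ j) ⟩
    binomialSum n x (suc j) + + (n C suc j) * (x * x ^ j) + x * (B + + (n C j) * x ^ j) ∎
    where
    B = binomialSum n x j
    lem : ∀ S x B c d y → S + x * B + (c + d) * (x * y) ≡ S + d * (x * y) + x * (B + c * y)
    lem = solve-∀

  binomial-theorem : ∀ n x → binomialSum n x (suc n) ≡ (1ℤ + x) ^ n
  binomial-theorem zero    x = refl
  binomial-theorem (suc n) x = begin
    binomialSum (suc n) x (suc (suc n))
      ≡⟨ binomialSum-pascal n x (suc n) ⟩
    S + + (n C suc n) * (x * x ^ n) + x * S
      ≡⟨ cong (λ t → S + + t * (x * x ^ n) + x * S) (k>n⇒nCk≡0 {n} (ℕP.n<1+n n)) ⟩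
    S + 0ℤ * (x * x ^ n) + x * S
      ≡⟨ lem S x (x * x ^ n) ⟩
    (1ℤ + x) * S
      ≡⟨ cong ((1ℤ + x) *_) (binomial-theorem n x) ⟩
    (1ℤ + x) ^ suc n ∎
    where
    S = binomialSum n x (suc n)
    lem : ∀ S x y → S + 0ℤ * y + x * S ≡ (1ℤ + x) * S
    lem = solve-∀

  module PrimeModulus (p : ℕ) (pr : Prime p) where

    instance
      p≢0 : ℕ.NonZero p
      p≢0 = prime⇒nonZero pr

    open Modular p public

    null-split : ∀ a b → Null (a * b) → Null a ⊎ Null b
    null-split a b h =
      Sum.map ∣ᵤ⇒∣ ∣ᵤ⇒∣ (euclidsLemma ∣ a ∣ ∣ b ∣ pr (subst (p ℕD.∣_) (ℤP.abs-* a b) (∣⇒∣ᵤ h)))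

    ¬null-1 : ¬ Null 1ℤ
    ¬null-1 h = ¬prime[1] (subst Prime (ℕD.∣1⇒≡1 (∣⇒∣ᵤ h)) pr)

    null-cancel : ∀ a b → ¬ Null a → Null (a * b) → Null b
    null-cancel a b ¬a h with null-split a b h
    ... | inj₁ ha = ⊥-elim (¬a ha)
    ... | inj₂ hb = hb

    p∣C : ∀ {k} → suc k ℕ.< p → Null (+ (p C suc k))
    p∣C {k} k<p = ∣ᵤ⇒∣ (result p pr k<p)
      where
      result : ∀ q → Prime q → suc k ℕ.< q → q ℕD.∣ q C suc k
      result (suc n) qr k<q with euclidsLemma (suc k) (suc n C suc k) qr
          (subst (suc n ℕD.∣_) (sym (C-absorb n k)) (ℕD.m∣m*n (n C k)))
      ... | inj₁ d = ⊥-elim (ℕP.<⇒≱ k<q (ℕD.∣⇒≤ d))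
      ... | inj₂ d = d

    binomialSum-null : ∀ x j → suc j ℕ.≤ p → Null (binomialSum p x (suc j) - 1ℤ)
    binomialSum-null x zero    _   = subst (λ c → Null (0ℤ + + c * 1ℤ - 1ℤ)) (sym (nC0≡1 p)) null-0
    binomialSum-null x (suc j) j<p = null-lin 1ℤ (x ^ suc j)
        (lem (binomialSum p x (suc j)) (+ (p C suc j)) (x ^ suc j)) (binomialSum-null x j (ℕP.<⇒≤ j<p)) (p∣C j<p)
      where
      lem : ∀ S c y → S + c * y - 1ℤ ≡ 1ℤ * (S - 1ℤ) + y * c
      lem = solve-∀

    freshman : ∀ x → Null ((1ℤ + x) ^ p - 1ℤ - x ^ p)
    freshman x = subst (λ s → Null (s - 1ℤ - x ^ p)) (binomial-theorem p x) (go p refl)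
      where
      go : ∀ q → q ≡ p → Null (binomialSum p x (suc p) - 1ℤ - x ^ p)
      -- The prime p is a parameter and cannot be matched on, so a copy q with q ≡ p exposes its
      -- successor.
      go zero    e = ⊥-elim (ℕ.≢-nonZero⁻¹ p (sym e))
      go (suc q) e = subst Null eq (binomialSum-null x q (ℕP.≤-reflexive e))
        where
        lem : ∀ S y → S - 1ℤ ≡ S + 1ℤ * y - 1ℤ - y
        lem = solve-∀
        eq : binomialSum p x (suc q) - 1ℤ ≡ binomialSum p x (suc p) - 1ℤ - x ^ p
        eq = trans (lem (binomialSum p x (suc q)) (x ^ p))
            (cong₂ (λ r c → binomialSum p x r + + c * x ^ p - 1ℤ - x ^ p) e (sym (nCn≡1 p)))

    fermat-ℕ : ∀ m → Null ((+ m) ^ p - + m)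
    fermat-ℕ zero    = go p refl
      where
      go : ∀ q → q ≡ p → Null (0ℤ ^ p - 0ℤ)
      go zero    e = ⊥-elim (ℕ.≢-nonZero⁻¹ p (sym e))
      go (suc q) e = subst (λ r → Null (0ℤ ^ r - 0ℤ)) e (subst Null (sym (lem (0ℤ ^ q))) null-0)
        where
        lem : ∀ y → 0ℤ * y - 0ℤ ≡ 0ℤ
        lem = solve-∀
    fermat-ℕ (suc m) = null-lin 1ℤ 1ℤ (lem ((1ℤ + + m) ^ p) (+ m) ((+ m) ^ p)) (freshman (+ m)) (fermat-ℕ m)
      where
      lem : ∀ s m y → s - (1ℤ + m) ≡ 1ℤ * (s - 1ℤ - y) + 1ℤ * (y - m)
      lem = solve-∀

    null-^ : ∀ {x y} k → Null (x - y) → Null (x ^ k - y ^ k)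
    null-^ zero    h = null-0
    null-^ {x} {y} (suc k) h = null-lin (x ^ k) y (lem x y (x ^ k) (y ^ k)) h (null-^ k h)
      where
      lem : ∀ x y a b → x * a - y * b ≡ a * (x - y) + y * (a - b)
      lem = solve-∀

    fermat : ∀ z → Null (z ^ p - z)
    fermat z = null-lin 1ℤ 1ℤ (lem (z ^ p) z (red z ^ p) (red z)) (null-^ p z-red)
        (null-lin 1ℤ (- 1ℤ) (lem₂ (red z ^ p) (red z) z) (fermat-ℕ _) z-red)
      where
      z-red : Null (z - red z)
      z-red = null-* (- 1ℤ) (neg z (red z)) (red-null z)
        where
        neg : ∀ a b → a - b ≡ - 1ℤ * (b - a)
        neg = solve-∀
      lem : ∀ a z b r → a - z ≡ 1ℤ * (a - b) + 1ℤ * (b - z)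
      lem = solve-∀
      lem₂ : ∀ b r z → b - z ≡ 1ℤ * (b - r) + - 1ℤ * (z - r)
      lem₂ = solve-∀

    fermat-unit : ∀ z → ¬ Null z → Null (z ^ (p ℕ.∸ 1) - 1ℤ)
    fermat-unit z ¬z = null-cancel z _ ¬z (subst Null eq (fermat z))
      where
      lem : ∀ z a → z * a - z ≡ z * (a - 1ℤ)
      lem = solve-∀
      eq : z ^ p - z ≡ z * (z ^ (p ℕ.∸ 1) - 1ℤ)
      eq = trans (cong (λ q → z ^ q - z) (sym (ℕP.suc-pred p)))
          (trans (cong (λ q → z * z ^ q - z) (sym (ℕP.pred[m∸n]≡m∸[1+n] p 0))) (lem z (z ^ (p ℕ.∸ 1))))

    -- Fermat's little theorem makes z^(p-2) an inverse of every unit z.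
    inverse : ℤ → ℤ
    inverse z = z ^ (p ℕ.∸ 2)

    inverse-null : ∀ z → ¬ Null z → Null (z * inverse z - 1ℤ)
    inverse-null z ¬z = go p refl
      where
      go : ∀ q → q ≡ p → Null (z * inverse z - 1ℤ)
      go zero          e = ⊥-elim (ℕ.≢-nonZero⁻¹ p (sym e))
      go (suc zero)    e = ⊥-elim (¬prime[1] (subst Prime (sym e) pr))
      go (suc (suc q)) e = subst (λ m → Null (z * z ^ (m ℕ.∸ 2) - 1ℤ)) e
          (subst (λ m → Null (z ^ (m ℕ.∸ 1) - 1ℤ)) (sym e) (fermat-unit z ¬z))

open FermatLittle

-- Expansion of a line over hyperplanes, and the pairing of two weights.

module Hyperplanes (p : ℕ) (pr : Prime p) where

  open import Data.Integer using (ℤ; +_; -_; _+_; _*_; _-_; _≤_; _^_; 0ℤ; 1ℤ; +<+; Positive; positive)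
  open PrimeModulus p pr

  instance
    p-pos : Positive (+ p)
    p-pos = positive (+<+ (ℕ.>-nonZero⁻¹ p))

  cancel-p : ∀ {x y} → + p * x ≤ + p * y → x ≤ y
  cancel-p {x} {y} = ℤP.*-cancelˡ-≤-pos x y (+ p)

  -- The indicator of p ∣ z, scaled and centred to have mean zero over residues: it plays the part of
  -- the nontrivial additive characters.
  κ : ℤ → ℤ
  κ z = + p * δ z - 1ℤ

  κ-null : ∀ {z} → Null z → κ z ≡ + p - 1ℤ
  κ-null {z} h = cong (_- 1ℤ) (trans (cong (+ p *_) (δ-null h)) (ℤP.*-identityʳ (+ p)))

  κ-periodic : Periodic κ
  κ-periodic c d h = cong (λ t → + p * t - 1ℤ) (δ-shift h)

  -- If z ≡ 0 all p terms equal κ e. Otherwise c z + e runs through every residue once, and κ has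
  -- mean zero.
  ∑-κ-affine : ∀ z e → ∑ (range p) (λ c → κ (c * z + e)) ≡ δ z * (+ p * κ e)
  ∑-κ-affine z e with + p ∣? z
  ... | yes h = begin
    ∑ (range p) (λ c → κ (c * z + e))  ≡⟨ ∑-cong (range p) (λ c → κ-periodic (c * z + e) e (null-* c (lem c z e) h)) ⟩
    ∑ (range p) (λ _ → κ e)            ≡⟨ ∑-range-const p (κ e) ⟩
    + p * κ e                          ≡⟨ ℤP.*-identityˡ _ ⟨
    1ℤ * (+ p * κ e)                   ∎
    where
    lem : ∀ c z e → c * z + e - e ≡ c * z
    lem = solve-∀
  ... | no ¬h = begin
    ∑ (range p) (λ c → κ (c * z + e))
      ≡⟨ ∑-- (range p) (λ c → + p * δ (c * z + e)) (λ _ → 1ℤ) ⟩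
    ∑ (range p) (λ c → + p * δ (c * z + e)) - ∑ (range p) (λ _ → 1ℤ)
      ≡⟨ cong₂ _-_ (∑-*ˡ (range p) (+ p) _) (∑-range-const p 1ℤ) ⟩
    + p * ∑ (range p) (λ c → δ (c * z + e)) - + p * 1ℤ
      ≡⟨ cong (λ t → + p * t - + p * 1ℤ) one ⟩
    + p * 1ℤ - + p * 1ℤ
      ≡⟨ lem (+ p) (+ p * κ e) ⟩
    0ℤ * (+ p * κ e) ∎
    where
    one : ∑ (range p) (λ c → δ (c * z + e)) ≡ 1ℤ
    one = trans (∑-cong (range p) (λ c → sym (ℤP.*-identityʳ _)))
                (∑-pick-unit z (inverse z) e {λ _ → 1ℤ} (inverse-null z ¬h) (λ _ _ _ → refl))
    lem : ∀ p x → p * 1ℤ - p * 1ℤ ≡ 0ℤ * x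
    lem = solve-∀

  opaque
    unfolding _·_

    -- Orthogonality relation for κ. The offset e is arbitrary because the induction moves the
    -- contribution of the first coordinate into it.
    ∑-κ-dot : ∀ {m} (z : Vec ℤ m) e → ∑ (cube p m) (λ h → κ (h · z + e)) ≡ Z z * ((+ p) ^ m * κ e)
    ∑-κ-dot []      e = trans (∑-cube-zero p (λ h → κ (h · [] + e))) (trans (cong κ (ℤP.+-identityˡ e)) (lem (κ e)))
      where
      lem : ∀ x → x ≡ 1ℤ * (1ℤ * x)
      lem = solve-∀
    ∑-κ-dot {suc m} (a ∷ z) e = begin
      ∑ (cube p (suc m)) (λ h → κ (h · (a ∷ z) + e))
        ≡⟨ ∑-cube p m _ ⟩
      ∑ (range p) (λ c → ∑ (cube p m) (λ h → κ (c * a + h · z + e)))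
        ≡⟨ ∑-cong (range p) (λ c → trans (∑-cong (cube p m) (λ h → cong κ (lem₁ (c * a) (h · z) e)))
            (∑-κ-dot z (c * a + e))) ⟩
      ∑ (range p) (λ c → Z z * ((+ p) ^ m * κ (c * a + e)))
        ≡⟨ trans (∑-*ˡ (range p) (Z z) _) (cong (Z z *_) (∑-*ˡ (range p) ((+ p) ^ m) _)) ⟩
      Z z * ((+ p) ^ m * ∑ (range p) (λ c → κ (c * a + e)))
        ≡⟨ cong (λ t → Z z * ((+ p) ^ m * t)) (∑-κ-affine a e) ⟩
      Z z * ((+ p) ^ m * (δ a * (+ p * κ e)))
        ≡⟨ lem₂ (Z z) ((+ p) ^ m) (δ a) (+ p) (κ e) ⟩
      δ a * Z z * ((+ p * (+ p) ^ m) * κ e)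
        ≡⟨ cong (_* ((+ p) ^ suc m * κ e)) (Z-∷ a z) ⟨
      Z (a ∷ z) * ((+ p) ^ suc m * κ e) ∎
      where
      lem₁ : ∀ a b e → a + b + e ≡ b + (a + e)
      lem₁ = solve-∀
      lem₂ : ∀ Z q d p k → Z * (q * (d * (p * k))) ≡ d * Z * ((p * q) * k)
      lem₂ = solve-∀

  ∑-Z : ∀ {m} (v : Vec ℤ m) → ∑ (cube p m) (λ y → Z (y ⊖ v)) ≡ 1ℤ
  ∑-Z []      = refl
  ∑-Z {suc m} (a ∷ v) = begin
    ∑ (cube p (suc m)) (λ y → Z (y ⊖ (a ∷ v)))
      ≡⟨ ∑-cube p m _ ⟩
    ∑ (range p) (λ c → ∑ (cube p m) (λ y → Z ((c - a) ∷ (y ⊖ v))))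
      ≡⟨ ∑-cong (range p) (λ c → ∑-cong (cube p m) (λ y → Z-∷ (c - a) (y ⊖ v))) ⟩
    ∑ (range p) (λ c → ∑ (cube p m) (λ y → δ (c - a) * Z (y ⊖ v)))
      ≡⟨ ∑-∑-* (range p) (cube p m) (λ c → δ (c - a)) (λ y → Z (y ⊖ v)) ⟩
    ∑ (range p) (λ c → δ (c - a)) * ∑ (cube p m) (λ y → Z (y ⊖ v))
      ≡⟨ cong₂ _*_ (∑-δ a) (∑-Z v) ⟩
    1ℤ ∎

  Z-pick : ∀ {m} (v v′ : Vec ℤ m) → ZeroV (v ⊖ v′) → ∀ y → Z (y ⊖ v) ≡ Z (y ⊖ v′)
  Z-pick v v′ h y = Z-shift (go y v v′ h)
    where
    lem : ∀ y a b → (y - a) - (y - b) ≡ - 1ℤ * (a - b)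
    lem = solve-∀
    go : ∀ {m} (y v v′ : Vec ℤ m) → ZeroV (v ⊖ v′) → ZeroV ((y ⊖ v) ⊖ (y ⊖ v′))
    go []      []      []       AllV.[]        = AllV.[]
    go (y ∷ ys) (a ∷ v) (b ∷ v′) (h AllV.∷ hs) = null-* (- 1ℤ) (lem y a b) h AllV.∷ go ys v v′ hs

  opaque
    unfolding _·_

    -- Hyperplanes through the origin containing w separate the points off the line spanned by w.
    ∑-line : ∀ {n} (w : Vec ℤ (suc n)) i → Null (Data.Vec.head w * i - 1ℤ) → ∀ z →
      ∑ (cube p (suc n)) (λ h → δ (h · w) * κ (h · z)) ≡
      (+ p) ^ n * (+ p - 1ℤ) * ∑ (range p) (λ a → Z (z ⊖ a ⊙ w))
    ∑-line {n} (w₀ ∷ w) i inv (z₀ ∷ z) = trans left (sym right)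
      where
      -- The first coordinate forces a ≡ i z₀ for a point z on the line; T tests the other
      -- coordinates. Both sides are reduced to the same multiple of T.
      T : ℤ
      T = Z (z ⊖ (i * z₀) ⊙ w)
      lem₁ : ∀ i z₀ s t → - (i * s) * z₀ + t ≡ t - (i * z₀) * s + 0ℤ
      lem₁ = solve-∀
      lem₂ : ∀ T q k → T * (q * k) ≡ q * k * T
      lem₂ = solve-∀
      g-per : ∀ s → Periodic (λ c → κ (c * z₀ + s))
      g-per s c d h = κ-periodic (c * z₀ + s) (d * z₀ + s) (null-* z₀ (lem c d z₀ s) h)
        where
        lem : ∀ c d z s → c * z + s - (d * z + s) ≡ z * (c - d)
        lem = solve-∀
      left : ∑ (cube p (suc n)) (λ h → δ (h · (w₀ ∷ w)) * κ (h · (z₀ ∷ z))) ≡ (+ p) ^ n * (+ p - 1ℤ) * T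
      left = begin
        ∑ (cube p (suc n)) (λ h → δ (h · (w₀ ∷ w)) * κ (h · (z₀ ∷ z)))
          ≡⟨ trans (∑-cube p n _) (∑-swap (range p) (cube p n) _) ⟩
        ∑ (cube p n) (λ h → ∑ (range p) (λ c → δ (c * w₀ + h · w) * κ (c * z₀ + h · z)))
          -- Since w₀ is a unit, orthogonality to w determines the first coordinate of h; the other
          -- n coordinates remain free and the orthogonality relation applies to them.
          ≡⟨ ∑-cong (cube p n) (λ h → ∑-pick-unit w₀ i (h · w) inv (g-per (h · z))) ⟩
        ∑ (cube p n) (λ h → κ (- (i * h · w) * z₀ + h · z))
          ≡⟨ ∑-cong (cube p n) (λ h → cong κ (trans (lem₁ i z₀ (h · w) (h · z))
              (cong (_+ 0ℤ) (sym (trans (·-⊖ h z _) (cong (λ t → h · z - t) (·-⊙ h (i * z₀) w))))))) ⟩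
        ∑ (cube p n) (λ h → κ (h · (z ⊖ (i * z₀) ⊙ w) + 0ℤ))
          ≡⟨ ∑-κ-dot (z ⊖ (i * z₀) ⊙ w) 0ℤ ⟩
        T * ((+ p) ^ n * κ 0ℤ)
          ≡⟨ cong (λ t → T * ((+ p) ^ n * t)) (κ-null null-0) ⟩
        T * ((+ p) ^ n * (+ p - 1ℤ))
          ≡⟨ lem₂ T ((+ p) ^ n) (+ p - 1ℤ) ⟩
        (+ p) ^ n * (+ p - 1ℤ) * T ∎
      per : Periodic (λ a → Z (z ⊖ a ⊙ w))
      per c d h = Z-pick (c ⊙ w) (d ⊙ w) (go w) z
        where
        lem : ∀ c d w → c * w - d * w ≡ w * (c - d)
        lem = solve-∀
        go : ∀ {m} (w : Vec ℤ m) → ZeroV (c ⊙ w ⊖ d ⊙ w)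
        go []      = AllV.[]
        go (w ∷ ws) = null-* w (lem c d w) h AllV.∷ go ws
      right : (+ p) ^ n * (+ p - 1ℤ) * ∑ (range p) (λ a → Z ((z₀ ∷ z) ⊖ a ⊙ (w₀ ∷ w))) ≡ (+ p) ^ n * (+ p - 1ℤ) * T
      right = cong ((+ p) ^ n * (+ p - 1ℤ) *_) (begin
        ∑ (range p) (λ a → Z ((z₀ - a * w₀) ∷ (z ⊖ a ⊙ w)))
          ≡⟨ ∑-cong (range p) (λ a → trans (Z-∷ (z₀ - a * w₀) (z ⊖ a ⊙ w)) (cong (_* Z (z ⊖ a ⊙ w)) (flip a))) ⟩
        ∑ (range p) (λ a → δ (a * w₀ + - z₀) * Z (z ⊖ a ⊙ w))
          ≡⟨ ∑-pick-unit w₀ i (- z₀) inv per ⟩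
        Z (z ⊖ (- (i * - z₀)) ⊙ w)
          ≡⟨ cong (λ c → Z (z ⊖ c ⊙ w)) (lem₃ i z₀) ⟩
        T ∎)
        where
        lem₃ : ∀ i z → - (i * - z) ≡ i * z
        lem₃ = solve-∀
        lem₄ : ∀ a w z → z - a * w ≡ - 1ℤ * (a * w + - z)
        lem₄ = solve-∀
        lem₅ : ∀ a w z → a * w + - z ≡ - 1ℤ * (z - a * w)
        lem₅ = solve-∀
        flip : ∀ a → δ (z₀ - a * w₀) ≡ δ (a * w₀ + - z₀)
        flip a = δ-cong (null-* (- 1ℤ) (lem₅ a w₀ z₀)) (null-* (- 1ℤ) (lem₄ a w₀ z₀))

  -- Like δ, κ reproduces itself under convolution, here up to the factor p: subtracting the mean
  -- only removes terms whose sum over c is zero.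
  ∑-κκ : ∀ s t → ∑ (range p) (λ c → κ (s - c) * κ (t - c)) ≡ + p * κ (t - s)
  ∑-κκ s t = begin
    ∑ (range p) (λ c → κ (s - c) * κ (t - c))
      ≡⟨ ∑-cong (range p) (λ c → trans (cong₂ (λ a b → (+ p * a - 1ℤ) * (+ p * b - 1ℤ)) (flip s c) refl)
          (lem₁ (+ p) (δ (c - s)) (δ (t - c)))) ⟩
    ∑ (range p) (λ c → + p * (δ (c - s) * κ (t - c)) - κ (t - c))
      ≡⟨ trans (∑-- (range p) _ _) (cong₂ _-_ (∑-*ˡ (range p) (+ p) _) (∑-cong (range p) (λ c → cong κ (lem₂ t c)))) ⟩
    + p * ∑ (range p) (λ c → δ (c - s) * κ (t - c)) - ∑ (range p) (λ c → κ (c * - 1ℤ + t))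
      ≡⟨ cong₂ (λ a b → + p * a - b) (∑-pick s per) (∑-κ-affine (- 1ℤ) t) ⟩
    + p * κ (t - s) - δ (- 1ℤ) * (+ p * κ t)
      ≡⟨ cong (λ d → + p * κ (t - s) - d * (+ p * κ t)) (𝟙-no (+ p ∣? - 1ℤ) ¬unit) ⟩
    + p * κ (t - s) - 0ℤ * (+ p * κ t)
      ≡⟨ lem₃ (+ p * κ (t - s)) (+ p * κ t) ⟩
    + p * κ (t - s) ∎
    where
    lem₁ : ∀ p a b → (p * a - 1ℤ) * (p * b - 1ℤ) ≡ p * (a * (p * b - 1ℤ)) - (p * b - 1ℤ)
    lem₁ = solve-∀
    lem₂ : ∀ t c → t - c ≡ c * - 1ℤ + t
    lem₂ = solve-∀
    lem₃ : ∀ x y → x - 0ℤ * y ≡ x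
    lem₃ = solve-∀
    neg : ∀ a b → a - b ≡ - 1ℤ * (b - a)
    neg = solve-∀
    flip : ∀ a b → δ (a - b) ≡ δ (b - a)
    flip a b = δ-cong (null-* (- 1ℤ) (neg b a)) (null-* (- 1ℤ) (neg a b))
    per : Periodic (λ c → κ (t - c))
    per c d h = κ-periodic (t - c) (t - d) (null-* (- 1ℤ) (lem t c d) h)
      where
      lem : ∀ t c d → t - c - (t - d) ≡ - 1ℤ * (c - d)
      lem = solve-∀
    ¬unit : ¬ Null (- 1ℤ)
    ¬unit h = ¬null-1 (null-* (- 1ℤ) refl h)

  module _ {N : ℕ} where

    -- This is p times the weighted number of pairs with h · (y - x) ≡ e, minus the weight of all
    -- pairs: the deviation from equidistribution seen by h.
    pairing : Vec ℤ N → ℤ → (φ ψ : Vec ℤ N → ℤ) → ℤ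
    pairing h e φ ψ = ∑ (cube p N) (λ x → ∑ (cube p N) (λ y → φ x * ψ y * κ (h · y - h · x - e)))

    -- This is p times the mass of φ on the affine hyperplane h · x ≡ s + c, minus the total mass.
    fibre : Vec ℤ N → ℤ → (Vec ℤ N → ℤ) → ℤ → ℤ
    fibre h s φ c = ∑ (cube p N) (λ x → φ x * κ (h · x - s - c))

    ∑-fibre : ∀ h s t φ ψ → ∑ (range p) (λ c → fibre h s φ c * fibre h t ψ c) ≡ + p * pairing h (t - s) φ ψ
    ∑-fibre h s t φ ψ = begin
      ∑ (range p) (λ c → fibre h s φ c * fibre h t ψ c)
        ≡⟨ ∑-cong (range p) (λ c → sym (∑-∑-* (cube p N) (cube p N) _ _)) ⟩
      ∑ (range p) (λ c → ∑ (cube p N) (λ x → ∑ (cube p N)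
          (λ y → φ x * κ (h · x - s - c) * (ψ y * κ (h · y - t - c)))))
        ≡⟨ trans (∑-swap (range p) (cube p N) _) (∑-cong (cube p N) (λ x → ∑-swap (range p) (cube p N) _)) ⟩
      ∑ (cube p N) (λ x → ∑ (cube p N) (λ y → ∑ (range p)
          (λ c → φ x * κ (h · x - s - c) * (ψ y * κ (h · y - t - c)))))
        ≡⟨ ∑-cong (cube p N) (λ x → ∑-cong (cube p N) (λ y → inner x y)) ⟩
      ∑ (cube p N) (λ x → ∑ (cube p N) (λ y → + p * (φ x * ψ y * κ (h · y - h · x - (t - s)))))
        ≡⟨ trans (∑-cong (cube p N) (λ x → ∑-*ˡ (cube p N) (+ p) _)) (∑-*ˡ (cube p N) (+ p) _) ⟩
      + p * pairing h (t - s) φ ψ ∎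
      where
      lem₁ : ∀ a b c d → a * b * (c * d) ≡ a * c * (b * d)
      lem₁ = solve-∀
      lem₂ : ∀ a p k → a * (p * k) ≡ p * (a * k)
      lem₂ = solve-∀
      lem₃ : ∀ X Y s t → Y - t - (X - s) ≡ Y - X - (t - s)
      lem₃ = solve-∀
      inner : ∀ x y → ∑ (range p) (λ c → φ x * κ (h · x - s - c) * (ψ y * κ (h · y - t - c))) ≡ + p *
          (φ x * ψ y * κ (h · y - h · x - (t - s)))
      inner x y = begin
        ∑ (range p) (λ c → φ x * κ (h · x - s - c) * (ψ y * κ (h · y - t - c)))
          ≡⟨ trans (∑-cong (range p) (λ c → lem₁ (φ x) (κ (h · x - s - c)) (ψ y) (κ (h · y - t - c))))
              (∑-*ˡ (range p) (φ x * ψ y) _) ⟩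
        φ x * ψ y * ∑ (range p) (λ c → κ (h · x - s - c) * κ (h · y - t - c))
          ≡⟨ cong (φ x * ψ y *_) (trans (∑-κκ (h · x - s) (h · y - t))
              (cong (λ k → + p * κ k) (lem₃ (h · x) (h · y) s t))) ⟩
        φ x * ψ y * (+ p * κ (h · y - h · x - (t - s)))
          ≡⟨ lem₂ (φ x * ψ y) (+ p) _ ⟩
        + p * (φ x * ψ y * κ (h · y - h · x - (t - s))) ∎

    ∑-fibre² : ∀ h s φ → ∑ (range p) (λ c → fibre h s φ c * fibre h s φ c) ≡ + p * pairing h 0ℤ φ φ
    ∑-fibre² h s φ = trans (∑-fibre h s s φ φ) (cong (λ t → + p * pairing h t φ φ) (ℤP.+-inverseʳ s))

    -- For ψ = φ and e = 0, p times the pairing is a sum of squares of fibre values.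
    pairing-nonneg : ∀ h φ → 0ℤ ≤ pairing h 0ℤ φ φ
    pairing-nonneg h φ = cancel-p (subst (_≤ + p * pairing h 0ℤ φ φ) (sym (ℤP.*-zeroʳ (+ p)))
      (subst (0ℤ ≤_) (∑-fibre² h 0ℤ φ) (∑-nonneg (range p) (λ c → 0≤square (fibre h 0ℤ φ c)))))

    -- AM-GM: p times the pairing is Σ_c F(c) G(c) for the centred fibre distributions F of φ and G of ψ.
    pairing-bound : ∀ h e φ ψ → (+ 2 * pairing h e φ ψ) within (pairing h 0ℤ φ φ + pairing h 0ℤ ψ ψ)
    pairing-bound h e φ ψ =
      cancel-p (subst₂ _≤_ eq-l eq-r (∑-mono (range p) (λ c → ≤-from-gap (lem₁ (F c) (G c))
          (0≤square (F c - G c))))) ,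
      cancel-p (subst₂ _≤_ (trans (∑-neg (range p) _) (trans (cong -_ eq-l) (ℤP.neg-distribʳ-* (+ p) _))) eq-r
          (∑-mono (range p) (λ c → ≤-from-gap (lem₂ (F c) (G c)) (0≤square (F c + G c)))))
      where
      F G : ℤ → ℤ
      F = fibre h 0ℤ φ
      G = fibre h e ψ
      lem₁ : ∀ x y → x * x + y * y ≡ + 2 * (x * y) + (x - y) * (x - y)
      lem₁ = solve-∀
      lem₂ : ∀ x y → x * x + y * y ≡ - (+ 2 * (x * y)) + (x + y) * (x + y)
      lem₂ = solve-∀
      lem₃ : ∀ p x → + 2 * (p * x) ≡ p * (+ 2 * x)
      lem₃ = solve-∀
      eq-l : ∑ (range p) (λ c → + 2 * (F c * G c)) ≡ + p * (+ 2 * pairing h e φ ψ)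
      eq-l = trans (∑-*ˡ (range p) (+ 2) _) (trans (cong (+ 2 *_)
          (trans (∑-fibre h 0ℤ e φ ψ) (cong (λ t → + p * pairing h t φ ψ) (ℤP.+-identityʳ e))))
          (lem₃ (+ p) (pairing h e φ ψ)))
      eq-r : ∑ (range p) (λ c → F c * F c + G c * G c) ≡ + p * (pairing h 0ℤ φ φ + pairing h 0ℤ ψ ψ)
      eq-r = trans (∑-+ (range p) _ _) (trans (cong₂ _+_ (∑-fibre² h 0ℤ φ) (∑-fibre² h e ψ))
          (sym (ℤP.*-distribˡ-+ (+ p) _ _)))

-- How many directions are orthogonal to a vector, and the incidence estimate.

module Directions (p : ℕ) (pr : Prime p) where

  open import Data.Integer using (ℤ; +_; -_; _+_; _*_; _-_; _≤_; _^_; 0ℤ; 1ℤ; +≤+; +<+; Positive; positive)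
  open PrimeModulus p pr
  open Hyperplanes p pr

  -- States w_j ≡ - 1/(b + t_j) without division, which also forces b + t_j and w_j to be units.
  NegReciprocals : ∀ {N} → ℤ → Vec ℤ N → Vec ℤ N → Set
  NegReciprocals b = Pointwise (λ t w → Null ((b + t) * w + 1ℤ))

  negReciprocal-unit : ∀ a w → Null (a * w + 1ℤ) → ¬ Null w
  negReciprocal-unit a w h k = ¬null-1 (null-lin 1ℤ (- a) (lem a w) h k)
    where
    lem : ∀ a w → 1ℤ ≡ 1ℤ * (a * w + 1ℤ) + - a * w
    lem = solve-∀

  Distinct : ∀ {N} → Vec ℤ N → Set
  Distinct = AllPairs (λ s t → ¬ Null (s - t))

  -- Partial fractions: if Σ hⱼ/(b + tⱼ) vanishes at b′, then away from b′ its zeros are those of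
  -- the sum with poles t₁, t₂, … only and these coefficients.
  eliminate : ∀ {N} → ℤ → Vec ℤ N → Vec ℤ N → Vec ℤ N → Vec ℤ N
  eliminate t₀ []      []      []      = []
  eliminate t₀ (h ∷ hs) (t ∷ ts) (w ∷ ws) = h * w * (t₀ - t) ∷ eliminate t₀ hs ts ws

  -- The right side combines the two relations (b + t) w ≡ - 1 and (b′ + t) w′ ≡ - 1 with explicit
  -- cofactors, so the left side vanishes modulo p although nothing is divided.
  eliminate-term : ∀ t₀ b b′ h t w w′ → (b - b′) * (h * w′ * (t₀ - t) * w) -
      ((b + t₀) * (h * w) - (b′ + t₀) * (h * w′)) ≡
    h * ((t₀ - t) * w′ - 1ℤ) * ((b + t) * w + 1ℤ) + h * (1ℤ - (t₀ - t) * w) * ((b′ + t) * w′ + 1ℤ)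
  eliminate-term = solve-∀

  eliminate-split : ∀ β A A′ g w x x′ D S S′ →
    β * (g * w + D) - (A * (x + S) - A′ * (x′ + S′)) ≡
    (β * D - (A * S - A′ * S′)) + (β * (g * w) - (A * x - A′ * x′))
  eliminate-split = solve-∀

  eliminate-nil : ∀ b b′ t → (b - b′) * 0ℤ - ((b + t) * 0ℤ - (b′ + t) * 0ℤ) ≡ 0ℤ
  eliminate-nil = solve-∀

  eliminate-step : ∀ t₀ b b′ h t w w′ D S S′ {E H H′} → E ≡ h * w′ * (t₀ - t) * w + D → H ≡ h * w + S →
      H′ ≡ h * w′ + S′ →
    Null ((b + t) * w + 1ℤ) → Null ((b′ + t) * w′ + 1ℤ) →
    Null ((b - b′) * D - ((b + t₀) * S - (b′ + t₀) * S′)) →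
    Null ((b - b′) * E - ((b + t₀) * H - (b′ + t₀) * H′))
  eliminate-step t₀ b b′ h t w w′ D S S′ eE eH eH′ r r′ ih =
    null-+ (trans (cong₂ (λ e k → (b - b′) * e - k) eE (cong₂ (λ k k′ → (b + t₀) * k - (b′ + t₀) * k′) eH eH′))
                  (eliminate-split (b - b′) (b + t₀) (b′ + t₀) (h * w′ * (t₀ - t)) w (h * w) (h * w′) D S S′)) ih
      (null-lin (h * ((t₀ - t) * w′ - 1ℤ)) (h * (1ℤ - (t₀ - t) * w)) (eliminate-term t₀ b b′ h t w w′) r r′)

  -- Because (b + t₀)/(b + t) = 1 + (t₀ - t)/(b + t), the constant 1 drops out of the difference
  -- between b and b′, and (b + t₀) w - (b′ + t₀) w′ ≡ (b - b′)(t₀ - t) w w′ in each coordinate.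
  eliminate-dot : ∀ {N} t₀ b b′ (h t w w′ : Vec ℤ N) → NegReciprocals b t w → NegReciprocals b′ t w′ →
    Null ((b - b′) * eliminate t₀ h t w′ · w - ((b + t₀) * h · w - (b′ + t₀) * h · w′))
  eliminate-dot t₀ b b′ []      []      []      []       _ _ =
    subst Null (sym (trans (cong₂ (λ x y → (b - b′) * x - y) (·-[] [])
        (cong₂ (λ x y → (b + t₀) * x - (b′ + t₀) * y) (·-[] []) (·-[] []))) (eliminate-nil b b′ t₀))) null-0
  eliminate-dot t₀ b b′ (h ∷ hs) (t ∷ ts) (w ∷ ws) (w′ ∷ ws′) (r Pointwise.∷ rs) (r′ Pointwise.∷ rs′) =
    eliminate-step t₀ b b′ h t w w′ (eliminate t₀ hs ts ws′ · ws) (hs · ws) (hs · ws′)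
      {eliminate t₀ (h ∷ hs) (t ∷ ts) (w′ ∷ ws′) · (w ∷ ws)} {(h ∷ hs) · (w ∷ ws)} {(h ∷ hs) · (w′ ∷ ws′)}
      (·-∷ (h * w′ * (t₀ - t)) w (eliminate t₀ hs ts ws′) ws) (·-∷ h w hs ws) (·-∷ h w′ hs ws′) r r′
      (eliminate-dot t₀ b b′ hs ts ws ws′ rs rs′)

  -- Each coefficient was multiplied by w′ and t₀ - t, both units, so elimination cannot annihilate
  -- a nonzero one.
  eliminate-zero : ∀ {N} t₀ b′ (h t w′ : Vec ℤ N) → NegReciprocals b′ t w′ → AllV (λ t → ¬ Null (t₀ - t)) t →
    ZeroV (eliminate t₀ h t w′) → ZeroV h
  eliminate-zero t₀ b′ []      []      []       _ _ _ = AllV.[]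
  eliminate-zero t₀ b′ (h ∷ hs) (t ∷ ts) (w ∷ ws) (r Pointwise.∷ rs) (a AllV.∷ as) (z AllV.∷ zs) =
    null-cancel w h (negReciprocal-unit (b′ + t) w r)
      (null-cancel (t₀ - t) (w * h) a (null-* 1ℤ (lem t₀ t h w) z)) AllV.∷
    eliminate-zero t₀ b′ hs ts ws rs as zs
    where
    lem : ∀ t₀ t h w → (t₀ - t) * (w * h) ≡ 1ℤ * (h * w * (t₀ - t))
    lem = solve-∀

  opaque
    unfolding _·_

    zero-dot : ∀ {N} (h w : Vec ℤ N) → ZeroV h → Null (h · w)
    zero-dot []      []      AllV.[]        = null-0
    zero-dot (h ∷ hs) (w ∷ ws) (z AllV.∷ zs) = null-lin w 1ℤ (lem h w _) z (zero-dot hs ws zs)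
      where
      lem : ∀ h w s → h * w + s ≡ w * h + 1ℤ * s
      lem = solve-∀

  -- Induction on the number of poles. Given one root b′, every other root is a root of the
  -- eliminated sum, which has one pole fewer; b′ itself is counted at most once because `bs` has
  -- incongruent entries.
  root-count : ∀ {N} (t : Vec ℤ N) → Distinct t → (bs : List ℤ) → (∀ b′ → ∑ bs (λ b → δ (b - b′)) ≤ 1ℤ) →
    (w : ℤ → Vec ℤ N) → All (λ b → NegReciprocals b t (w b)) bs →
    (h : Vec ℤ N) → ¬ ZeroV h → ∑ bs (λ b → δ (h · w b)) ≤ + N
  root-count []       _ bs U w recip [] h≢0 = ⊥-elim (h≢0 AllV.[])
  root-count {suc N} (t₀ ∷ t) (apart AllPairs.∷ dist) bs U w recip (h₀ ∷ h) h≢0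
    with any? (λ b → + p ∣? ((h₀ ∷ h) · w b)) bs
  ... | no none = subst (_≤ + suc N) (sym (trans (∑-congᴬ (All.map (𝟙-no (+ p ∣? _)) (¬Any⇒All¬ bs none)))
      (∑-0 bs))) (0≤+ (suc N))
  ... | yes some = ℤP.≤-trans (∑-monoᴬ (All.map pointwise recip)) (subst (_≤ + suc N) (sym (∑-+ bs _ _))
        (ℤP.+-mono-≤ (U b′) (root-count t dist bs U (tail ∘ w) (All.map (λ {b} → tails b) recip) h′ h′≢0)))
    where
    b′ : ℤ
    b′ = proj₁ (Any.satisfied some)
    found : Null ((h₀ ∷ h) · w b′) × NegReciprocals b′ (t₀ ∷ t) (w b′)
    found = proj₂ (Any.satisfied some) , rec′ some recip
      where
      rec′ : ∀ {xs} (a : Any (λ b → Null ((h₀ ∷ h) · w b)) xs) → All (λ b → NegReciprocals b (t₀ ∷ t) (w b)) xs →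
        NegReciprocals (proj₁ (Any.satisfied a)) (t₀ ∷ t) (w (proj₁ (Any.satisfied a)))
      rec′ (here _)  (r ∷ _)  = r
      rec′ (there a) (_ ∷ rs) = rec′ a rs
    tails : ∀ b {v : Vec ℤ (suc N)} → NegReciprocals b (t₀ ∷ t) v → NegReciprocals b t (tail v)
    tails _ (_ Pointwise.∷ rs) = rs
    h′ : Vec ℤ N
    h′ = eliminate t₀ h t (tail (w b′))
    -- If the remaining coefficients all vanish, the root b′ leaves h₀ w₀ ≡ 0 with w₀ a unit. Hence
    -- a nonzero h stays nonzero after elimination.
    zero-all : ∀ {v : Vec ℤ (suc N)} → Null ((h₀ ∷ h) · v) → NegReciprocals b′ (t₀ ∷ t) v → ZeroV h → ZeroV (h₀ ∷ h)
    zero-all {w₀ ∷ ws} root (r Pointwise.∷ _) z =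
      null-cancel w₀ h₀ (negReciprocal-unit (b′ + t₀) w₀ r)
          (null-lin 1ℤ (- 1ℤ) (lem h₀ w₀ (h · ws)) (subst Null (·-∷ h₀ w₀ h ws) root) (zero-dot h ws z)) AllV.∷ z
      where
      lem : ∀ h w s → w * h ≡ 1ℤ * (h * w + s) + - 1ℤ * s
      lem = solve-∀
    h′≢0 : ¬ ZeroV h′
    h′≢0 z = h≢0 (zero-all (proj₁ found) (proj₂ found) (eliminate-zero t₀ b′ h t (tail (w b′))
        (tails b′ (proj₂ found)) apart z))
    root-step : ∀ b {v v′ : Vec ℤ (suc N)} → NegReciprocals b (t₀ ∷ t) v → NegReciprocals b′ (t₀ ∷ t) v′ →
      Null ((h₀ ∷ h) · v) → Null ((h₀ ∷ h) · v′) → Null ((b - b′) * eliminate t₀ h t (tail v′) · tail v)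
    root-step b {w₀ ∷ ws} {w₀′ ∷ ws′} (r Pointwise.∷ rs) (r′ Pointwise.∷ rs′) root root′ =
      finish (b + t₀) (b′ + t₀) ((b - b′) * eliminate t₀ h t ws′ · ws) (h · ws) (h · ws′)
        (eliminate-dot t₀ b b′ h t ws ws′ rs rs′) (subst Null (·-∷ h₀ w₀ h ws) root)
            (subst Null (·-∷ h₀ w₀′ h ws′) root′) r r′
      where
      lem : ∀ A A′ h₀ w₀ w₀′ X S S′ → X ≡
        (X - (A * S - A′ * S′)) +
        ((A * (h₀ * w₀ + S) + - A′ * (h₀ * w₀′ + S′)) + (- h₀ * (A * w₀ + 1ℤ) + h₀ * (A′ * w₀′ + 1ℤ)))
      lem = solve-∀
      finish : ∀ A A′ X S S′ → Null (X - (A * S - A′ * S′)) → Null (h₀ * w₀ + S) → Null (h₀ * w₀′ + S′) →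
        Null (A * w₀ + 1ℤ) → Null (A′ * w₀′ + 1ℤ) → Null X
      finish A A′ X S S′ e s s′ r r′ = null-+ (lem A A′ h₀ w₀ w₀′ X S S′) e
        (null-+ refl (null-lin A (- A′) refl s s′) (null-lin (- h₀) h₀ refl r r′))
    pointwise : ∀ {b} → NegReciprocals b (t₀ ∷ t) (w b) → δ ((h₀ ∷ h) · w b) ≤ δ (b - b′) + δ (h′ · tail (w b))
    pointwise {b} rb with + p ∣? (b - b′) | + p ∣? ((h₀ ∷ h) · w b)
    ... | d       | no  _    = ℤP.+-mono-≤ (0≤𝟙 d) (0≤𝟙 (+ p ∣? (h′ · tail (w b))))
    ... | yes _   | yes _    = ℤP.+-monoʳ-≤ 1ℤ (0≤𝟙 (+ p ∣? (h′ · tail (w b))))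
    ... | no b≢b′ | yes root = ℤP.≤-reflexive (sym (trans (ℤP.+-identityˡ _) (δ-null
            (null-cancel (b - b′) _ b≢b′ (root-step b rb (proj₂ found) root (proj₁ found))))))

  0≤p-1 : 0ℤ ≤ + p - 1ℤ
  0≤p-1 = 0≤gap (+≤+ (ℕ.>-nonZero⁻¹ p))

  Bounded : ∀ {X : Set} → (X → ℤ) → Set
  Bounded φ = ∀ x → 0ℤ ≤ φ x × φ x ≤ 1ℤ

  -- A Parseval bound: by orthogonality only the pairs with x ≡ y survive, each with weight pᴺ (p -
  -- 1). The values of φ are then simply bounded by 1.
  ∑-pairing : ∀ {N} (φ : Vec ℤ N → ℤ) → Bounded φ →
    ∑ (cube p N) (λ h → pairing h 0ℤ φ φ) ≤ (+ p - 1ℤ) * ((+ p) ^ N * (+ p) ^ N)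
  ∑-pairing {N} φ bd = subst₂ _≤_ (sym eq-l) eq-r
    (∑-mono (cube p N) (λ x → ∑-mono (cube p N) (λ y → *-mono-≤ (0≤-* (proj₁ (bd x)) (proj₁ (bd y)))
        (0≤-* (0≤𝟙 (zeroV? (y ⊖ x))) c≥0) (φφ x y) ℤP.≤-refl)))
    where
    c : ℤ
    c = (+ p) ^ N * (+ p - 1ℤ)
    c≥0 : 0ℤ ≤ c
    c≥0 = 0≤-* (0≤^ p N) 0≤p-1
    φφ : ∀ x y → φ x * φ y ≤ 1ℤ
    φφ x y = *-mono-≤ {b = 1ℤ} {y = 1ℤ} (proj₁ (bd x)) (0≤+ 1) (proj₂ (bd x)) (proj₂ (bd y))
    lem : ∀ P X → P - X - 0ℤ ≡ P - X + 0ℤ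
    lem = solve-∀
    lem₂ : ∀ q k → q * (1ℤ * (q * k)) ≡ k * (q * q)
    lem₂ = solve-∀
    inner : ∀ x y → ∑ (cube p N) (λ h → φ x * φ y * κ (h · y - h · x - 0ℤ)) ≡ φ x * φ y * (Z (y ⊖ x) * c)
    inner x y = trans (∑-*ˡ (cube p N) (φ x * φ y) _) (cong (φ x * φ y *_) (begin
      ∑ (cube p N) (λ h → κ (h · y - h · x - 0ℤ))
        ≡⟨ ∑-cong (cube p N) (λ h → cong κ (trans (lem (h · y) (h · x)) (cong (_+ 0ℤ) (sym (·-⊖ h y x))))) ⟩
      ∑ (cube p N) (λ h → κ (h · (y ⊖ x) + 0ℤ))
        ≡⟨ ∑-κ-dot (y ⊖ x) 0ℤ ⟩
      Z (y ⊖ x) * ((+ p) ^ N * κ 0ℤ)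
        ≡⟨ cong (λ k → Z (y ⊖ x) * ((+ p) ^ N * k)) (κ-null null-0) ⟩
      Z (y ⊖ x) * c ∎))
    eq-l : ∑ (cube p N) (λ h → pairing h 0ℤ φ φ) ≡ ∑ (cube p N)
        (λ x → ∑ (cube p N) (λ y → φ x * φ y * (Z (y ⊖ x) * c)))
    eq-l = trans (∑-swap (cube p N) (cube p N) _) (∑-cong (cube p N) (λ x →
             trans (∑-swap (cube p N) (cube p N) _) (∑-cong (cube p N) (λ y → inner x y))))
    eq-r : ∑ (cube p N) (λ x → ∑ (cube p N) (λ y → 1ℤ * (Z (y ⊖ x) * c))) ≡ (+ p - 1ℤ) * ((+ p) ^ N * (+ p) ^ N)
    eq-r = begin
      ∑ (cube p N) (λ x → ∑ (cube p N) (λ y → 1ℤ * (Z (y ⊖ x) * c)))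
        ≡⟨ ∑-cong (cube p N) (λ x → trans (∑-cong (cube p N) (λ y → ℤP.*-identityˡ _))
            (trans (∑-*ʳ (cube p N) c _) (cong (_* c) (∑-Z x)))) ⟩
      ∑ (cube p N) (λ x → 1ℤ * c)
        ≡⟨ ∑-cube-const p N (1ℤ * c) ⟩
      (+ p) ^ N * (1ℤ * c)
        ≡⟨ lem₂ ((+ p) ^ N) (+ p - 1ℤ) ⟩
      (+ p - 1ℤ) * ((+ p) ^ N * (+ p) ^ N) ∎

  ∑-Z₀ : ∀ N → ∑ (cube p N) Z ≡ 1ℤ
  ∑-Z₀ N = trans (∑-cong (cube p N) (λ h → cong Z (sym (⊖-0 h)))) (∑-Z (replicate N 0ℤ))
    where
    ⊖-0 : ∀ {N} (h : Vec ℤ N) → h ⊖ replicate N 0ℤ ≡ h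
    ⊖-0 []      = refl
    ⊖-0 (a ∷ h) = cong₂ _∷_ (ℤP.+-identityʳ a) (⊖-0 h)

  -- Incidences of two weights with a family of lines.

  module Mixing {n : ℕ} {B : Set} (bs : List B) (w u : B → Vec ℤ (suc n))
    (units : All (λ b → ∃ λ i → Null (head (w b) * i - 1ℤ)) bs)
    (L : ℕ) (roots : ∀ h → ¬ ZeroV h → ∑ bs (λ b → δ (h · w b)) ≤ + L)
    where

    N : ℕ
    N = suc n

    -- The sum over a is the indicator of y − x lying on the line u b + F_p (w b), as w b ≢ 0.
    incidence : (φ ψ : Vec ℤ N → ℤ) → ℤ
    incidence φ ψ = ∑ bs (λ b → ∑ (cube p N) (λ x → ∑ (cube p N) (λ y →
      φ x * ψ y * ∑ (range p) (λ a → Z (y ⊖ x ⊖ u b ⊖ a ⊙ w b)))))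

    incidence-pairing : ∀ φ ψ → (+ p) ^ n * (+ p - 1ℤ) * incidence φ ψ ≡
      ∑ bs (λ b → ∑ (cube p N) (λ h → δ (h · w b) * pairing h (h · u b) φ ψ))
    incidence-pairing φ ψ = trans (sym (∑-*ˡ bs c _)) (∑-congᴬ (All.map (λ {b} e → step b e) units))
      where
      c : ℤ
      c = (+ p) ^ n * (+ p - 1ℤ)
      lem₁ : ∀ c f s → c * (f * s) ≡ f * (c * s)
      lem₁ = solve-∀
      lem₂ : ∀ f d k → f * (d * k) ≡ d * (f * k)
      lem₂ = solve-∀
      step : ∀ b → (∃ λ i → Null (head (w b) * i - 1ℤ)) →
        c * ∑ (cube p N) (λ x → ∑ (cube p N) (λ y → φ x * ψ y * ∑ (range p) (λ a → Z (y ⊖ x ⊖ u b ⊖ a ⊙ w b)))) ≡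
        ∑ (cube p N) (λ h → δ (h · w b) * pairing h (h · u b) φ ψ)
      step b (i , inv) = begin
        c * ∑ (cube p N) (λ x → ∑ (cube p N) (λ y → φ x * ψ y * ∑ (range p) (λ a → Z (y ⊖ x ⊖ u b ⊖ a ⊙ w b))))
          ≡⟨ trans (sym (∑-*ˡ (cube p N) c _)) (∑-cong (cube p N) (λ x → sym (∑-*ˡ (cube p N) c _))) ⟩
        ∑ (cube p N) (λ x → ∑ (cube p N) (λ y → c * (φ x * ψ y * ∑ (range p) (λ a → Z (y ⊖ x ⊖ u b ⊖ a ⊙ w b)))))
          ≡⟨ ∑-cong (cube p N) (λ x → ∑-cong (cube p N) (λ y → inner x y)) ⟩
        ∑ (cube p N) (λ x → ∑ (cube p N) (λ y → ∑ (cube p N)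
            (λ h → δ (h · w b) * (φ x * ψ y * κ (h · y - h · x - h · u b)))))
          ≡⟨ trans (∑-cong (cube p N) (λ x → ∑-swap (cube p N) (cube p N) _)) (∑-swap (cube p N) (cube p N) _) ⟩
        ∑ (cube p N) (λ h → ∑ (cube p N) (λ x → ∑ (cube p N)
            (λ y → δ (h · w b) * (φ x * ψ y * κ (h · y - h · x - h · u b)))))
          ≡⟨ ∑-cong (cube p N) (λ h → trans (∑-cong (cube p N) (λ x → ∑-*ˡ (cube p N) (δ (h · w b)) _))
              (∑-*ˡ (cube p N) (δ (h · w b)) _)) ⟩
        ∑ (cube p N) (λ h → δ (h · w b) * pairing h (h · u b) φ ψ) ∎
        where
        inner : ∀ x y → c * (φ x * ψ y * ∑ (range p) (λ a → Z (y ⊖ x ⊖ u b ⊖ a ⊙ w b))) ≡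
          ∑ (cube p N) (λ h → δ (h · w b) * (φ x * ψ y * κ (h · y - h · x - h · u b)))
        inner x y = begin
          c * (φ x * ψ y * ∑ (range p) (λ a → Z (y ⊖ x ⊖ u b ⊖ a ⊙ w b)))
            ≡⟨ lem₁ c (φ x * ψ y) _ ⟩
          φ x * ψ y * (c * ∑ (range p) (λ a → Z (y ⊖ x ⊖ u b ⊖ a ⊙ w b)))
            ≡⟨ cong (φ x * ψ y *_) (∑-line (w b) i inv (y ⊖ x ⊖ u b)) ⟨
          φ x * ψ y * ∑ (cube p N) (λ h → δ (h · w b) * κ (h · (y ⊖ x ⊖ u b)))
            ≡⟨ ∑-*ˡ (cube p N) (φ x * ψ y) _ ⟨
          ∑ (cube p N) (λ h → φ x * ψ y * (δ (h · w b) * κ (h · (y ⊖ x ⊖ u b))))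
            ≡⟨ ∑-cong (cube p N) (λ h → trans (lem₂ (φ x * ψ y) (δ (h · w b)) _)
                 (cong (λ k → δ (h · w b) * (φ x * ψ y * κ k))
                     (trans (·-⊖ h (y ⊖ x) (u b)) (cong (_- h · u b) (·-⊖ h y x))))) ⟩
          ∑ (cube p N) (λ h → δ (h · w b) * (φ x * ψ y * κ (h · y - h · x - h · u b))) ∎

    -- For h ≡ 0 the kernel κ is constantly p - 1; this is the source of the main term.
    zero-pairing : ∀ {h} e φ ψ → ZeroV h → Null e → pairing h e φ ψ ≡ (+ p - 1ℤ) * (∑ (cube p N) φ * ∑ (cube p N) ψ)
    zero-pairing {h} e φ ψ z ne = begin
      pairing h e φ ψ
        ≡⟨ ∑-cong (cube p N) (λ x → ∑-cong (cube p N) (λ y → trans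
            (cong (φ x * ψ y *_) (κ-null (null-- (h · y - h · x) e
            (null-- (h · y) (h · x) (zero-dot h y z) (zero-dot h x z)) ne))) (ℤP.*-comm _ (+ p - 1ℤ)))) ⟩
      ∑ (cube p N) (λ x → ∑ (cube p N) (λ y → (+ p - 1ℤ) * (φ x * ψ y)))
        ≡⟨ trans (∑-cong (cube p N) (λ x → ∑-*ˡ (cube p N) (+ p - 1ℤ) _)) (∑-*ˡ (cube p N) (+ p - 1ℤ) _) ⟩
      (+ p - 1ℤ) * ∑ (cube p N) (λ x → ∑ (cube p N) (λ y → φ x * ψ y))
        ≡⟨ cong ((+ p - 1ℤ) *_) (∑-∑-* (cube p N) (cube p N) φ ψ) ⟩
      (+ p - 1ℤ) * (∑ (cube p N) φ * ∑ (cube p N) ψ) ∎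

    -- After h ≡ 0 is split off, AM-GM bounds each remaining pairing by two diagonal ones
    -- independent of b. Exchanging the sums, each h is charged at most L times, and the Parseval
    -- bound finishes. The factor 2 of AM-GM meets the two diagonal terms, and p - 1 is common to
    -- both sides.
    mixing : ∀ φ ψ → Bounded φ → Bounded ψ →
      ((+ p) ^ n * incidence φ ψ - + length bs * (∑ (cube p N) φ * ∑ (cube p N) ψ)) within
          (+ L * ((+ p) ^ N * (+ p) ^ N))
    mixing φ ψ bφ bψ = cancel (within-resp eq (within-≤ total second))
      where
      m S : ℤ
      m = ∑ (cube p N) φ * ∑ (cube p N) ψ
      S = (+ p) ^ n * incidence φ ψ - + length bs * m
      E : ℤ
      E = + L * ((+ p) ^ N * (+ p) ^ N)
      f : B → Vec ℤ N → ℤ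
      f b h = δ (h · w b) * pairing h (h · u b) φ ψ
      D : Vec ℤ N → ℤ
      D h = pairing h 0ℤ φ φ + pairing h 0ℤ ψ ψ
      D≥0 : ∀ h → 0ℤ ≤ D h
      D≥0 h = ℤP.+-mono-≤ (pairing-nonneg h φ) (pairing-nonneg h ψ)
      head-term : ∀ b h → Z h * f b h ≡ Z h * ((+ p - 1ℤ) * m)
      head-term b h with zeroV? h
      ... | no  _ = refl
      ... | yes z = cong (1ℤ *_) (trans (cong₂ _*_ (δ-null (zero-dot h (w b) z))
          (zero-pairing (h · u b) φ ψ z (zero-dot h (u b) z))) (ℤP.*-identityˡ _))
      first : ∑ bs (λ b → ∑ (cube p N) (λ h → Z h * f b h)) ≡ (+ p - 1ℤ) * (+ length bs * m)
      first = begin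
        ∑ bs (λ b → ∑ (cube p N) (λ h → Z h * f b h))
          ≡⟨ ∑-cong bs (λ b → trans (∑-cong (cube p N) (head-term b))
              (trans (∑-*ʳ (cube p N) _ Z) (trans (cong (_* ((+ p - 1ℤ) * m)) (∑-Z₀ N)) (ℤP.*-identityˡ _)))) ⟩
        ∑ bs (λ b → (+ p - 1ℤ) * m)
          ≡⟨ ∑-const _ bs ⟩
        + length bs * ((+ p - 1ℤ) * m)
          ≡⟨ lem (+ length bs) (+ p - 1ℤ) m ⟩
        (+ p - 1ℤ) * (+ length bs * m) ∎
        where
        lem : ∀ l q m → l * (q * m) ≡ q * (l * m)
        lem = solve-∀
      ¬Z : Vec ℤ N → ℤ
      ¬Z h = 1ℤ - Z h
      ¬Z≥0 : ∀ h → 0ℤ ≤ ¬Z h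
      ¬Z≥0 h = 0≤gap (𝟙≤1 (zeroV? h))
      second : (∑ bs (λ b → ∑ (cube p N) (λ h → ¬Z h * δ (h · w b) * (+ 2 * pairing h (h · u b) φ ψ)))) within
               (∑ bs (λ b → ∑ (cube p N) (λ h → ¬Z h * δ (h · w b) * D h)))
      second = ∑-within bs (All.universal (λ b → ∑-within (cube p N) (All.universal (λ h →
        within-* (0≤-* (¬Z≥0 h) (0≤𝟙 (+ p ∣? (h · w b)))) (pairing-bound h (h · u b) φ ψ)) (cube p N))) bs)
      eq : ∑ bs (λ b → ∑ (cube p N) (λ h → ¬Z h * δ (h · w b) * (+ 2 * pairing h (h · u b) φ ψ))) ≡ + 2 *
          ((+ p - 1ℤ) * S)
      eq = begin
        ∑ bs (λ b → ∑ (cube p N) (λ h → ¬Z h * δ (h · w b) * (+ 2 * pairing h (h · u b) φ ψ)))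
          ≡⟨ ∑-cong bs (λ b → ∑-cong (cube p N) (λ h → lem₁ (Z h) (δ (h · w b)) (pairing h (h · u b) φ ψ))) ⟩
        ∑ bs (λ b → ∑ (cube p N) (λ h → + 2 * (f b h - Z h * f b h)))
          ≡⟨ trans (∑-cong bs (λ b → trans (∑-*ˡ (cube p N) (+ 2) _) (cong (+ 2 *_) (∑-- (cube p N) (f b) _))))
              (trans (∑-*ˡ bs (+ 2) _) (cong (+ 2 *_) (∑-- bs _ _))) ⟩
        + 2 * (∑ bs (λ b → ∑ (cube p N) (f b)) - ∑ bs (λ b → ∑ (cube p N) (λ h → Z h * f b h)))
          ≡⟨ cong₂ (λ s t → + 2 * (s - t)) (sym (incidence-pairing φ ψ)) first ⟩
        + 2 * ((+ p) ^ n * (+ p - 1ℤ) * incidence φ ψ - (+ p - 1ℤ) * (+ length bs * m))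
          ≡⟨ lem₂ ((+ p) ^ n) (+ p - 1ℤ) (incidence φ ψ) (+ length bs * m) ⟩
        + 2 * ((+ p - 1ℤ) * S) ∎
        where
        lem₁ : ∀ z d q → (1ℤ - z) * d * (+ 2 * q) ≡ + 2 * (d * q - z * (d * q))
        lem₁ = solve-∀
        lem₂ : ∀ a q s t → + 2 * (a * q * s - q * t) ≡ + 2 * (q * (a * s - t))
        lem₂ = solve-∀
      few : ∀ h → ¬Z h * ∑ bs (λ b → δ (h · w b)) ≤ + L
      few h with zeroV? h
      ... | yes _  = subst (_≤ + L) (sym (ℤP.*-zeroˡ (∑ bs (λ b → δ (h · w b))))) (0≤+ L)
      ... | no h≢0 = subst (_≤ + L) (sym (ℤP.*-identityˡ _)) (roots h h≢0)
      total : ∑ bs (λ b → ∑ (cube p N) (λ h → ¬Z h * δ (h · w b) * D h)) ≤ + 2 * ((+ p - 1ℤ) * E)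
      total = ℤP.≤-trans (ℤP.≤-reflexive (trans (∑-swap bs (cube p N) _) (∑-cong (cube p N) (λ h →
                trans (∑-*ʳ bs (D h) _) (cong (_* D h) (∑-*ˡ bs (¬Z h) _))))))
        (ℤP.≤-trans (∑-mono (cube p N) (λ h → subst₂ _≤_ (ℤP.*-comm (D h) _) (ℤP.*-comm (D h) _)
            (*-monoˡ-≤ (D≥0 h) (few h))))
        (subst₂ _≤_ (sym (∑-*ˡ (cube p N) (+ L) D)) (lem (+ L) (+ p - 1ℤ) ((+ p) ^ N * (+ p) ^ N))
          (*-monoˡ-≤ (0≤+ L) (subst (_≤ ((+ p - 1ℤ) * q + (+ p - 1ℤ) * q)) (sym (∑-+ (cube p N) _ _))
              (ℤP.+-mono-≤ (∑-pairing φ bφ) (∑-pairing ψ bψ))))))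
        where
        q : ℤ
        q = (+ p) ^ N * (+ p) ^ N
        lem : ∀ l k q → l * (k * q + k * q) ≡ + 2 * (k * (l * q))
        lem = solve-∀
      instance
        p-1-pos : Positive (+ p - 1ℤ)
        p-1-pos = positive (ℤP.+-monoˡ-< (- 1ℤ) (+<+ (ℕ.nonTrivial⇒n>1 p {{prime⇒nonTrivial pr}})))
      cancel₁ : ∀ {x y} → + 2 * ((+ p - 1ℤ) * x) ≤ + 2 * ((+ p - 1ℤ) * y) → x ≤ y
      cancel₁ {x} {y} le = ℤP.*-cancelˡ-≤-pos x y (+ p - 1ℤ) (ℤP.*-cancelˡ-≤-pos _ _ (+ 2) le)
      cancel : (+ 2 * ((+ p - 1ℤ) * S)) within (+ 2 * ((+ p - 1ℤ) * E)) → S within E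
      cancel (a , b) = cancel₁ a , cancel₁ (subst (_≤ + 2 * ((+ p - 1ℤ) * E)) (lem (+ p - 1ℤ) S) b)
        where
        lem : ∀ q s → - (+ 2 * (q * s)) ≡ + 2 * (q * - s)
        lem = solve-∀

-- Counting ascending vectors by falling factorials.

module AscendingVectors where

  open import Data.Integer using (ℤ; +_; -_; _+_; _*_; _-_; _≤_; _<_; _^_; 0ℤ; 1ℤ; -1ℤ; +<+; -≤+; -<+)

  𝟙-linked : ∀ {R : ℤ → ℤ → Set} (R? : B.Decidable R) {N} x y (v : Vec ℤ N) →
    𝟙 (linked? R? (x ∷ y ∷ v)) ≡ 𝟙 (R? x y) * 𝟙 (linked? R? (y ∷ v))
  𝟙-linked R? x y v = trans
    (𝟙-cong (linked? R? (x ∷ y ∷ v)) (R? x y ×-dec linked? R? (y ∷ v)) (λ { (h Linked.∷ hs) → h , hs })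
        (λ (h , hs) → h Linked.∷ hs))
    (𝟙-× (R? x y) (linked? R? (y ∷ v)))

  fallingFactorial : ℕ → ℤ → ℤ
  fallingFactorial zero    z = 1ℤ
  fallingFactorial (suc N) z = (z - + N) * fallingFactorial N z

  -- The difference analogue of differentiating a power; it makes the sum over the first entry
  -- telescope.
  fallingFactorial-step : ∀ N z →
    fallingFactorial (suc N) (z + 1ℤ) ≡ fallingFactorial (suc N) z + + suc N * fallingFactorial N z
  fallingFactorial-step zero    z = lem z
    where
    lem : ∀ z → (z + 1ℤ - 0ℤ) * 1ℤ ≡ (z - 0ℤ) * 1ℤ + 1ℤ * 1ℤ
    lem = solve-∀
  fallingFactorial-step (suc N) z = trans (cong ((z + 1ℤ - + suc N) *_) (fallingFactorial-step N z))
      (lem z (+ N) (fallingFactorial N z))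
    where
    lem : ∀ z n f → (z + 1ℤ - (1ℤ + n)) * ((z - n) * f + (1ℤ + n) * f) ≡ (z - (1ℤ + n)) * ((z - n) * f) +
        (1ℤ + (1ℤ + n)) * ((z - n) * f)
    lem = solve-∀

  fallingFactorial-0 : ∀ N → fallingFactorial (suc N) 0ℤ ≡ 0ℤ
  fallingFactorial-0 zero    = refl
  fallingFactorial-0 (suc N) = trans (cong ((0ℤ - + suc N) *_) (fallingFactorial-0 N)) (ℤP.*-zeroʳ (0ℤ - + suc N))

  -- Telescoping over m < c < k. The value m = -1 stands for no lower bound; anything smaller would
  -- break the empty sum at k = 0.
  fallingFactorial-sum : ∀ N p m → -1ℤ ≤ m → ∀ k →
    ∑ (range k) (λ c → 𝟙 (m ℤP.<? c) * (+ suc N * fallingFactorial N (p - 1ℤ - c))) ≡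
    𝟙 (m ℤP.<? + k) * (fallingFactorial (suc N) (p - 1ℤ - m) - fallingFactorial (suc N) (p - + k))
  fallingFactorial-sum N p m -1≤m zero with m ℤP.<? 0ℤ
  ... | no  _   = refl
  ... | yes m<0 = sym (trans (ℤP.*-identityˡ _) (trans (cong (λ z → F z - F (p - 0ℤ))
      (trans (cong (λ m → p - 1ℤ - m) m≡-1) (lem p))) (ℤP.+-inverseʳ (F (p - 0ℤ)))))
    where
    F = fallingFactorial (suc N)
    m≡-1 : m ≡ -1ℤ
    m≡-1 = ℤP.≤-antisym (ℤP.i<j⇒i≤pred[j] m<0) -1≤m
    lem : ∀ p → p - 1ℤ - -1ℤ ≡ p - 0ℤ
    lem = solve-∀
  fallingFactorial-sum N p m -1≤m (suc k) = trans (cong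
      (λ s → 𝟙 (m ℤP.<? + k) * (+ suc N * fallingFactorial N (p - 1ℤ - + k)) + s)
      (fallingFactorial-sum N p m -1≤m k)) (cases (ℤP.<-cmp m (+ k)))
    where
    F = fallingFactorial (suc N)
    G : ℤ
    G = + suc N * fallingFactorial N (p - 1ℤ - + k)
    shift : ∀ p k → p - 1ℤ - k + 1ℤ ≡ p - k
    shift = solve-∀
    shift′ : ∀ p k → p - 1ℤ - k ≡ p - (1ℤ + k)
    shift′ = solve-∀
    F-step : F (p - + k) ≡ F (p - + suc k) + G
    F-step = trans (cong F (sym (shift p (+ k)))) (trans (fallingFactorial-step N (p - 1ℤ - + k))
        (cong (λ z → F z + G) (shift′ p (+ k))))
    lem : ∀ g a b → 1ℤ * g + 1ℤ * (a - (b + g)) ≡ 1ℤ * (a - b)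
    lem = solve-∀
    lem₀ : ∀ g a b → 0ℤ * g + 0ℤ * a ≡ 0ℤ * b
    lem₀ = solve-∀
    lem₁ : ∀ g a b → 0ℤ * g + 0ℤ * a ≡ 1ℤ * (b - b)
    lem₁ = solve-∀
    k<1+k : + k < + suc k
    k<1+k = +<+ (ℕP.n<1+n k)
    cases : _ → 𝟙 (m ℤP.<? + k) * G + 𝟙 (m ℤP.<? + k) * (F (p - 1ℤ - m) - F (p - + k)) ≡ 𝟙 (m ℤP.<? + suc k) *
        (F (p - 1ℤ - m) - F (p - + suc k))
    cases (tri< m<k _ _) = trans (cong₂ (λ i f → i * G + i * (F (p - 1ℤ - m) - f)) (𝟙-yes (m ℤP.<? + k) m<k) F-step)
      (trans (lem G (F (p - 1ℤ - m)) (F (p - + suc k)))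
          (cong (_* (F (p - 1ℤ - m) - F (p - + suc k))) (sym (𝟙-yes (m ℤP.<? + suc k) (ℤP.<-trans m<k k<1+k)))))
    cases (tri≈ ¬m<k m≡k _) = trans (cong (λ i → i * G + i * (F (p - 1ℤ - m) - F (p - + k)))
        (𝟙-no (m ℤP.<? + k) ¬m<k))
      (trans (lem₁ G (F (p - 1ℤ - m) - F (p - + k)) (F (p - + suc k)))
          (cong₂ (λ i f → i * (f - F (p - + suc k))) (sym
          (𝟙-yes (m ℤP.<? + suc k) (subst (_< + suc k) (sym m≡k) k<1+k)))
        (cong F (trans (sym (shift′ p (+ k))) (cong (λ z → p - 1ℤ - z) (sym m≡k))))))
    cases (tri> ¬m<k _ m>k) = trans (cong (λ i → i * G + i * (F (p - 1ℤ - m) - F (p - + k)))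
        (𝟙-no (m ℤP.<? + k) ¬m<k))
      (trans (lem₀ G (F (p - 1ℤ - m) - F (p - + k)) (F (p - 1ℤ - m) - F (p - + suc k)))
          (cong (_* (F (p - 1ℤ - m) - F (p - + suc k)))
          (sym (𝟙-no (m ℤP.<? + suc k) (ℤP.≤⇒≯ (ℤP.i<j⇒suc[i]≤j m>k))))))

  ascending? : ∀ {N} (v : Vec ℤ N) → Dec (Linked _<_ v)
  ascending? = linked? ℤP._<?_

  -- Ascending vectors are the N-element subsets of the p - 1 - m residues above m; the factor N!
  -- keeps the binomial coefficient a product. The induction fixes the least entry c and uses c as
  -- the new lower bound.
  count-ascending : ∀ p N m → -1ℤ ≤ m → m < + p →
    + (N !) * ∑ (cube p N) (λ v → 𝟙 (ascending? (m ∷ v))) ≡ fallingFactorial N (+ p - 1ℤ - m)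
  count-ascending p zero    m _ _ = refl
  count-ascending p (suc N) m -1≤m m<p = begin
    + (suc N !) * ∑ (cube p (suc N)) (λ v → 𝟙 (ascending? (m ∷ v)))
      ≡⟨ cong₂ _*_ (ℤP.pos-* (suc N) (N !)) (∑-cube p N _) ⟩
    + suc N * + (N !) * ∑ (range p) (λ c → ∑ (cube p N) (λ v → 𝟙 (ascending? (m ∷ c ∷ v))))
      ≡⟨ cong (+ suc N * + (N !) *_) (∑-cong (range p) (λ c → trans
          (∑-cong (cube p N) (λ v → 𝟙-linked ℤP._<?_ m c v)) (∑-*ˡ (cube p N) (𝟙 (m ℤP.<? c)) _))) ⟩
    + suc N * + (N !) * ∑ (range p) (λ c → 𝟙 (m ℤP.<? c) * S c)
      ≡⟨ sym (∑-*ˡ (range p) (+ suc N * + (N !)) _) ⟩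
    ∑ (range p) (λ c → + suc N * + (N !) * (𝟙 (m ℤP.<? c) * S c))
      ≡⟨ ∑-congᴬ (All.map (λ {c} → step c) (range-InRange p)) ⟩
    ∑ (range p) (λ c → 𝟙 (m ℤP.<? c) * (+ suc N * fallingFactorial N (+ p - 1ℤ - c)))
      ≡⟨ fallingFactorial-sum N (+ p) m -1≤m p ⟩
    𝟙 (m ℤP.<? + p) * (F (+ p - 1ℤ - m) - F (+ p - + p))
      ≡⟨ cong₂ (λ i f → i * (F (+ p - 1ℤ - m) - f)) (𝟙-yes (m ℤP.<? + p) m<p)
          (trans (cong F (ℤP.+-inverseʳ (+ p))) (fallingFactorial-0 N)) ⟩
    1ℤ * (F (+ p - 1ℤ - m) - 0ℤ)
      ≡⟨ lem₂ _ ⟩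
    F (+ p - 1ℤ - m) ∎
    where
    F = fallingFactorial (suc N)
    S : ℤ → ℤ
    S c = ∑ (cube p N) (λ v → 𝟙 (ascending? (c ∷ v)))
    lem : ∀ a b i s → a * b * (i * s) ≡ i * (a * (b * s))
    lem = solve-∀
    lem₂ : ∀ x → 1ℤ * (x - 0ℤ) ≡ x
    lem₂ = solve-∀
    step : ∀ c → InRange p c → + suc N * + (N !) * (𝟙 (m ℤP.<? c) * S c) ≡ 𝟙 (m ℤP.<? c) *
        (+ suc N * fallingFactorial N (+ p - 1ℤ - c))
    step c (r , r<p , refl) = trans (lem (+ suc N) (+ (N !)) (𝟙 (m ℤP.<? c)) (S c))
      (cong (λ s → 𝟙 (m ℤP.<? c) * (+ suc N * s)) (count-ascending p N c -≤+ (+<+ r<p)))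

  -- A leading −1 imposes no condition on vectors of residues; it starts the induction on a lower bound.
  module _ (p : ℕ) (1≤p : 1 ℕ.≤ p) where

    ascendingCount : ℕ → ℤ
    ascendingCount N = ∑ (cube p N) (λ v → 𝟙 (ascending? (-1ℤ ∷ v)))

    ascendingCount-ff : ∀ N → + (N !) * ascendingCount N ≡ fallingFactorial N (+ p)
    ascendingCount-ff N = trans (count-ascending p N -1ℤ ℤP.≤-refl -<+) (cong (fallingFactorial N) (lem (+ p)))
      where
      lem : ∀ p → p - 1ℤ - -1ℤ ≡ p
      lem = solve-∀

    ff-nonneg : ∀ N → 0ℤ ≤ fallingFactorial N (+ p)
    ff-nonneg N = subst (0ℤ ≤_) (ascendingCount-ff N) (0≤-* (0≤+ (N !))
        (∑-nonneg (cube p N) (λ v → 0≤𝟙 (ascending? (-1ℤ ∷ v)))))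

    ff-upper : ∀ N → fallingFactorial N (+ p) ≤ (+ p) ^ N
    ff-upper zero    = ℤP.≤-refl
    ff-upper (suc N) = ≤-from-gap (lem (+ p) (+ N) (fallingFactorial N (+ p)) ((+ p) ^ N))
      (ℤP.+-mono-≤ (0≤-* (0≤+ N) (ff-nonneg N)) (0≤-* (0≤+ p) (0≤gap (ff-upper N))))
      where
      lem : ∀ p n f q → p * q ≡ (p - n) * f + (n * f + p * (q - f))
      lem = solve-∀

    -- Replacing the factor p - i by p costs a relative error i/p, and the sum of all i < N is at
    -- most N².
    ff-lower : ∀ N → + p * ((+ p) ^ N - fallingFactorial N (+ p)) ≤ + N * + N * (+ p) ^ N
    ff-lower zero    = ℤP.≤-reflexive (lem (+ p))
      where
      lem : ∀ p → p * (1ℤ - 1ℤ) ≡ 0ℤ * 0ℤ * 1ℤ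
      lem = solve-∀
    ff-lower (suc N) = ≤-from-gap (lem (+ p) (+ N) (fallingFactorial N (+ p)) ((+ p) ^ N))
      (ℤP.+-mono-≤ (0≤-* (0≤+ p) (0≤gap (ff-lower N)))
        (ℤP.+-mono-≤ (0≤-* (0≤-* (0≤+ p) (0≤+ N)) (0≤gap (ff-upper N)))
            (0≤-* (0≤-* (0≤+ (suc N)) (0≤+ p)) (0≤^ p N))))
      where
      lem : ∀ p n f q → (1ℤ + n) * (1ℤ + n) * (p * q) ≡
        p * (p * q - (p - n) * f) + (p * (n * n * q - p * (q - f)) + (p * n * (q - f) + (1ℤ + n) * p * q))
      lem = solve-∀

    ascendingCount-within : ∀ N → (+ p * (+ (N !) * ascendingCount N - (+ p) ^ N)) within (+ N * + N * (+ p) ^ N)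
    ascendingCount-within N = subst (λ f → (+ p * (f - (+ p) ^ N)) within (+ N * + N * (+ p) ^ N))
        (sym (ascendingCount-ff N))
      ( ≤-from-gap (lem₁ (+ p) (+ N) (fallingFactorial N (+ p)) ((+ p) ^ N))
          (ℤP.+-mono-≤ (0≤-* (0≤-* (0≤+ N) (0≤+ N)) (0≤^ p N)) (0≤-* (0≤+ p) (0≤gap (ff-upper N))))
      , subst (_≤ + N * + N * (+ p) ^ N) (lem₂ (+ p) (fallingFactorial N (+ p)) ((+ p) ^ N)) (ff-lower N))
      where
      lem₁ : ∀ p n f q → n * n * q ≡ p * (f - q) + (n * n * q + p * (q - f))
      lem₁ = solve-∀
      lem₂ : ∀ p f q → p * (q - f) ≡ - (p * (f - q))
      lem₂ = solve-∀

open AscendingVectors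

-- Vectors whose order survives a small shift.

module Spacing where

  open import Data.Integer using (ℤ; +_; -[1+_]; -_; _+_; _*_; _-_; _≤_; _<_; _^_; 0ℤ; 1ℤ; -1ℤ; +<+; -≤+)

  1+≤ : ∀ {x y} → x < y → 0ℤ ≤ y - (1ℤ + x)
  1+≤ h = 0≤gap (ℤP.i<j⇒suc[i]≤j h)

  <-from-gap : ∀ {x y g} → y ≡ 1ℤ + x + g → 0ℤ ≤ g → x < y
  <-from-gap e h = ℤP.suc[i]≤j⇒i<j (≤-from-gap e h)

  module Windows (p : ℕ) .{{_ : ℕ.NonZero p}} where
    open Modular p

    ∑-𝟙≟ : ∀ d → ∑ (range p) (λ c → 𝟙 (c ℤP.≟ d)) ≤ 1ℤ
    ∑-𝟙≟ d = ℤP.≤-trans (∑-mono (range p) (λ c → 𝟙-mono (c ℤP.≟ d) (+ p ∣? (c - d))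
        (λ { refl → subst Null (sym (ℤP.+-inverseʳ c)) null-0 })))
                        (ℤP.≤-reflexive (∑-δ d))

    window? : ∀ α ℓ c → Dec (α ≤ c × c < α + + ℓ)
    window? α ℓ c = (α ℤP.≤? c) ×-dec (c ℤP.<? α + + ℓ)

    ∑-window : ∀ α ℓ → ∑ (range p) (λ c → 𝟙 (window? α ℓ c)) ≤ + ℓ
    ∑-window α zero    = ℤP.≤-reflexive (trans (∑-cong (range p)
        (λ c → 𝟙-no (window? α 0 c) (λ (h , k) → ℤP.≤⇒≯ h (subst (c <_) (ℤP.+-identityʳ α) k)))) (∑-0 (range p)))
    ∑-window α (suc ℓ) = ℤP.≤-trans (∑-mono (range p) split)
      (subst₂ _≤_ (sym (∑-+ (range p) (λ c → 𝟙 (c ℤP.≟ α + + ℓ)) (λ c → 𝟙 (window? α ℓ c)))) refl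
          (ℤP.+-mono-≤ (∑-𝟙≟ (α + + ℓ)) (∑-window α ℓ)))
      where
      lem : ∀ α l → 1ℤ + (α + l) ≡ α + (1ℤ + l)
      lem = solve-∀
      split : ∀ c → 𝟙 (window? α (suc ℓ) c) ≤ 𝟙 (c ℤP.≟ α + + ℓ) + 𝟙 (window? α ℓ c)
      split c with window? α (suc ℓ) c
      ... | no _ = ℤP.+-mono-≤ (0≤𝟙 (c ℤP.≟ α + + ℓ)) (0≤𝟙 (window? α ℓ c))
      ... | yes (h , k) with ℤP.<-cmp c (α + + ℓ)
      ...   | tri< c< _ _ = ℤP.+-mono-≤ (0≤𝟙 (c ℤP.≟ α + + ℓ)) (ℤP.≤-reflexive (sym (𝟙-yes (window? α ℓ c) (h , c<))))
      ...   | tri≈ _ c≡ _ = ℤP.+-mono-≤ (ℤP.≤-reflexive (sym (𝟙-yes (c ℤP.≟ α + + ℓ) c≡))) (0≤𝟙 (window? α ℓ c))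
      ...   | tri> _ _ c> = ⊥-elim (ℤP.≤⇒≯ (ℤP.i<j⇒suc[i]≤j c>) (subst (c <_) (sym (lem α (+ ℓ))) k))

  module Gaps (D : ℕ) where

    -- The lower bound on b keeps it clear of the point where residues wrap around.
    Gapped : ℤ → ℤ → Set
    Gapped a b = + D ≤ b × (a + + D ≤ b ⊎ b + + D ≤ a)

    gapped? : ∀ a b → Dec (Gapped a b)
    gapped? a b = (+ D ℤP.≤? b) ×-dec ((a + + D ℤP.≤? b) ⊎-dec (b + + D ℤP.≤? a))

    -- Gaps are asked only between neighbours, since the order condition compares only neighbours.
    wellSpaced? : ∀ {N} (v : Vec ℤ N) → Dec (Linked Gapped v)
    wellSpaced? = linked? gapped?

    -- Two shifts in [0, D) differ by less than D and cannot reverse a gap of D. The gap is assumed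
    -- after the shift, because the shifted points are the ones that incidences count.
    order-stable : ∀ a b s r → 0ℤ ≤ s → s < + D → 0ℤ ≤ r → r < + D → (a + s) + + D ≤ b + r ⊎ (b + r) + + D ≤ a + s →
      (a < b → a + s < b + r) × (a + s < b + r → a < b)
    order-stable a b s r 0≤s s<D 0≤r r<D (inj₁ h) =
      (λ _ → <-from-gap (lem₁ a b s r (+ D)) (ℤP.+-mono-≤ (0≤gap h) (ℤP.+-mono-≤ (1+≤ r<D) 0≤r))) ,
      (λ _ → <-from-gap (lem₂ a b s r (+ D)) (ℤP.+-mono-≤ (0≤gap h) (ℤP.+-mono-≤ (1+≤ r<D) 0≤s)))
      where
      lem₁ : ∀ a b s r D → b + r ≡ 1ℤ + (a + s) + ((b + r - (a + s + D)) + ((D - (1ℤ + r)) + r))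
      lem₁ = solve-∀
      lem₂ : ∀ a b s r D → b ≡ 1ℤ + a + ((b + r - (a + s + D)) + ((D - (1ℤ + r)) + s))
      lem₂ = solve-∀
    order-stable a b s r 0≤s s<D 0≤r r<D (inj₂ h) =
      -- Here b lies below a before and after the shift, so both implications are vacuous: the
      -- hypotheses add up to 0 ≤ -2.
      (λ a<b → absurd (subst (0ℤ ≤_) (lem₁ a b s r (+ D))
          (ℤP.+-mono-≤ (0≤gap h) (ℤP.+-mono-≤ (1+≤ a<b) (ℤP.+-mono-≤ (1+≤ s<D) 0≤r))))) ,
      (λ a<b → absurd (subst (0ℤ ≤_) (lem₂ a b s r (+ D))
          (ℤP.+-mono-≤ (0≤gap h) (ℤP.+-mono-≤ (1+≤ a<b) (ℤP.+-mono-≤ (1+≤ s<D) 0≤s)))))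
      where
      absurd : ∀ {A : Set} → 0ℤ ≤ -[1+ 1 ] → A
      absurd ()
      lem₁ : ∀ a b s r D → (a + s - (b + r + D)) + ((b - (1ℤ + a)) + ((D - (1ℤ + s)) + r)) ≡ -[1+ 1 ]
      lem₁ = solve-∀
      lem₂ : ∀ a b s r D → (a + s - (b + r + D)) + ((b + r - (1ℤ + (a + s))) + ((D - (1ℤ + s)) + s)) ≡ -[1+ 1 ]
      lem₂ = solve-∀

    -- The equation is claimed only for y ≥ D: a residue shifted by less than D that wraps around p
    -- lands below D, where `Gapped` already fails.
    Perturbed : ℤ → ℤ → Set
    Perturbed x y = ∃ λ r → 0ℤ ≤ r × r < + D × (+ D ≤ y → y ≡ x + r)

    ascending-stable : ∀ {N} a s → 0ℤ ≤ s → s < + D → (x y : Vec ℤ N) → Pointwise Perturbed x y →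
      Linked Gapped ((a + s) ∷ y) →
      (Linked _<_ (a ∷ x) → Linked _<_ ((a + s) ∷ y)) × (Linked _<_ ((a + s) ∷ y) → Linked _<_ (a ∷ x))
    ascending-stable a s 0≤s s<D []       []       _ _ = (λ _ → [-]) , (λ _ → [-])
    ascending-stable a s 0≤s s<D (b ∷ bs) (y ∷ ys) ((r , 0≤r , r<D , eq) Pointwise.∷ ps) ((D≤y , apart) Linked.∷ gs)
      with eq D≤y
    ... | refl = (λ { (h Linked.∷ hs) → proj₁ order h Linked.∷ proj₁ rest hs }) ,
                 (λ { (h Linked.∷ hs) → proj₂ order h Linked.∷ proj₂ rest hs })
      where
      order = order-stable a b s r 0≤s s<D 0≤r r<D apart
      rest = ascending-stable b r 0≤r r<D bs ys ps gs

    ascending-perturb : ∀ {N} → 1 ℕ.≤ D → (x y : Vec ℤ N) → Pointwise Perturbed x y →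
      (𝟙 (ascending? (-1ℤ ∷ x)) - 𝟙 (ascending? (-1ℤ ∷ y))) within (1ℤ - 𝟙 (wellSpaced? (-1ℤ ∷ y)))
    ascending-perturb 1≤D x y ps with wellSpaced? (-1ℤ ∷ y)
    ... | yes g = within-resp (sym (trans (cong (_- 𝟙 (ascending? (-1ℤ ∷ y)))
        (𝟙-cong (ascending? (-1ℤ ∷ x)) (ascending? (-1ℤ ∷ y)) (proj₁ st) (proj₂ st)))
        (ℤP.+-inverseʳ (𝟙 (ascending? (-1ℤ ∷ y)))))) (ℤP.≤-refl , ℤP.≤-refl)
      where
      -- The leading -1 is not moved; its shift 0 is below D since D ≥ 1.
      st = ascending-stable -1ℤ 0ℤ ℤP.≤-refl (+<+ 1≤D) x y ps g
    ... | no _ with ascending? (-1ℤ ∷ x) | ascending? (-1ℤ ∷ y)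
    ...   | yes _ | yes _ = 0≤+ 1 , 0≤+ 1
    ...   | yes _ | no _  = ℤP.≤-refl , -≤+
    ...   | no _  | yes _ = -≤+ , ℤP.≤-refl
    ...   | no _  | no _  = 0≤+ 1 , 0≤+ 1

    module _ (p : ℕ) .{{_ : ℕ.NonZero p}} where
      open Windows p

      -- At most D values lie below D, and at most 2D lie within distance D of m.
      ∑-¬gapped : ∀ m → ∑ (range p) (λ c → 1ℤ - 𝟙 (gapped? m c)) ≤ + 3 * + D
      ∑-¬gapped m = ℤP.≤-trans (∑-monoᴬ (All.map (λ {c} → bound c) (range-InRange p)))
        (subst₂ _≤_ (sym (∑-+ (range p) _ _)) (lem (+ D))
            (ℤP.+-mono-≤ (∑-window 0ℤ D) (∑-window (m - + D) (D ℕ.+ D))))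
        where
        lem : ∀ D → D + (D + D) ≡ + 3 * D
        lem = solve-∀
        lem₂ : ∀ m c D → c ≡ m - D + (c + D - (1ℤ + m) + 1ℤ)
        lem₂ = solve-∀
        lem₃ : ∀ m D → m + D ≡ m - D + (D + D)
        lem₃ = solve-∀
        bound : ∀ c → InRange p c → 1ℤ - 𝟙 (gapped? m c) ≤ 𝟙 (window? 0ℤ D c) + 𝟙 (window? (m - + D) (D ℕ.+ D) c)
        bound c (r , _ , refl) with gapped? m c
        ... | yes _ = ℤP.+-mono-≤ (0≤𝟙 (window? 0ℤ D c)) (0≤𝟙 (window? (m - + D) (D ℕ.+ D) c))
        ... | no ¬g with + D ℤP.≤? c
        ...   | no D≰c  = ℤP.+-mono-≤ (ℤP.≤-reflexive (sym
            (𝟙-yes (window? 0ℤ D c) (0≤+ r , subst (c <_) (sym (ℤP.+-identityˡ (+ D))) (ℤP.≰⇒> D≰c)))))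
            (0≤𝟙 (window? (m - + D) (D ℕ.+ D) c))
        ...   | yes D≤c = ℤP.+-mono-≤ (0≤𝟙 (window? 0ℤ D c))
            (ℤP.≤-reflexive (sym (𝟙-yes (window? (m - + D) (D ℕ.+ D) c)
                  ( ≤-from-gap (lem₂ m c (+ D)) (ℤP.+-mono-≤ (1+≤ (ℤP.≰⇒> (λ h → ¬g (D≤c , inj₂ h)))) (0≤+ 1))
                  , subst (c <_) (lem₃ m (+ D)) (ℤP.≰⇒> (λ h → ¬g (D≤c , inj₁ h)))))))

      -- Union bound over the N neighbouring pairs: given the earlier entry, at most 3D values of
      -- the later one are bad. The extra factor p avoids the exponent N - 1.
      count-crowded : ∀ N m → + p * ∑ (cube p N) (λ v → 1ℤ - 𝟙 (wellSpaced? (m ∷ v))) ≤ + 3 * + N * + D * (+ p) ^ N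
      count-crowded zero    m = ℤP.≤-reflexive (lem (+ p) (+ D))
        where
        lem : ∀ p D → p * 0ℤ ≡ + 3 * 0ℤ * D * 1ℤ
        lem = solve-∀
      count-crowded (suc N) m = begin′
        where
        E : ℤ → ℤ
        E c = ∑ (cube p N) (λ v → 1ℤ - 𝟙 (wellSpaced? (c ∷ v)))
        lem₀ : ∀ a b → (1ℤ - a) + (1ℤ - b) ≡ (1ℤ - a * b) + (1ℤ - a) * (1ℤ - b)
        lem₀ = solve-∀
        union : ∀ c v → 1ℤ - 𝟙 (wellSpaced? (m ∷ c ∷ v)) ≤ (1ℤ - 𝟙 (gapped? m c)) + (1ℤ - 𝟙 (wellSpaced? (c ∷ v)))
        union c v = subst (λ i → 1ℤ - i ≤ (1ℤ - 𝟙 (gapped? m c)) + (1ℤ - 𝟙 (wellSpaced? (c ∷ v))))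
            (sym (𝟙-linked gapped? m c v))
          (≤-from-gap (lem₀ (𝟙 (gapped? m c)) (𝟙 (wellSpaced? (c ∷ v))))
              (0≤-* (0≤gap (𝟙≤1 (gapped? m c))) (0≤gap (𝟙≤1 (wellSpaced? (c ∷ v))))))
        step₁ : ∑ (cube p (suc N)) (λ v → 1ℤ - 𝟙 (wellSpaced? (m ∷ v))) ≤ (+ p) ^ N * (+ 3 * + D) + ∑ (range p) E
        step₁ = ℤP.≤-trans (ℤP.≤-reflexive (∑-cube p N _))
            (ℤP.≤-trans (∑-mono (range p) (λ c → ∑-mono (cube p N) (union c)))
          (ℤP.≤-trans (ℤP.≤-reflexive (trans (∑-cong (range p)
              (λ c → trans (∑-+ (cube p N) _ _) (cong (_+ E c) (∑-cube-const p N _))))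
              (trans (∑-+ (range p) _ E) (cong (_+ ∑ (range p) E) (∑-*ˡ (range p) ((+ p) ^ N) _)))))
            (ℤP.+-monoˡ-≤ (∑ (range p) E) (*-monoˡ-≤ (0≤^ p N) (∑-¬gapped m)))))
        step₂ : + p * ∑ (range p) E ≤ + p * (+ 3 * + N * + D * (+ p) ^ N)
        step₂ = subst₂ _≤_ (∑-*ˡ (range p) (+ p) E) (∑-range-const p _) (∑-mono (range p) (λ c → count-crowded N c))
        lem : ∀ p q D n → p * (q * (+ 3 * D)) + p * (+ 3 * n * D * q) ≡ + 3 * (1ℤ + n) * D * (p * q)
        lem = solve-∀
        begin′ : + p * ∑ (cube p (suc N)) (λ v → 1ℤ - 𝟙 (wellSpaced? (m ∷ v))) ≤ + 3 * + suc N * + D * (+ p) ^ suc N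
        begin′ = ℤP.≤-trans (*-monoˡ-≤ (0≤+ p) step₁) (ℤP.≤-trans (ℤP.≤-reflexive (ℤP.*-distribˡ-+ (+ p) _ _))
          (ℤP.≤-trans (ℤP.+-monoʳ-≤ (+ p * ((+ p) ^ N * (+ 3 * + D))) step₂)
              (ℤP.≤-reflexive (lem (+ p) ((+ p) ^ N) (+ D) (+ N)))))

    small? : ∀ {N} (v : Vec ℤ N) → Dec (AllV (_< + D) v)
    small? = AllV.all? (λ c → c ℤP.<? + D)

    ∑-below : ∀ {k} → D ℕ.≤′ k → ∑ (range k) (λ c → 𝟙 (c ℤP.<? + D)) ≡ + D
    ∑-below ℕ.≤′-refl = trans (∑-congᴬ (All.map (λ { {c} (r , r<D , refl) → 𝟙-yes (c ℤP.<? + D) (+<+ r<D) })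
        (range-InRange D)))
      (trans (∑-range-const D 1ℤ) (ℤP.*-identityʳ (+ D)))
    ∑-below {suc k} (ℕ.≤′-step h) = trans (cong₂ _+_ (𝟙-no (+ k ℤP.<? + D)
        (λ { (+<+ k<D) → ℕP.<⇒≱ k<D (ℕP.≤′⇒≤ h) })) (∑-below h)) (ℤP.+-identityˡ _)

    ∑-small : ∀ {p} → D ℕ.≤ p → ∀ N → ∑ (cube p N) (λ v → 𝟙 (small? v)) ≡ (+ D) ^ N
    ∑-small D≤p zero    = refl
    ∑-small {p} D≤p (suc N) = begin
      ∑ (cube p (suc N)) (λ v → 𝟙 (small? v))
        ≡⟨ ∑-cube p N _ ⟩
      ∑ (range p) (λ c → ∑ (cube p N) (λ v → 𝟙 (small? (c ∷ v))))
        ≡⟨ ∑-cong (range p) (λ c → ∑-cong (cube p N) (λ v → trans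
            (𝟙-cong (small? (c ∷ v)) ((c ℤP.<? + D) ×-dec small? v) AllV.uncons (λ (h , hs) → h AllV.∷ hs))
            (𝟙-× (c ℤP.<? + D) (small? v)))) ⟩
      ∑ (range p) (λ c → ∑ (cube p N) (λ v → 𝟙 (c ℤP.<? + D) * 𝟙 (small? v)))
        ≡⟨ ∑-∑-* (range p) (cube p N) _ _ ⟩
      ∑ (range p) (λ c → 𝟙 (c ℤP.<? + D)) * ∑ (cube p N) (λ v → 𝟙 (small? v))
        ≡⟨ cong₂ _*_ (∑-below (ℕP.≤⇒≤′ D≤p)) (∑-small D≤p N) ⟩
      (+ D) ^ suc N ∎

open Spacing

-- Averaging over the shifts by a small cube.

module Equidistribution (p : ℕ) (pr : Prime p) where

  open import Data.Integer using (ℤ; +_; -_; _+_; _*_; _-_; _≤_; _<_; _^_; 1ℤ; -1ℤ; +≤+; +<+)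
  open PrimeModulus p pr
  open Hyperplanes p pr
  open Directions p pr

  redV : ∀ {N} → Vec ℤ N → Vec ℤ N
  redV = Vec.map red

  red-unique : ∀ {c} d → InRange p c → Null (c - d) → c ≡ red d
  red-unique d (r , r<p , refl) h = cong +_ (small-≡ r<p (n%ℕd<d d p)
      (null-lin 1ℤ (- 1ℤ) (lem (+ r) d (red d)) h (red-null d)))
    where
    lem : ∀ r d e → r - e ≡ 1ℤ * (r - d) + - 1ℤ * (e - d)
    lem = solve-∀

  -- Unlike in `∑-pick`, g need not be periodic, as the entries of `range p` are already reduced.
  -- Order conditions require this: they depend on representatives and not on residue classes.
  ∑-red : ∀ d (g : ℤ → ℤ) → ∑ (range p) (λ c → δ (c - d) * g c) ≡ g (red d)
  ∑-red d g = begin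
    ∑ (range p) (λ c → δ (c - d) * g c)        ≡⟨ ∑-congᴬ
        (All.map (λ {c} i → δ-* {c - d} (λ h → cong g (red-unique d i h))) (range-InRange p)) ⟩
    ∑ (range p) (λ c → δ (c - d) * g (red d))  ≡⟨ ∑-*ʳ (range p) (g (red d)) _ ⟩
    ∑ (range p) (λ c → δ (c - d)) * g (red d)  ≡⟨ cong (_* g (red d)) (∑-δ d) ⟩
    1ℤ * g (red d)                             ≡⟨ ℤP.*-identityˡ _ ⟩
    g (red d)                                  ∎

  ∑-redV : ∀ {N} (ψ : Vec ℤ N → ℤ) v → ∑ (cube p N) (λ y → ψ y * Z (y ⊖ v)) ≡ ψ (redV v)
  ∑-redV ψ [] = trans (ℤP.+-identityʳ _) (ℤP.*-identityʳ _)
  ∑-redV {suc N} ψ (d ∷ v) = begin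
    ∑ (cube p (suc N)) (λ y → ψ y * Z (y ⊖ (d ∷ v)))
      ≡⟨ ∑-cube p N _ ⟩
    ∑ (range p) (λ c → ∑ (cube p N) (λ y → ψ (c ∷ y) * Z ((c - d) ∷ (y ⊖ v))))
      ≡⟨ ∑-cong (range p) (λ c → trans (∑-cong (cube p N)
          (λ y → trans (cong (ψ (c ∷ y) *_) (Z-∷ (c - d) (y ⊖ v))) (lem (ψ (c ∷ y)) (δ (c - d)) (Z (y ⊖ v)))))
          (∑-*ˡ (cube p N) (δ (c - d)) _)) ⟩
    ∑ (range p) (λ c → δ (c - d) * ∑ (cube p N) (λ y → ψ (c ∷ y) * Z (y ⊖ v)))
      ≡⟨ ∑-cong (range p) (λ c → cong (δ (c - d) *_) (∑-redV (λ y → ψ (c ∷ y)) v)) ⟩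
    ∑ (range p) (λ c → δ (c - d) * ψ (c ∷ redV v))
      ≡⟨ ∑-red d (λ c → ψ (c ∷ redV v)) ⟩
    ψ (red d ∷ redV v) ∎
    where
    lem : ∀ a b c → a * (b * c) ≡ b * (a * c)
    lem = solve-∀

  module Smoothing (D : ℕ) where
    open Gaps D

    -- If the residue y of r + t is at least D > r, then y - r lies in [0, p) and is congruent to t,
    -- so it is the residue of t.
    red-perturbed : ∀ {r} t → InRange p r → r < + D → Perturbed (red t) (red (r + t))
    red-perturbed t (r , r<p , refl) (+<+ r<D) = + r , 0≤+ r , +<+ r<D , shifted
      where
      y x : ℕ
      y = (+ r + t) %ℕ p
      x = t %ℕ p
      lem : ∀ Y r X t → Y - r - X ≡ 1ℤ * (Y - (r + t)) + - 1ℤ * (X - t)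
      lem = solve-∀
      shifted : + D ≤ + y → + y ≡ + x + + r
      shifted (+≤+ D≤y) = cong +_ (trans (sym (ℕP.m∸n+n≡m r≤y)) (cong (ℕ._+ r) same))
        where
        r≤y : r ℕ.≤ y
        r≤y = ℕP.≤-trans (ℕP.<⇒≤ r<D) D≤y
        diff : + (y ℕ.∸ r) ≡ + y - + r
        diff = trans (sym (ℤP.⊖-≥ r≤y)) (sym (ℤP.m-n≡m⊖n y r))
        same : y ℕ.∸ r ≡ x
        same = small-≡ (ℕP.≤-<-trans (ℕP.m∸n≤m y r) (n%ℕd<d (+ r + t) p)) (n%ℕd<d t p)
          (subst (λ z → Null (z - + x)) (sym diff) (null-lin 1ℤ (- 1ℤ) (lem (+ y) (+ r) (+ x) t)
              (red-null (+ r + t)) (red-null t)))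

    redV-perturbed : ∀ {N} (r t : Vec ℤ N) → AllV (InRange p) r → AllV (_< + D) r → Pointwise Perturbed (redV t)
        (redV (r ⊕ t))
    redV-perturbed []      []      _ _ = Pointwise.[]
    redV-perturbed (r ∷ rs) (t ∷ ts) (i AllV.∷ is) (s AllV.∷ ss) =
        red-perturbed t i s Pointwise.∷ redV-perturbed rs ts is ss

    module _ {n : ℕ} {B : Set} (bs : List B) (w u : B → Vec ℤ (suc n))
      (units : All (λ b → ∃ λ i → Null (head (w b) * i - 1ℤ)) bs)
      (L : ℕ) (roots : ∀ h → ¬ ZeroV h → ∑ bs (λ b → δ (h · w b)) ≤ + L)
      (1≤D : 1 ℕ.≤ D) (D≤p : D ℕ.≤ p)
      where
      open Mixing bs w u units L roots

      line : B → ℤ → Vec ℤ N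
      line b a = u b ⊕ a ⊙ w b

      -- For given x and a exactly one residue vector y is hit, namely the reduction of x plus a
      -- point of the line; the sum over y collapses.
      incidence-redV : ∀ φ ψ → incidence φ ψ ≡ ∑ bs (λ b → ∑ (cube p N)
          (λ x → ∑ (range p) (λ a → φ x * ψ (redV (x ⊕ line b a)))))
      incidence-redV φ ψ = ∑-cong bs (λ b → ∑-cong (cube p N) (λ x → begin
        ∑ (cube p N) (λ y → φ x * ψ y * ∑ (range p) (λ a → Z (y ⊖ x ⊖ u b ⊖ a ⊙ w b)))
          ≡⟨ ∑-cong (cube p N) (λ y → trans (sym (∑-*ˡ (range p) (φ x * ψ y) _)) (∑-cong (range p) (λ a →
               trans (ℤP.*-assoc (φ x) (ψ y) _) (cong (λ z → φ x * (ψ y * Z z)) (⊖-⊕ y x (u b) (a ⊙ w b)))))) ⟩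
        ∑ (cube p N) (λ y → ∑ (range p) (λ a → φ x * (ψ y * Z (y ⊖ (x ⊕ line b a)))))
          ≡⟨ ∑-swap (cube p N) (range p) _ ⟩
        ∑ (range p) (λ a → ∑ (cube p N) (λ y → φ x * (ψ y * Z (y ⊖ (x ⊕ line b a)))))
          ≡⟨ ∑-cong (range p) (λ a → trans (∑-*ˡ (cube p N) (φ x) _) (cong (φ x *_) (∑-redV ψ (x ⊕ line b a)))) ⟩
        ∑ (range p) (λ a → φ x * ψ (redV (x ⊕ line b a))) ∎))

      -- Indicators of the cube of side D, of the ascending vectors, and of the vectors that a shift
      -- by the cube might reorder.
      box f e : Vec ℤ N → ℤ
      box v = 𝟙 (small? v)
      f v = 𝟙 (ascending? (-1ℤ ∷ v))
      e v = 1ℤ - 𝟙 (wellSpaced? (-1ℤ ∷ v))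

      e-bounded : Bounded e
      e-bounded v with wellSpaced? (-1ℤ ∷ v)
      ... | yes _ = ℤP.≤-refl , 0≤+ 1
      ... | no _  = 0≤+ 1 , ℤP.≤-refl

      S : ℤ
      S = ∑ bs (λ b → ∑ (range p) (λ a → f (redV (line b a))))

      smoothing : ((+ D) ^ N * S - incidence box f) within incidence box e
      smoothing = subst₂ _within_ (sym eq-l) (sym (incidence-redV box e))
        (∑-within bs (All.universal (λ b → ∑-within (cube p N)
            (All.map (λ {x} i → ∑-within (range p) (All.universal (λ a → pointwise b x a i) (range p)))
            (cube-All p N))) bs))
        where
        eq-l : (+ D) ^ N * S - incidence box f ≡ ∑ bs (λ b → ∑ (cube p N)
            (λ x → ∑ (range p) (λ a → box x * (f (redV (line b a)) - f (redV (x ⊕ line b a))))))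
        eq-l = begin
          (+ D) ^ N * S - incidence box f
            ≡⟨ cong₂ _-_ (trans (cong (_* S) (sym (∑-small D≤p N)))
                (trans (sym (∑-∑-* (cube p N) bs box _)) (∑-swap (cube p N) bs _))) (incidence-redV box f) ⟩
          ∑ bs (λ b → ∑ (cube p N) (λ x → box x * ∑ (range p) (λ a → f (redV (line b a))))) - ∑ bs
              (λ b → ∑ (cube p N) (λ x → ∑ (range p) (λ a → box x * f (redV (x ⊕ line b a)))))
            ≡⟨ sym (∑-- bs _ _) ⟩
          ∑ bs (λ b → ∑ (cube p N) (λ x → box x * ∑ (range p) (λ a → f (redV (line b a)))) - ∑ (cube p N)
              (λ x → ∑ (range p) (λ a → box x * f (redV (x ⊕ line b a)))))
            ≡⟨ ∑-cong bs (λ b → trans (sym (∑-- (cube p N) _ _)) (∑-cong (cube p N) (λ x →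
                 trans (cong (λ t → t - ∑ (range p) (λ a → box x * f (redV (x ⊕ line b a))))
                     (sym (∑-*ˡ (range p) (box x) _)))
                   (trans (sym (∑-- (range p) _ _)) (∑-cong (range p)
                       (λ a → lem (box x) (f (redV (line b a))) (f (redV (x ⊕ line b a))))))))) ⟩
          ∑ bs (λ b → ∑ (cube p N) (λ x → ∑ (range p) (λ a → box x *
              (f (redV (line b a)) - f (redV (x ⊕ line b a)))))) ∎
          where
          lem : ∀ a b c → a * b - a * c ≡ a * (b - c)
          lem = solve-∀
        pointwise : ∀ b x a → AllV (InRange p) x → (box x * (f (redV (line b a)) - f (redV (x ⊕ line b a))))
            within (box x * e (redV (x ⊕ line b a)))
        pointwise b x a i with small? x
        ... | no _  = ℤP.≤-refl , ℤP.≤-refl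
        ... | yes s = within-* (0≤+ 1) (ascending-perturb 1≤D (redV (line b a)) (redV (x ⊕ line b a))
            (redV-perturbed x (line b a) i s))

      -- `mixing` is applied twice: from both sides to the ascending vectors, and from above to the
      -- crowded ones that bound the smoothing error. Hence the factor 2 before L.
      equidistribution : ((+ p) ^ n * ((+ D) ^ N * S) - + length bs * ((+ D) ^ N * ∑ (cube p N) f)) within
        (+ length bs * ((+ D) ^ N * ∑ (cube p N) e) + + 2 * (+ L * ((+ p) ^ N * (+ p) ^ N)))
      equidistribution = within-resp (lem₁ q ((+ D) ^ N * S) (incidence box f)
          (+ length bs * ((+ D) ^ N * ∑ (cube p N) f)))
        (within-≤ bound (within-+ (within-* (0≤^ p n) smoothing) mix-f))
        where
        q E : ℤ
        q = (+ p) ^ n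
        E = + L * ((+ p) ^ N * (+ p) ^ N)
        b-bounded : Bounded box
        b-bounded v = 0≤𝟙 (small? v) , 𝟙≤1 (small? v)
        f-bounded : Bounded f
        f-bounded v = 0≤𝟙 (ascending? (-1ℤ ∷ v)) , 𝟙≤1 (ascending? (-1ℤ ∷ v))
        mix-f : (q * incidence box f - + length bs * ((+ D) ^ N * ∑ (cube p N) f)) within E
        mix-f = subst (λ d → (q * incidence box f - + length bs * (d * ∑ (cube p N) f)) within E) (∑-small D≤p N)
            (mixing box f b-bounded f-bounded)
        mix-e : (q * incidence box e - + length bs * ((+ D) ^ N * ∑ (cube p N) e)) ≤ E
        mix-e = subst (λ d → (q * incidence box e - + length bs * (d * ∑ (cube p N) e)) ≤ E) (∑-small D≤p N)
            (proj₁ (mixing box e b-bounded e-bounded))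
        lem₁ : ∀ q a i m → q * (a - i) + (q * i - m) ≡ q * a - m
        lem₁ = solve-∀
        lem₂ : ∀ i m E → m + + 2 * E ≡ i + E + (E - (i - m))
        lem₂ = solve-∀
        bound : q * incidence box e + E ≤ + length bs * ((+ D) ^ N * ∑ (cube p N) e) + + 2 * E
        bound = ≤-from-gap (lem₂ (q * incidence box e) (+ length bs * ((+ D) ^ N * ∑ (cube p N) e)) E) (0≤gap mix-e)

-- Fermat quotients along a column.

module FermatQuotients where

  open import Data.Integer using (ℤ; +_; -_; _+_; _*_; _-_; _≤_; _<_; _^_; 0ℤ; 1ℤ; ∣_∣)

  pos-^ : ∀ m k → + (m ℕ.^ k) ≡ (+ m) ^ k
  pos-^ m zero    = refl
  pos-^ m (suc k) = trans (ℤP.pos-* m (m ℕ.^ k)) (cong (+ m *_) (pos-^ m k))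

  -- The integer quotient is kept next to its residue r: the linearity in a comes from an identity
  -- modulo p², which r alone does not remember.
  record IsFermatQuotient (p n r : ℕ) : Set where
    constructor isFermatQuotient
    field
      quotient : ℤ
      power    : (+ n) ^ (p ℕ.∸ 1) ≡ 1ℤ + + p * quotient
      residue  : (+ p) ∣ (+ r - quotient)
      bound    : r ℕ.< p

  fermatQuotient-correct : ∀ k n → 1 ℕ.≤ n → (+ suc k) ∣ ((+ n) ^ k - 1ℤ) → IsFermatQuotient (suc k) n
      (fermatQuotient (suc k) n)
  fermatQuotient-correct k n 1≤n d = isFermatQuotient (+ Q) power (divides (- (+ (Q ℕDM./ suc k))) residue)
      (ℕDM.m%n<n Q (suc k))
    where
    m Q : ℕ
    m = n ℕ.^ k ℕ.∸ 1
    Q = m ℕDM./ suc k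
    1≤n^k : 1 ℕ.≤ n ℕ.^ k
    1≤n^k = subst (ℕ._≤ n ℕ.^ k) (ℕP.^-zeroˡ k) (ℕP.^-monoˡ-≤ k 1≤n)
    m-eq : + m ≡ (+ n) ^ k - 1ℤ
    m-eq = trans (sym (ℤP.⊖-≥ 1≤n^k)) (trans (sym (ℤP.m-n≡m⊖n (n ℕ.^ k) 1)) (cong (_- 1ℤ) (pos-^ n k)))
    m-div : suc k ℕD.∣ m
    m-div = ∣⇒∣ᵤ (subst ((+ suc k) ∣_) (sym m-eq) d)
    lem : ∀ x → x ≡ 1ℤ + (x - 1ℤ)
    lem = solve-∀
    power : (+ n) ^ k ≡ 1ℤ + + suc k * + Q
    power = trans (lem ((+ n) ^ k)) (cong (λ z → 1ℤ + z)
        (trans (sym m-eq) (trans (cong +_ (sym (ℕDM.m*[n/m]≡n m-div))) (ℤP.pos-* (suc k) Q))))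
    lem₂ : ∀ r q p → r - (r + q * p) ≡ - q * p
    lem₂ = solve-∀
    residue : + (Q ℕDM.% suc k) - + Q ≡ - (+ (Q ℕDM./ suc k)) * + suc k
    residue = trans (cong (λ z → + (Q ℕDM.% suc k) - z)
        (trans (cong +_ (ℕDM.m≡m%n+[m/n]*n Q (suc k))) (trans (ℤP.pos-+ (Q ℕDM.% suc k) (Q ℕDM./ suc k ℕ.* suc k))
        (cong (λ z → + (Q ℕDM.% suc k) + z) (ℤP.pos-* (Q ℕDM./ suc k) (suc k))))))
      (lem₂ (+ (Q ℕDM.% suc k)) (+ (Q ℕDM./ suc k)) (+ suc k))

  -- Expansion to second order in z. The factor β turns the linear coefficient k β^(k-1) into k β^k
  -- and so avoids the exponent k - 1.
  power-expand : ∀ β z k → ∃ λ T → β * (β + z) ^ k ≡ β * β ^ k + + k * z * β ^ k + z * z * T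
  power-expand β z zero    = 0ℤ , lem β z
    where
    lem : ∀ β z → β * 1ℤ ≡ β * 1ℤ + 0ℤ * z * 1ℤ + z * z * 0ℤ
    lem = solve-∀
  power-expand β z (suc k) with power-expand β z k
  ... | T , eq = + k * β ^ k + (β + z) * T , trans (lem₁ β (β + z) ((β + z) ^ k))
      (trans (cong ((β + z) *_) eq) (lem₂ β z (β ^ k) (+ k) T))
    where
    lem₁ : ∀ β y Y → β * (y * Y) ≡ y * (β * Y)
    lem₁ = solve-∀
    lem₂ : ∀ β z B k T → (β + z) * (β * B + k * z * B + z * z * T) ≡ β * (β * B) + (1ℤ + k) * z *
        (β * B) + z * z * (k * B + (β + z) * T)
    lem₂ = solve-∀

  module FermatQuotientLine (p : ℕ) (pr : Prime p) where
    open PrimeModulus p pr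

    quotient-of : ∀ n → ¬ Null (+ n) → IsFermatQuotient p n (fermatQuotient p n)
    quotient-of zero    n≢0 = ⊥-elim (n≢0 null-0)
    quotient-of (suc n) n≢0 = go p refl
      where
      go : ∀ q → q ≡ p → IsFermatQuotient p (suc n) (fermatQuotient p (suc n))
      go zero    e = ⊥-elim (ℕ.≢-nonZero⁻¹ p (sym e))
      go (suc k) e = subst (λ P → IsFermatQuotient P (suc n) (fermatQuotient P (suc n))) e
        (fermatQuotient-correct k (suc n) (ℕ.s≤s ℕ.z≤n)
            (subst (λ P → (+ P) ∣ ((+ suc n) ^ (P ℕ.∸ 1) - 1ℤ)) (sym e) (fermat-unit (+ suc n) n≢0)))

    p-cast : + p ≡ 1ℤ + + (p ℕ.∸ 1)
    p-cast = cong +_ (sym (ℕP.m+[n∸m]≡n (ℕ.>-nonZero⁻¹ p)))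

    -- With z = α p and exponent p - 1 the expansion gives β p (Qα - Q₀) ≡ (p - 1) α p β^(p-1)
    -- modulo p². Cancelling p and using β^(p-1) ≡ 1 leaves - α.
    quotient-difference : ∀ α β Qα Q₀ → (+ α * + p + β) ^ (p ℕ.∸ 1) ≡ 1ℤ + + p * Qα → β ^ (p ℕ.∸ 1) ≡ 1ℤ + + p * Q₀ →
      Null (β * (Qα - Q₀) + + α)
    quotient-difference α β Qα Q₀ eα e₀ = go (power-expand β (+ α * + p) k)
      where
      k = p ℕ.∸ 1
      a P K : ℤ
      a = + α
      P = + p
      K = + k
      cancel : ∀ {x y} → P * x ≡ P * y → x ≡ y
      cancel {x} {y} = ℤP.*-cancelˡ-≡ P x y
      lem₁ : ∀ β P Qα Q₀ → P * (β * (Qα - Q₀)) ≡ β * (1ℤ + P * Qα) - β * (1ℤ + P * Q₀)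
      lem₁ = solve-∀
      lem₂ : ∀ β P Q₀ K a T B → β * B + K * (a * P) * B + (a * P) * (a * P) * T - β * B ≡ P *
          (K * a * B + a * a * P * T)
      lem₂ = solve-∀
      lem₃ : ∀ P Q₀ K a T → K * a * (1ℤ + P * Q₀) + a * a * P * T + a ≡ (K * a * Q₀ + a * a * T) * P + a * (1ℤ + K)
      lem₃ = solve-∀
      lem₄ : ∀ x a P → x * P + a * P ≡ (x + a) * P
      lem₄ = solve-∀
      go : (∃ λ T → β * (β + a * P) ^ k ≡ β * β ^ k + K * (a * P) * β ^ k + (a * P) * (a * P) * T) → Null
          (β * (Qα - Q₀) + a)
      go (T , ex) = divides (K * a * Q₀ + a * a * T + a) (begin
        β * (Qα - Q₀) + a
          ≡⟨ cong (_+ a) (cancel (trans (lem₁ β P Qα Q₀)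
              (trans (cong₂ (λ x y → β * x - β * y) (sym (trans (cong (_^ k) (ℤP.+-comm β (a * P))) eα)) (sym e₀))
               (trans (cong (_- β * β ^ k) ex) (lem₂ β P Q₀ K a T (β ^ k)))))) ⟩
        K * a * β ^ k + a * a * P * T + a
          ≡⟨ cong (λ B → K * a * B + a * a * P * T + a) e₀ ⟩
        K * a * (1ℤ + P * Q₀) + a * a * P * T + a
          ≡⟨ lem₃ P Q₀ K a T ⟩
        (K * a * Q₀ + a * a * T) * P + a * (1ℤ + K)
          ≡⟨ cong (λ z → (K * a * Q₀ + a * a * T) * P + a * z) (sym p-cast) ⟩
        (K * a * Q₀ + a * a * T) * P + a * P
          ≡⟨ lem₄ (K * a * Q₀ + a * a * T) a P ⟩
        (K * a * Q₀ + a * a * T + a) * P ∎)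

    argument : ∀ α β → + (α ℕ.* p ℕ.+ β) ≡ + α * + p + + β
    argument α β = trans (ℤP.pos-+ (α ℕ.* p) β) (cong (_+ + β) (ℤP.pos-* α p))

    argument-unit : ∀ α β → ¬ Null (+ β) → ¬ Null (+ (α ℕ.* p ℕ.+ β))
    argument-unit α β β≢0 h = β≢0 (null-lin 1ℤ (- + α) (lem (+ α) (+ p) (+ β)) (subst Null (argument α β) h)
        (divides 1ℤ (sym (ℤP.*-identityˡ (+ p)))))
      where
      lem : ∀ a p b → b ≡ 1ℤ * (a * p + b) + - a * p
      lem = solve-∀

    A-bound : ∀ α β → ¬ Null (+ β) → A p α β ℕ.< p
    A-bound α β β≢0 = IsFermatQuotient.bound (quotient-of (α ℕ.* p ℕ.+ β) (argument-unit α β β≢0))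

    A-line : ∀ α β w → ¬ Null (+ β) → Null (+ β * w + 1ℤ) → Null (+ A p α β - (+ A p 0 β + + α * w))
    A-line α β w β≢0 inv = null-cancel (+ β) _ β≢0
      (null-+ (lem b Aα A₀ Qα.quotient Q₀.quotient (+ α) w)
        (null-+ refl (quotient-difference α b Qα.quotient Q₀.quotient
            (trans (cong (_^ (p ℕ.∸ 1)) (sym (argument α β))) Qα.power) Q₀.power) (null-* (- + α) refl inv))
        (null-+ refl (null-* b refl Qα.residue) (null-* (- b) refl Q₀.residue)))
      where
      b Aα A₀ : ℤ
      b = + β
      Aα = + A p α β
      A₀ = + A p 0 β
      module Qα = IsFermatQuotient (quotient-of (α ℕ.* p ℕ.+ β) (argument-unit α β β≢0))
      module Q₀ = IsFermatQuotient (quotient-of (0 ℕ.* p ℕ.+ β) (argument-unit 0 β β≢0))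
      lem : ∀ b Aα A₀ Qα Q₀ a w → b * (Aα - (A₀ + a * w)) ≡
        ((b * (Qα - Q₀) + a) + - a * (b * w + 1ℤ)) + (b * (Aα - Qα) + - b * (A₀ - Q₀))
      lem = solve-∀

open FermatQuotients

-- From the pattern count to lines, with all error terms.

module Patterns where

  open import Data.Integer using (ℤ; +_; -[1+_]; -_; _+_; _*_; _-_; _≤_; _<_; _^_; 0ℤ; 1ℤ; -1ℤ; ∣_∣; +≤+; +<+;
      -≤+; -<+; Positive; positive)

  ∑-upTo : ∀ k (h : ℕ → ℤ) → ∑ (upTo k) h ≡ ∑ (range k) (λ c → h ∣ c ∣)
  ∑-upTo zero    h = refl
  ∑-upTo (suc k) h = begin
    ∑ (upTo (suc k)) h                ≡⟨ cong (λ xs → ∑ xs h) (ListP.upTo-∷ʳ k) ⟨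
    ∑ (upTo k ∷ʳ k) h       ≡⟨ ∑-++ (upTo k) (k ∷ []) h ⟩
    ∑ (upTo k) h + (h k + 0ℤ)         ≡⟨ cong₂ _+_ (∑-upTo k h) (ℤP.+-identityʳ (h k)) ⟩
    ∑ (range k) (λ c → h ∣ c ∣) + h k ≡⟨ ℤP.+-comm _ (h k) ⟩
    ∑ (range (suc k)) (λ c → h ∣ c ∣) ∎

  linked-tabulate⁺ : ∀ {m} (g : Fin (suc m) → ℤ) → (∀ k → g (inject₁ k) < g (fsuc k)) → Linked _<_ (tabulate g)
  linked-tabulate⁺ {zero}  g h = [-]
  linked-tabulate⁺ {suc m} g h = h fzero Linked.∷ linked-tabulate⁺ (g ∘ fsuc) (h ∘ fsuc)

  linked-tabulate⁻ : ∀ {m} (g : Fin (suc m) → ℤ) → Linked _<_ (tabulate g) → ∀ k → g (inject₁ k) < g (fsuc k)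
  linked-tabulate⁻ {suc m} g (h Linked.∷ hs) fzero    = h
  linked-tabulate⁻ {suc m} g (h Linked.∷ hs) (fsuc k) = linked-tabulate⁻ (g ∘ fsuc) hs k

  tabulate-line : ∀ {m} (φ : ℤ → ℤ) (f g : Fin m → ℤ) a →
    Vec.map φ (tabulate f ⊕ a ⊙ tabulate g) ≡ tabulate (λ k → φ (f k + a * g k))
  tabulate-line {zero}  φ f g a = refl
  tabulate-line {suc m} φ f g a = cong (φ (f fzero + a * g fzero) ∷_) (tabulate-line φ (f ∘ fsuc) (g ∘ fsuc) a)

  abs-bounds : ∀ {M} z → ∣ z ∣ ℕ.≤ M → - + M ≤ z × z ≤ + M
  abs-bounds {M} (+ k)     h = ℤP.≤-trans (ℤP.neg-mono-≤ (0≤+ M)) (0≤+ k) , +≤+ h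
  abs-bounds {M} -[1+ k ]  h = ℤP.neg-mono-≤ (+≤+ h) , -≤+

  ^-positive : ∀ k m → 1 ℕ.≤ k → Positive ((+ k) ^ m)
  ^-positive (suc k) m _ = subst Positive (pos-^ (suc k) m) (positive (+<+ (ℕP.m^n>0 (suc k) m)))

  module Assembly (p : ℕ) (pr : Prime p) {n : ℕ} (v : Shifts n) (M : ℕ)
    (bounded : ∀ j → (∣ proj₁ (v j) ∣ ℕ.≤ M) × (∣ proj₂ (v j) ∣ ℕ.≤ M))
    (distinct : Injective _≡_ _≡_ (proj₂ ∘ v))
    (σ : Permutation′ (suc n)) (2M<p : M ℕ.+ M ℕ.< p)
    where

    open PrimeModulus p pr
    open Hyperplanes p pr using (cancel-p)
    open Directions p pr
    open Equidistribution p pr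
    open FermatQuotientLine p pr
    open Windows p

    N : ℕ
    N = suc n

    -- Reordering the shifts by σ turns membership in T(σ, N) into ascending order of the
    -- coordinates.
    s t : Fin N → ℤ
    s k = proj₁ (v (σ ⟨$⟩ʳ k))
    t k = proj₂ (v (σ ⟨$⟩ʳ k))

    ValidRow ValidColumn : ℤ → Set
    ValidRow a = ∀ k → (0ℤ ≤ a + s k) × (a + s k < + p)
    ValidColumn b = (1ℤ ≤ b) × (∀ k → (1ℤ ≤ b + t k) × (b + t k < + p))

    validRow? : ∀ a → Dec (ValidRow a)
    validRow? a = all? (λ k → (0ℤ ℤP.≤? a + s k) ×-dec (a + s k ℤP.<? + p))

    validColumn? : ∀ b → Dec (ValidColumn b)
    validColumn? b = (1ℤ ℤP.≤? b) ×-dec all? (λ k → (1ℤ ℤP.≤? b + t k) ×-dec (b + t k ℤP.<? + p))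

    columns : List ℤ
    columns = filter validColumn? (range p)

    interior : ∀ c z L → ∣ z ∣ ℕ.≤ M → + L + + M ≤ c → c < + p - + M → + L ≤ c + z × c + z < + p
    interior c z L h lo hi =
      ≤-from-gap (lem₁ c z (+ L) (+ M)) (ℤP.+-mono-≤ (0≤gap lo) (0≤gap (proj₁ (abs-bounds z h)))) ,
      <-from-gap (lem₂ c z (+ p) (+ M)) (ℤP.+-mono-≤ (1+≤ hi) (0≤gap (proj₂ (abs-bounds z h))))
      where
      lem₁ : ∀ c z L M → c + z ≡ L + ((c - (L + M)) + (z - - M))
      lem₁ = solve-∀
      lem₂ : ∀ c z p M → p ≡ 1ℤ + (c + z) + ((p - M - (1ℤ + c)) + (M - z))
      lem₂ = solve-∀

    -- Only the L smallest and the M largest residues can fail. Columns use L = M + 1 instead of M,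
    -- as b + t must be at least 1.
    boundary : ∀ {P : ℤ → Set} (P? : ∀ c → Dec (P c)) L → (∀ c → + L ≤ c → c < + p - + M → P c) →
      ∑ (range p) (λ c → 1ℤ - 𝟙 (P? c)) ≤ + L + + M
    boundary P? L inside = ℤP.≤-trans (∑-monoᴬ (All.map (λ {c} → pointwise c) (range-InRange p)))
      (subst (_≤ + L + + M) (sym (∑-+ (range p) _ _)) (ℤP.+-mono-≤ (∑-window 0ℤ L) (∑-window (+ p - + M) M)))
      where
      lem : ∀ p M → p ≡ p - M + M
      lem = solve-∀
      pointwise : ∀ c → InRange p c → 1ℤ - 𝟙 (P? c) ≤ 𝟙 (window? 0ℤ L c) + 𝟙 (window? (+ p - + M) M c)
      pointwise c (r , r<p , refl) with P? c
      ... | yes _ = ℤP.+-mono-≤ (0≤𝟙 (window? 0ℤ L c)) (0≤𝟙 (window? (+ p - + M) M c))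
      ... | no ¬P with + L ℤP.≤? c
      ...   | no L≰c  = ℤP.+-mono-≤ (ℤP.≤-reflexive (sym
          (𝟙-yes (window? 0ℤ L c) (0≤+ r , subst (c <_) (sym (ℤP.+-identityˡ (+ L))) (ℤP.≰⇒> L≰c)))))
          (0≤𝟙 (window? (+ p - + M) M c))
      ...   | yes L≤c = ℤP.+-mono-≤ (0≤𝟙 (window? 0ℤ L c)) (ℤP.≤-reflexive (sym (𝟙-yes (window? (+ p - + M) M c)
                (ℤP.≮⇒≥ (λ h → ¬P (inside c L≤c h)) , subst (c <_) (lem (+ p) (+ M)) (+<+ r<p)))))

    ∑-¬validRow : ∑ (range p) (λ a → 1ℤ - 𝟙 (validRow? a)) ≤ + M + + M
    ∑-¬validRow = boundary validRow? M (λ a lo hi k → interior a (s k) 0 (proj₁ (bounded _))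
        (subst (_≤ a) (sym (ℤP.+-identityˡ (+ M))) lo) hi)

    ∑-¬validColumn : ∑ (range p) (λ b → 1ℤ - 𝟙 (validColumn? b)) ≤ + suc M + + M
    ∑-¬validColumn = boundary validColumn? (suc M) (λ b lo hi →
      ℤP.≤-trans (+≤+ (ℕ.s≤s ℕ.z≤n)) lo , (λ k → interior b (t k) 1 (proj₂ (bounded _)) lo hi))

    length-columns : + p - + length columns ≡ ∑ (range p) (λ b → 1ℤ - 𝟙 (validColumn? b))
    length-columns = sym (trans (∑-- (range p) (λ _ → 1ℤ) (λ b → 𝟙 (validColumn? b)))
        (cong₂ _-_ (trans (∑-range-const p 1ℤ) (ℤP.*-identityʳ (+ p)))
      (trans (∑-cong (range p) (λ b → sym (ℤP.*-identityʳ (𝟙 (validColumn? b)))))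
          (trans (sym (∑-filter validColumn? (range p) (λ _ → 1ℤ))) (sym (length-∑ columns))))))

    unit-range : ∀ z → 1ℤ ≤ z → z < + p → ¬ Null z
    unit-range (+ suc r) _ (+<+ r<p) h = ℕP.<⇒≱ r<p (ℕD.∣⇒≤ (∣⇒∣ᵤ h))
    unit-range (+ zero)  (+≤+ ()) _ _

    -- The row shift s only moves the parameter on the line from a to a + s; its contribution is put
    -- into the offset.
    slope offset : ℤ → Fin N → ℤ
    slope b k = - inverse (b + t k)
    offset b k = + A p 0 ∣ b + t k ∣ + s k * slope b k

    w u : ℤ → Vec ℤ N
    w b = tabulate (slope b)
    u b = tabulate (offset b)

    slope-reciprocal : ∀ b → ValidColumn b → ∀ k → Null ((b + t k) * slope b k + 1ℤ)
    slope-reciprocal b (_ , ok) k = null-* (- 1ℤ) (lem (b + t k) (inverse (b + t k)))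
        (inverse-null (b + t k) (unit-range _ (proj₁ (ok k)) (proj₂ (ok k))))
      where
      lem : ∀ z i → z * - i + 1ℤ ≡ - 1ℤ * (z * i - 1ℤ)
      lem = solve-∀

    columns-valid : All ValidColumn columns
    columns-valid = all-filter validColumn? (range p)

    -- Differences of the t_j are at most 2M < p in absolute value, so distinct integers remain
    -- incongruent.
    T-distinct : Distinct (tabulate t)
    T-distinct = allPairs-tabulate⁺ {f = t} (λ {i} {j} i≢j → apart i j i≢j)
      where
      σ-injective : ∀ i j → σ ⟨$⟩ʳ i ≡ σ ⟨$⟩ʳ j → i ≡ j
      σ-injective i j e = trans (sym (inverseˡ σ)) (trans (cong (σ ⟨$⟩ˡ_) e) (inverseˡ σ))
      apart : ∀ i j → i ≢ j → ¬ Null (t i - t j)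
      apart i j i≢j h with ∣ t i - t j ∣ in eq | ∣⇒∣ᵤ h
      ... | zero  | _ = i≢j (σ-injective i j (distinct (ℤP.i-j≡0⇒i≡j (t i) (t j) (ℤP.∣i∣≡0⇒i≡0 eq))))
      ... | suc m | d = ℕP.<⇒≱ (ℕP.≤-<-trans (ℕP.≤-trans (ℕP.≤-reflexive (sym eq))
          (ℕP.≤-trans (ℤP.∣i-j∣≤∣i∣+∣j∣ (t i) (t j)) (ℕP.+-mono-≤ (proj₂ (bounded _)) (proj₂ (bounded _))))) 2M<p)
          (ℕD.∣⇒≤ d)

    columns-incongruent : ∀ b′ → ∑ columns (λ b → δ (b - b′)) ≤ 1ℤ
    columns-incongruent b′ = ℤP.≤-trans (ℤP.≤-reflexive (∑-filter validColumn? (range p) _))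
        (ℤP.≤-trans (∑-mono (range p) (λ b →
      *-mono-≤ {𝟙 (validColumn? b)} {1ℤ} {δ (b - b′)} {δ (b - b′)} (0≤𝟙 (validColumn? b)) (0≤𝟙 (+ p ∣? (b - b′)))
          (𝟙≤1 (validColumn? b)) ℤP.≤-refl))
      (ℤP.≤-reflexive (trans (∑-cong (range p) (λ b → ℤP.*-identityˡ _)) (∑-δ b′))))

    w-reciprocal : All (λ b → NegReciprocals b (tabulate t) (w b)) columns
    w-reciprocal = All.map (λ {b} ok → Pointwise.tabulate⁺ (slope-reciprocal b ok)) columns-valid

    roots : ∀ h → ¬ ZeroV h → ∑ columns (λ b → δ (h · w b)) ≤ + N
    roots = root-count (tabulate t) T-distinct columns columns-incongruent w w-reciprocal

    units : All (λ b → ∃ λ i → Null (head (w b) * i - 1ℤ)) columns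
    units = All.map (λ {b} ok → - (b + t fzero) , null-* (- 1ℤ) (lem (b + t fzero) (slope b fzero))
        (slope-reciprocal b ok fzero)) columns-valid
      where
      lem : ∀ z w → w * - z - 1ℤ ≡ - 1ℤ * (z * w + 1ℤ)
      lem = solve-∀

    point : ℤ → ℤ → Fin N → ℤ
    point a b k = red (offset b k + a * slope b k)

    redV-line : ∀ a b → redV (u b ⊕ a ⊙ w b) ≡ tabulate (point a b)
    redV-line a b = tabulate-line red (offset b) (slope b) a

    -- A congruence between reduced residues is an equality, so comparisons of matrix entries become
    -- comparisons of coordinates on the line.
    entry-point : ∀ α β → ValidRow (+ α) → ValidColumn (+ β) → ∀ k → + entry p v α β (σ ⟨$⟩ʳ k) ≡ point (+ α) (+ β) k
    entry-point α β row column k = red-unique (offset (+ β) k + + α * slope (+ β) k)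
        (entry p v α β (σ ⟨$⟩ʳ k) , A-bound x y unit , refl)
      (subst (λ z → Null (+ A p x y - z)) (trans (cong (λ x → + A p 0 y + x * ω) x-eq)
          (lem (+ A p 0 y) (s k) (+ α) ω)) (A-line x y ω unit recip))
      where
      x y : ℕ
      x = ∣ + α + s k ∣
      y = ∣ + β + t k ∣
      ω : ℤ
      ω = slope (+ β) k
      x-eq : + x ≡ + α + s k
      x-eq = ℤP.0≤i⇒+∣i∣≡i (proj₁ (row k))
      y-eq : + y ≡ + β + t k
      y-eq = ℤP.0≤i⇒+∣i∣≡i (ℤP.≤-trans (0≤+ 1) (proj₁ (proj₂ column k)))
      unit : ¬ Null (+ y)
      unit = subst (¬_ ∘ Null) (sym y-eq) (unit-range _ (proj₁ (proj₂ column k)) (proj₂ (proj₂ column k)))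
      recip : Null (+ y * ω + 1ℤ)
      recip = subst (λ z → Null (z * ω + 1ℤ)) (sym y-eq) (slope-reciprocal (+ β) column k)
      lem : ∀ q s a ω → q + (a + s) * ω ≡ q + s * ω + a * ω
      lem = solve-∀

    Ascends : ℤ → ℤ → Set
    Ascends a b = Linked _<_ (-1ℤ ∷ redV (u b ⊕ a ⊙ w b))

    ascends⁺ : ∀ α β → ValidRow (+ α) → ValidColumn (+ β) → InT p v σ α β → Ascends (+ α) (+ β)
    ascends⁺ α β row column h = subst (λ x → Linked _<_ (-1ℤ ∷ x)) (sym (redV-line (+ α) (+ β)))
      (-<+ Linked.∷ linked-tabulate⁺ (point (+ α) (+ β))
          (λ k → subst₂ _<_ (entry-point α β row column (inject₁ k)) (entry-point α β row column (fsuc k))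
          (+<+ (h k))))

    ascends⁻ : ∀ α β → ValidRow (+ α) → ValidColumn (+ β) → Ascends (+ α) (+ β) → InT p v σ α β
    ascends⁻ α β row column h k with subst (λ x → Linked _<_ (-1ℤ ∷ x)) (redV-line (+ α) (+ β)) h
    ... | _ Linked.∷ hs = ℤP.drop‿+<+ (subst₂ _<_ (sym (entry-point α β row column (inject₁ k)))
        (sym (entry-point α β row column (fsuc k)))
            (linked-tabulate⁻ (point (+ α) (+ β)) hs k))

    good⁺ : ∀ α β → α ℕ.< p → β ℕ.< p → ValidRow (+ α) → ValidColumn (+ β) → Ascends (+ α) (+ β) → good p v σ (α , β)
    good⁺ α β α<p β<p row column h =
      (α<p , ℤP.drop‿+≤+ (proj₁ column) , β<p , λ j → subst Conditions (inverseʳ σ {j})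
          (proj₁ (row (σ ⟨$⟩ˡ j)) , proj₂ (row (σ ⟨$⟩ˡ j)) , proj₂ column (σ ⟨$⟩ˡ j))) ,
      ascends⁻ α β row column h
      where
      Conditions : Fin N → Set
      Conditions j = (0ℤ ≤ + α + proj₁ (v j)) × (+ α + proj₁ (v j) < + p) × (1ℤ ≤ + β + proj₂ (v j)) ×
          (+ β + proj₂ (v j) < + p)

    good-row : ∀ α β → good p v σ (α , β) → ValidRow (+ α)
    good-row α β ((_ , _ , _ , c) , _) k = proj₁ (c (σ ⟨$⟩ʳ k)) , proj₁ (proj₂ (c (σ ⟨$⟩ʳ k)))

    good-column : ∀ α β → good p v σ (α , β) → ValidColumn (+ β)
    good-column α β ((_ , 1≤β , _ , c) , _) = +≤+ 1≤β , (λ k → proj₂ (proj₂ (c (σ ⟨$⟩ʳ k))))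

    module Count (D : ℕ) (1≤D : 1 ℕ.≤ D) (D≤p : D ℕ.≤ p) where
      open Smoothing D using (equidistribution)
      open Gaps D using (wellSpaced?; count-crowded)

      ascends? : ∀ a b → Dec (Ascends a b)
      ascends? a b = ascending? (-1ℤ ∷ redV (u b ⊕ a ⊙ w b))

      -- Invalid columns are discarded exactly, since they have no direction w_b. Rows are kept even
      -- when invalid, because the incidence count needs the whole line; they are the only
      -- discrepancy.
      good-compare : ∀ a b → InRange p a → InRange p b →
        (𝟙 (good? p v σ (∣ a ∣ , ∣ b ∣)) - 𝟙 (validColumn? b) * 𝟙 (ascends? a b)) within (1ℤ - 𝟙 (validRow? a))
      good-compare a b (α , α<p , refl) (β , β<p , refl) with validRow? (+ α)
      ... | yes row = within-resp (sym (trans (cong (λ i → 𝟙 (good? p v σ (α , β)) - i)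
          (sym (𝟙-× (validColumn? b) (ascends? a b))))
              (trans (cong (_- 𝟙 (validColumn? b ×-dec ascends? a b))
                  (𝟙-cong (good? p v σ (α , β)) (validColumn? b ×-dec ascends? a b)
                (λ g → good-column α β g , ascends⁺ α β row (good-column α β g) (proj₂ g))
                    (λ (c , h) → good⁺ α β α<p β<p row c h)))
                (ℤP.+-inverseʳ (𝟙 (validColumn? b ×-dec ascends? a b))))))
            (ℤP.≤-refl , ℤP.≤-refl)
      ... | no ¬row = within-resp (sym (cong₂ _-_ (𝟙-no (good? p v σ (α , β)) (λ g → ¬row (good-row α β g)))
          (sym (𝟙-× (validColumn? b) (ascends? a b))))) (unit-within (validColumn? b ×-dec ascends? a b))
        where
        unit-within : ∀ {P : Set} (d : Dec P) → (0ℤ - 𝟙 d) within 1ℤ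
        unit-within (yes _) = -≤+ , ℤP.≤-refl
        unit-within (no _)  = 0≤+ 1 , 0≤+ 1

      S : ℤ
      S = ∑ columns (λ b → ∑ (range p) (λ a → 𝟙 (ascends? a b)))

      count-∑ : + count p v σ ≡ ∑ (range p) (λ a → ∑ (range p) (λ b → 𝟙 (good? p v σ (∣ a ∣ , ∣ b ∣))))
      count-∑ = begin
        + count p v σ
          ≡⟨ length-∑ (filter (good? p v σ) (cartesianProduct (upTo p) (upTo p))) ⟩
        ∑ (filter (good? p v σ) (cartesianProduct (upTo p) (upTo p))) (λ _ → 1ℤ)
          ≡⟨ trans (∑-filter (good? p v σ) (cartesianProduct (upTo p) (upTo p)) (λ _ → 1ℤ))
              (∑-cong (cartesianProduct (upTo p) (upTo p)) (λ x → ℤP.*-identityʳ (𝟙 (good? p v σ x)))) ⟩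
        ∑ (cartesianProduct (upTo p) (upTo p)) (λ x → 𝟙 (good? p v σ x))
          ≡⟨ ∑-product _,_ (upTo p) (upTo p) _ ⟩
        ∑ (upTo p) (λ α → ∑ (upTo p) (λ β → 𝟙 (good? p v σ (α , β))))
          ≡⟨ ∑-upTo p _ ⟩
        ∑ (range p) (λ a → ∑ (upTo p) (λ β → 𝟙 (good? p v σ (∣ a ∣ , β))))
          ≡⟨ ∑-cong (range p) (λ a → ∑-upTo p (λ β → 𝟙 (good? p v σ (∣ a ∣ , β)))) ⟩
        ∑ (range p) (λ a → ∑ (range p) (λ b → 𝟙 (good? p v σ (∣ a ∣ , ∣ b ∣)))) ∎

      S-∑ : S ≡ ∑ (range p) (λ a → ∑ (range p) (λ b → 𝟙 (validColumn? b) * 𝟙 (ascends? a b)))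
      S-∑ = trans (∑-filter validColumn? (range p) _) (trans
          (∑-cong (range p) (λ b → sym (∑-*ˡ (range p) (𝟙 (validColumn? b)) _))) (∑-swap (range p) (range p) _))

      count-S : (+ count p v σ - S) within (+ p * (+ M + + M))
      count-S = subst (_within (+ p * (+ M + + M))) (sym eq)
          (within-≤ small (∑-within (range p) (All.map (λ {a} i → ∑-within (range p)
          (All.map (λ {b} j → good-compare a b i j) (range-InRange p))) (range-InRange p))))
        where
        eq : + count p v σ - S ≡ ∑ (range p) (λ a → ∑ (range p)
            (λ b → 𝟙 (good? p v σ (∣ a ∣ , ∣ b ∣)) - 𝟙 (validColumn? b) * 𝟙 (ascends? a b)))
        eq = trans (cong₂ _-_ count-∑ S-∑) (trans (sym (∑-- (range p) _ _))
            (∑-cong (range p) (λ a → sym (∑-- (range p) _ _))))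
        small : ∑ (range p) (λ a → ∑ (range p) (λ b → 1ℤ - 𝟙 (validRow? a))) ≤ + p * (+ M + + M)
        small = ℤP.≤-trans (ℤP.≤-reflexive (trans (∑-cong (range p)
            (λ a → ∑-range-const p (1ℤ - 𝟙 (validRow? a)))) (∑-*ˡ (range p) (+ p) _))) (*-monoˡ-≤ (0≤+ p) ∑-¬validRow)

      W : ℤ
      W = + (N ℕ.!)

      d q : ℤ
      d = (+ D) ^ N
      q = (+ p) ^ n

      ℓ F E : ℤ
      ℓ = + length columns
      F = ascendingCount p (ℕ.>-nonZero⁻¹ p) N
      E = ∑ (cube p N) (λ y → 1ℤ - 𝟙 (wellSpaced? (-1ℤ ∷ y)))

      equidistributed : (q * (d * S) - ℓ * (d * F)) within (ℓ * (d * E) + + 2 * (+ N * ((+ p) ^ N * (+ p) ^ N)))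
      equidistributed = equidistribution columns w u units N roots 1≤D D≤p

      F-size : (W * F - + p * q) within (+ N * + N * q)
      F-size = cancel-p (subst (+ p * (W * F - + p * q) ≤_) (lem (+ p) (+ N) q) (proj₁ h)) ,
               cancel-p (subst₂ _≤_ (ℤP.neg-distribʳ-* (+ p) _) (lem (+ p) (+ N) q) (proj₂ h))
        where
        h = ascendingCount-within p (ℕ.>-nonZero⁻¹ p) N
        lem : ∀ p n q → n * n * (p * q) ≡ p * (n * n * q)
        lem = solve-∀

      F-nonneg : 0ℤ ≤ F
      F-nonneg = ∑-nonneg (cube p N) (λ x → 0≤𝟙 (ascending? (-1ℤ ∷ x)))

      E-nonneg : 0ℤ ≤ E
      E-nonneg = ∑-nonneg (cube p N) (λ x → 0≤gap (𝟙≤1 (wellSpaced? (-1ℤ ∷ x))))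

      F-upper : F ≤ + p * q
      F-upper = ℤP.≤-trans (∑-mono (cube p N) (λ x → 𝟙≤1 (ascending? (-1ℤ ∷ x))))
          (ℤP.≤-reflexive (trans (∑-cube-const p N 1ℤ) (ℤP.*-identityʳ _)))

      E-size : E ≤ + 3 * + N * + D * q
      E-size = cancel-p (subst (+ p * E ≤_) (lem (+ p) (+ N) (+ D) q) (count-crowded p N -1ℤ))
        where
        lem : ∀ p n D q → + 3 * n * D * (p * q) ≡ p * (+ 3 * n * D * q)
        lem = solve-∀

      ℓ-lower : + p - ℓ ≤ + suc M + + M
      ℓ-lower = subst (_≤ + suc M + + M) (sym length-columns) ∑-¬validColumn

      ℓ-upper : 0ℤ ≤ + p - ℓ
      ℓ-upper = subst (0ℤ ≤_) (sym length-columns) (∑-nonneg (range p) (λ b → 0≤gap (𝟙≤1 (validColumn? b))))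

      -- All error terms carry the factor p ^ n · p, which cancels together with D ^ N.
      discrepancy : ∀ c → (+ p) ^ N ≤ + c * (+ D * (+ D) ^ N) →
        (W * + count p v σ - + p * + p) within
        (+ p * ((W * (+ M + + M + (+ suc M + + M)) + + N * + N + + 3 * (W * + N) + + 2 * (W * + N) * + c) * + D))
      discrepancy c D-large = cancel (within-resp eq (within-≤ size
        (within-+ (within-+ (within-* (0≤-* (0≤-* 0≤q 0≤d) 0≤W) count-S) (within-* 0≤W equidistributed))
          (within-+ (within-* (0≤-* 0≤d (0≤-* 0≤W F-nonneg)) ℓ-within) (within-* (0≤-* 0≤d (0≤+ p)) F-size)))))
        where
        0≤q : 0ℤ ≤ q
        0≤q = 0≤^ p n
        0≤d : 0ℤ ≤ d
        0≤d = 0≤^ D N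
        0≤W : 0ℤ ≤ W
        0≤W = 0≤+ (N ℕ.!)
        m K X : ℤ
        m = + M + + M
        K = W * (m + (+ suc M + + M)) + + N * + N + + 3 * (W * + N) + + 2 * (W * + N) * + c
        X = W * + count p v σ - + p * + p
        ℓ-within : (ℓ - + p) within (+ suc M + + M)
        ℓ-within = ℤP.≤-trans (subst (_≤ 0ℤ) (flip ℓ (+ p)) (ℤP.neg-mono-≤ ℓ-upper)) (0≤+ (suc M ℕ.+ M)) , subst
            (_≤ + suc M + + M) (flip′ ℓ (+ p)) ℓ-lower
          where
          flip : ∀ l p → - (p - l) ≡ l - p
          flip = solve-∀
          flip′ : ∀ l p → p - l ≡ - (l - p)
          flip′ = solve-∀
        -- Four replacements telescope: the count by S, pⁿ S by ℓ F, the number ℓ of columns by p,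
        -- and N! F by pᴺ.
        identity : ∀ q d W c S l F p → q * d * W * (c - S) + W * (q * (d * S) - l * (d * F)) +
            (d * (W * F) * (l - p) + d * p * (W * F - p * q)) ≡ q * (d * (W * c - p * p))
        identity = solve-∀
        eq : q * d * W * (+ count p v σ - S) + W * (q * (d * S) - ℓ * (d * F)) +
            (d * (W * F) * (ℓ - + p) + d * + p * (W * F - + p * q)) ≡ q * (d * X)
        eq = identity q d W (+ count p v σ) S ℓ F (+ p)
        -- The closing summands are the slack; they are nonnegative by D ≥ 1, the bound on E with ℓ
        -- ≤ p, the lower bound for D, and F ≤ pᴺ.
        collect : ∀ q d W p m l E N m′ F D c →
          q * (d * (p * ((W * (m + m′) + N * N + + 3 * (W * N) + + 2 * (W * N) * c) * D))) ≡
          (q * d * W * (p * m) + W * (l * (d * E) + + 2 * (N * ((p * q) * (p * q)))) +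
              (d * (W * F) * m′ + d * p * (N * N * q))) +
          ((q * d * p * (W * (m + m′) + N * N)) * (D - 1ℤ) +
           (W * d * (p * (+ 3 * N * D * q - E) + E * (p - l)) +
               (+ 2 * W * N * p * q * (c * (D * d) - p * q) + d * W * m′ * (p * q - F))))
        collect = solve-∀
        size : q * d * W * (+ p * m) + W * (ℓ * (d * E) + + 2 * (+ N * ((+ p) ^ N * (+ p) ^ N))) +
            (d * (W * F) * (+ suc M + + M) + d * + p * (+ N * + N * q)) ≤ q * (d * (+ p * (K * + D)))
        size = ≤-from-gap (collect q d W (+ p) m ℓ E (+ N) (+ suc M + + M) F (+ D) (+ c))
          (ℤP.+-mono-≤ (0≤-* (0≤-* (0≤-* (0≤-* 0≤q 0≤d) (0≤+ p))
              (ℤP.+-mono-≤ (0≤-* 0≤W (0≤+ (M ℕ.+ M ℕ.+ (suc M ℕ.+ M)))) (0≤-* (0≤+ N) (0≤+ N)))) (0≤gap (+≤+ 1≤D)))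
          (ℤP.+-mono-≤ (0≤-* (0≤-* 0≤W 0≤d) (ℤP.+-mono-≤ (0≤-* (0≤+ p) (0≤gap E-size)) (0≤-* E-nonneg ℓ-upper)))
          (ℤP.+-mono-≤ (0≤-* (0≤-* (0≤-* (0≤-* (0≤-* (0≤+ 2) 0≤W) (0≤+ N)) (0≤+ p)) 0≤q) (0≤gap D-large))
            (0≤-* (0≤-* (0≤-* 0≤d 0≤W) (0≤+ (suc M ℕ.+ M))) (0≤gap F-upper)))))
        cancel₁ : ∀ {x y} → q * (d * x) ≤ q * (d * y) → x ≤ y
        cancel₁ {x} {y} h = ℤP.*-cancelˡ-≤-pos x y d {{^-positive D N 1≤D}}
            (ℤP.*-cancelˡ-≤-pos (d * x) (d * y) q {{^-positive p n (ℕ.>-nonZero⁻¹ p)}} h)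
        neg : ∀ q d x → - (q * (d * x)) ≡ q * (d * - x)
        neg = solve-∀
        cancel : (q * (d * X)) within (q * (d * (+ p * (K * + D)))) → X within (+ p * (K * + D))
        cancel (a , b) = cancel₁ a , cancel₁ (subst (_≤ q * (d * (+ p * (K * + D)))) (neg q d X) b)

open Patterns

-- Choice of the cube side and the final bound.

open import Data.Nat using (_*_; _^_; _≤_; _<_; _+_; _∸_; ∣_-_∣; z≤n; s≤s; NonZero; _<?_; _≤?_)

^-distribʳ-* : ∀ m n k → (m * n) ^ k ≡ m ^ k * n ^ k
^-distribʳ-* m n zero    = refl
^-distribʳ-* m n (suc k) = trans (cong (m * n *_) (^-distribʳ-* m n k)) (lem m n (m ^ k) (n ^ k))
  where
  lem : ∀ m n a b → m * n * (a * b) ≡ m * a * (n * b)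
  lem = solveℕ-∀

-- The integer part of the root grows by at most one when x does, so a single comparison per step
-- decides it.
root : ∀ k x → ∃ λ D → D ^ suc k ≤ x × x < suc D ^ suc k
root k zero    = 0 , z≤n , ℕP.m^n>0 1 (suc k)
root k (suc x) with root k x
... | D , lo , hi with suc D ^ suc k ≤? suc x
...   | yes h = suc D , h , ℕP.≤-<-trans hi (ℕP.^-monoˡ-< (suc k) (ℕP.n<1+n (suc D)))
...   | no ¬h = D , ℕP.m≤n⇒m≤1+n lo , ℕP.≰⇒> ¬h

within-∣-∣ : ∀ m n b → (+ m ℤ.- + n) within (+ b) → ∣ m - n ∣ ≤ b
within-∣-∣ m n b (h , h′) with ℕP.≤-total m n
... | inj₁ m≤n = subst (_≤ b) (sym (ℕP.m≤n⇒∣m-n∣≡n∸m m≤n))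
    (ℤP.drop‿+≤+ (subst (ℤ._≤ + b) (trans (lem (+ m) (+ n)) (diff m≤n)) h′))
  where
  lem : ∀ m n → ℤ.- (m ℤ.- n) ≡ n ℤ.- m
  lem = solve-∀
  diff : ∀ {a c} → a ≤ c → + c ℤ.- + a ≡ + (c ∸ a)
  diff {a} {c} le = trans (ℤP.m-n≡m⊖n c a) (ℤP.⊖-≥ le)
... | inj₂ n≤m = subst (_≤ b) (sym (trans (ℕP.∣-∣-comm m n) (ℕP.m≤n⇒∣m-n∣≡n∸m n≤m)))
    (ℤP.drop‿+≤+ (subst (ℤ._≤ + b) (trans (ℤP.m-n≡m⊖n m n) (ℤP.⊖-≥ n≤m)) h))

log₂-positive : ∀ p → 2 ≤ p → 1 ≤ ⌊log₂ p ⌋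
log₂-positive p 2≤p = subst (_≤ ⌊log₂ p ⌋) (⌊log₂[2^n]⌋≡n 1) (⌊log₂⌋-mono-≤ 2≤p)

count-≤ : ∀ p {n} (v : Shifts n) σ → count p v σ ≤ p * p
count-≤ p v σ = ℕP.≤-trans (ListP.length-filter (good? p v σ) (cartesianProduct (upTo p) (upTo p)))
  (ℕP.≤-reflexive (ℤP.+-injective length-square))
  where
  length-square : + length (cartesianProduct (upTo p) (upTo p)) ≡ + (p * p)
  length-square = trans (length-∑ (cartesianProduct (upTo p) (upTo p)))
      (trans (∑-product _,_ (upTo p) (upTo p) (λ _ → ℤ.1ℤ))
    (trans (∑-cong (upTo p) (λ _ → sym (length-∑ (upTo p)))) (trans (∑-const _ (upTo p))
      (trans (cong (λ l → + l ℤ.* + l) (ListP.length-upTo p)) (sym (ℤP.pos-* p p))))))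

-- The side D of the smoothing cube balances the boundary term p² D/p against the mixing term p · pᴺ/Dᴺ.
record Scale (N p D : ℕ) : Set where
  field
    D-positive : 1 ≤ D
    D-bounded  : D ≤ p
    D-lower    : p ^ N ≤ 2 ^ suc N * D ^ suc N
    D-upper    : D ^ suc N ≤ p ^ N

-- D is the integer part of p^(N/(N+1)). It is positive as pᴺ ≥ 1, and D + 1 ≤ 2D is the origin of
-- the factor 2^(N+1).
scale : ∀ N p .{{_ : NonZero p}} → ∃ (Scale N p)
scale N p with root N (p ^ N)
... | zero  , _  , hi = ⊥-elim (ℕP.<⇒≱ hi (subst (_≤ p ^ N) (sym (ℕP.^-zeroˡ (suc N))) (ℕP.m^n>0 p N)))
... | suc D , lo , hi = suc D , record
  { D-positive = s≤s z≤n
  ; D-bounded  = ℕP.≮⇒≥ (λ p<D → ℕP.<⇒≱ (ℕP.^-monoˡ-< (suc N) p<D) (ℕP.≤-trans lo (ℕP.^-monoʳ-≤ p (ℕP.n≤1+n N))))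
  ; D-lower    = ℕP.≤-trans (ℕP.<⇒≤ hi) (ℕP.≤-trans (ℕP.^-monoˡ-≤ (suc N) double)
      (ℕP.≤-reflexive (^-distribʳ-* 2 (suc D) (suc N))))
  ; D-upper    = lo
  }
  where
  double : suc (suc D) ≤ 2 * suc D
  double = s≤s (ℕP.≤-trans (ℕP.≤-reflexive (ℕP.+-comm 1 D)) (ℕP.+-monoʳ-≤ D (s≤s z≤n)))

module _ (n M : ℕ) where

  private
    -- The summands of K account, in order, for invalid rows and columns, for the falling factorial
    -- against the power, for crowded vectors, and for the mixing error with the loss from rounding
    -- D.
    N W K : ℕ
    N = suc n
    W = N !
    K = W * (M + M + (suc M + M)) + N * N + 3 * (W * N) + 2 * (W * N) * 2 ^ suc N

  -- The linear bound p K D is raised to the power N + 1, where D^(N+1) ≤ pᴺ yields the exponent 2N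
  -- + 1 without any real root.
  discrepancy-large : (v : Shifts n) → (∀ j → (∣ proj₁ (v j) ∣ ≤ M) × (∣ proj₂ (v j) ∣ ≤ M)) →
    Injective _≡_ _≡_ (proj₂ ∘ v) → (σ : Permutation′ (suc n)) (p : ℕ) → Prime p → M + M < p →
    ∣ count p v σ * W - p ^ 2 ∣ ^ suc N ≤ K ^ suc N * p ^ (2 * N + 1)
  discrepancy-large v bounded distinct σ p pr 2M<p = go (scale N p {{prime⇒nonZero pr}})
    where
    go : ∃ (Scale N p) → _
    go (D , sc) = ℕP.≤-trans (ℕP.^-monoˡ-≤ (suc N) linear) (ℕP.≤-trans (ℕP.≤-reflexive powers)
        (ℕP.≤-trans (ℕP.*-monoʳ-≤ (K ^ suc N) (ℕP.*-monoʳ-≤ (p ^ suc N) D-upper))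
            (ℕP.≤-reflexive (cong (K ^ suc N *_) exponents))))
      where
      open Scale sc
      open Assembly p pr v M bounded distinct σ 2M<p hiding (N)
      open Count D D-positive D-bounded hiding (W)
      large : (+ p) ℤ.^ N ℤ.≤ + (2 ^ suc N) ℤ.* (+ D ℤ.* (+ D) ℤ.^ N)
      large = subst₂ ℤ._≤_ (pos-^ p N) (trans (ℤP.pos-* (2 ^ suc N) (D ^ suc N))
          (cong (+ (2 ^ suc N) ℤ.*_) (pos-^ D (suc N)))) (ℤ.+≤+ D-lower)
      cast-l : + W ℤ.* + count p v σ ℤ.- + p ℤ.* + p ≡ + (count p v σ * W) ℤ.- + (p ^ 2)
      cast-l = cong₂ ℤ._-_ (trans (ℤP.*-comm (+ W) _) (sym (ℤP.pos-* (count p v σ) W)))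
          (trans (sym (ℤP.pos-* p p)) (cong (λ r → + (p * r)) (sym (ℕP.*-identityʳ p))))
      c : ℕ
      c = 2 ^ suc N
      cast-K : + W ℤ.* (+ M ℤ.+ + M ℤ.+ (+ suc M ℤ.+ + M)) ℤ.+ + N ℤ.* + N ℤ.+ + 3 ℤ.* (+ W ℤ.* + N) ℤ.+ + 2 ℤ.*
          (+ W ℤ.* + N) ℤ.* + c ≡ + K
      cast-K = sym (cong₂ ℤ._+_ (cong₂ ℤ._+_ (cong₂ ℤ._+_ (ℤP.pos-* W (M + M + (suc M + M))) (ℤP.pos-* N N))
          (trans (ℤP.pos-* 3 (W * N)) (cong (+ 3 ℤ.*_) (ℤP.pos-* W N))))
        (trans (ℤP.pos-* (2 * (W * N)) c) (cong (ℤ._* + c)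
            (trans (ℤP.pos-* 2 (W * N)) (cong (+ 2 ℤ.*_) (ℤP.pos-* W N))))))
      cast-r : + p ℤ.* (+ K ℤ.* + D) ≡ + (p * (K * D))
      cast-r = sym (trans (ℤP.pos-* p (K * D)) (cong (+ p ℤ.*_) (ℤP.pos-* K D)))
      linear : ∣ count p v σ * W - p ^ 2 ∣ ≤ p * (K * D)
      linear = within-∣-∣ (count p v σ * W) (p ^ 2) (p * (K * D))
        (subst₂ _within_ cast-l (trans (cong (λ k → + p ℤ.* (k ℤ.* + D)) cast-K) cast-r) (discrepancy c large))
      powers : (p * (K * D)) ^ suc N ≡ K ^ suc N * (p ^ suc N * D ^ suc N)
      powers = trans (^-distribʳ-* p (K * D) (suc N)) (trans (cong (p ^ suc N *_) (^-distribʳ-* K D (suc N)))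
          (lem (p ^ suc N) (K ^ suc N) (D ^ suc N)))
        where
        lem : ∀ a b c → a * (b * c) ≡ b * (a * c)
        lem = solveℕ-∀
      exponents : p ^ suc N * p ^ N ≡ p ^ (2 * N + 1)
      exponents = trans (sym (ℕP.^-distribˡ-+-* p (suc N) N)) (cong (p ^_) (lem N))
        where
        lem : ∀ N → suc N + N ≡ 2 * N + 1
        lem = solveℕ-∀

  -- For p ≤ 2M the t_j may collide modulo p, but the trivial bounds by p² are then constants
  -- depending on M and N.
  discrepancy-small : (v : Shifts n) (σ : Permutation′ (suc n)) (p : ℕ) → p ≤ M + M →
    ∣ count p v σ * W - p ^ 2 ∣ ≤ (M + M) * (M + M) * (W + 1)
  discrepancy-small v σ p p≤2M = ℕP.≤-trans (ℕP.∣m-n∣≤m⊔n (count p v σ * W) (p ^ 2))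
      (ℕP.≤-trans (ℕP.m⊔n≤m+n (count p v σ * W) (p ^ 2))
    (ℕP.≤-trans (ℕP.+-mono-≤ (ℕP.*-monoˡ-≤ W (ℕP.≤-trans (count-≤ p v σ) p²))
        (ℕP.≤-trans (ℕP.≤-reflexive (cong (p *_) (ℕP.*-identityʳ p))) p²))
      (ℕP.≤-reflexive (lem ((M + M) * (M + M)) W))))
    where
    p² : p * p ≤ (M + M) * (M + M)
    p² = ℕP.*-mono-≤ p≤2M p≤2M
    lem : ∀ a W → a * W + a ≡ a * (W + 1)
    lem = solveℕ-∀

  C₁ C₂ : ℕ
  C₁ = K ^ suc N
  C₂ = ((M + M) * (M + M) * (W + 1)) ^ suc N

-- Multiplying by N! and raising to the power N + 1 clears fractions and roots, and ⌊log₂ p⌋ agrees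
-- with log p up to a constant factor. C is chosen before the shifts, σ and p, which expresses the
-- uniformity.
theorem2 : (n M : ℕ) → Σ ℕ λ C →
    (v : Shifts n) →
    (∀ j → (∣ proj₁ (v j) ∣ ≤ M) × (∣ proj₂ (v j) ∣ ≤ M)) →
    Injective _≡_ _≡_ (proj₂ ∘ v) →
    (σ : Permutation′ (suc n)) →
    (p : ℕ) → Prime p →
    ∣ count p v σ * ((suc n) !) - p ^ 2 ∣ ^ (suc (suc n))
    ≤ C * (p ^ (2 * suc n + 1) * ⌊log₂ p ⌋ ^ suc n)
theorem2 n M = C₁ n M + C₂ n M , bound
  where
  bound : (v : Shifts n) → (∀ j → (∣ proj₁ (v j) ∣ ≤ M) × (∣ proj₂ (v j) ∣ ≤ M)) → Injective _≡_ _≡_ (proj₂ ∘ v) →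
    (σ : Permutation′ (suc n)) (p : ℕ) → Prime p →
    ∣ count p v σ * ((suc n) !) - p ^ 2 ∣ ^ (suc (suc n)) ≤ (C₁ n M + C₂ n M) *
        (p ^ (2 * suc n + 1) * ⌊log₂ p ⌋ ^ suc n)
  bound v bounded distinct σ p pr with M + M <? p
  ... | yes 2M<p = ℕP.≤-trans (discrepancy-large n M v bounded distinct σ p pr 2M<p)
      (ℕP.*-mono-≤ (ℕP.m≤m+n (C₁ n M) (C₂ n M)) (ℕP.≤-trans (ℕP.≤-reflexive (sym (ℕP.*-identityʳ _)))
          (ℕP.*-monoʳ-≤ (p ^ (2 * suc n + 1)) log-power)))
    where
    log-power : 1 ≤ ⌊log₂ p ⌋ ^ suc n
    log-power = subst (_≤ ⌊log₂ p ⌋ ^ suc n) (ℕP.^-zeroˡ (suc n))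
        (ℕP.^-monoˡ-≤ (suc n) (log₂-positive p (ℕ.nonTrivial⇒n>1 p {{prime⇒nonTrivial pr}})))
  ... | no 2M≮p = ℕP.≤-trans (ℕP.^-monoˡ-≤ (suc (suc n)) (discrepancy-small n M v σ p (ℕP.≮⇒≥ 2M≮p)))
      (ℕP.≤-trans (ℕP.m≤n+m (C₂ n M) (C₁ n M)) (ℕP.≤-trans (ℕP.≤-reflexive (sym (ℕP.*-identityʳ _)))
          (ℕP.*-monoʳ-≤ (C₁ n M + C₂ n M) positive)))
    where
    positive : 1 ≤ p ^ (2 * suc n + 1) * ⌊log₂ p ⌋ ^ suc n
    positive = ℕP.*-mono-≤ {1} {_} {1} (ℕP.m^n>0 p {{prime⇒nonZero pr}} (2 * suc n + 1))
      (subst (_≤ ⌊log₂ p ⌋ ^ suc n) (ℕP.^-zeroˡ (suc n))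
          (ℕP.^-monoˡ-≤ (suc n) (log₂-positive p (ℕ.nonTrivial⇒n>1 p {{prime⇒nonTrivial pr}}))))
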